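{- Let $p$ be a prime, $e,n\ge1$, $r=2en$, $q=p^r$, and let $s>1$ be a divisor of $p^e+1$. Let $h\in\{0,\dots,s-1\}$, $m\ge2$, $a\in\mathbb{F}_q$, $t\mid m$, $d=\gcd(m/t,s)$, $l=\gcd(t,s/d)$, $u=s/(dl)$, $t_0=\frac{q^t-1}{q-1}$, and assume $p\nmid m/t$ and $d\mid h$. Let $i_0$ be the unique integer with $0\le i_0<s/d$ and $\frac{m}{dt}i_0\equiv\frac hd\pmod{s/d}$. (A) If $a=0$: when $l>1$ and $i_0\not\equiv k_l(t)\pmod l$, $N_t=\frac ds\bigl(q^{t-1}-1+(-1)^{nt}(q-1)\sqrt{q^{t-2}}\bigr)$; when $l=1$, or $l>1$ and $i_0\equiv k_l(t)\pmod l$, $N_t=\frac ds\bigl(q^{t-1}-1-(-1)^{nt}(q-1)(l-1)\sqrt{q^{t-2}}\bigr)$. (B) If $a\neq0$, put $a_0=-\frac{m}{ta}$ and $D=k_{s/d}(t)-i_0-\mathrm{ind}_{\gamma_t}a_0$. When $l\nmid D$, $N_t=\frac ds\bigl(q^{t-1}-(-1)^{nt}\sqrt{q^{t-2}}\bigr)$. When $l\mid D$, let $j_0\in\{0,\dots,u-1\}$ be the unique solution of $\frac{t_0}{l}j\equiv\frac Dl\pmod u$; then if $u>1$ and $j_0\not\equiv k_u(1)\pmod u$, $N_t=\frac ds\bigl(q^{t-1}-(-1)^{nt}\bigl(((-1)^n\sqrt q-1)l+1\bigr)\sqrt{q^{t-2}}\bigr)$, while if $u=1$, or $u>1$ and $j_0\equiv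 k_u(1)\pmod u$, $N_t=\frac ds\bigl(q^{t-1}-(-1)^{nt}\bigl(((-1)^{n-1}(u-1)\sqrt q-1)l+1\bigr)\sqrt{q^{t-2}}\bigr)$. In particular, if $a=0$ and $l=1$ then $N_t=\frac ds(q^{t-1}-1)$, and if $a\ne0$ and $d=s$ then $N_t=q^{t-1}$.
   Context: $\mathrm{Tr}_k,\mathrm{Nm}_k$ are trace and norm $\mathbb{F}_{q^k}\to\mathbb{F}_q$. $\gamma_m$ is a fixed primitive element of $\mathbb{F}_{q^m}$, $\gamma_t$ its norm to $\mathbb{F}_{q^t}$ (primitive in $\mathbb{F}_{q^t}$), $g=\mathrm{Nm}_m(\gamma_m)$. $N_t$ is the number of $x\in\mathbb{F}_{q^t}$ with $\mathrm{Tr}_m(x)=a$ and $\mathrm{Nm}_m(x)\in g^h\langle g^s\rangle$. $\mathrm{ind}_{\gamma_t}a_0$ is the discrete logarithm of $a_0\in\mathbb{F}_q^*\subseteq\mathbb{F}_{q^t}^*$ to base $\gamma_t$. For a positive divisor $N$ of $p^e+1$ and an integer $t'\ge1$, define $k_N(t')=N/2$ if $p>2$, $nt'$ is odd and $(p^e+1)/N$ is odd, and $k_N(t')=0$ otherwise. -}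

module Defs where

open import Level using (Level; _⊔_) renaming (suc to lsuc)
open import Data.Bool using (Bool; true; false; if_then_else_; _∧_)
open import Data.Nat as ℕ using (ℕ; zero; suc; _≡ᵇ_)
import Data.Nat.DivMod as ℕD
open import Data.Integer as ℤ using (ℤ; +_)
open import Data.Rational as ℚ using (ℚ)
open import Data.Fin using (Fin; toℕ)
open import Data.Fin.Properties using (any?)
open import Data.Product using (Σ; ∃; _×_; _,_)
open import Relation.Nullary using (¬_; Dec; yes; no)
open import Relation.Nullary.Decidable using (⌊_⌋; _×-dec_)
open import Relation.Binary using (Decidable)
open import Relation.Binary.PropositionalEquality using (_≡_)
open import Algebra.Bundles using (CommutativeRing)

-- truncated division, only used where the divisor is known to be
-- nonzero and to divide exactly
_div_ : ℕ → ℕ → ℕ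
x div zero = zero
x div (suc y) = ℕD._/_ x (suc y)

isOdd : ℕ → Bool
isOdd x = ℕD._%_ x 2 ≡ᵇ 1

_∣ℤ_ : ℤ → ℤ → Set
a ∣ℤ b = ∃ λ c → b ≡ c ℤ.* a

_≡_[modℤ_] : ℤ → ℤ → ℕ → Set
a ≡ b [modℤ N ] = (+ N) ∣ℤ (a ℤ.- b)

kN : (p e n N t' : ℕ) → ℕ
kN p e n N t' =
  if (isOdd p) ∧ isOdd (n ℕ.* t') ∧ isOdd ((p ℕ.^ e ℕ.+ 1) div N)
  then N div 2 else 0

ℕtoℚ : ℕ → ℚ
ℕtoℚ x = (+ x) ℚ./ 1

_/ℚ_ : ℚ → ℕ → ℚ
x /ℚ zero = ℚ.0ℚ
x /ℚ (suc y) = x ℚ.* (+ 1 ℚ./ suc y)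

sgn : ℕ → ℚ
sgn k = if isOdd k then ℚ.- ℚ.1ℚ else ℚ.1ℚ

-- sqrt(q^(t-2)) for q = p^(2en), i.e. p^(e n t) / p^(2 e n)  (t ≥ 1)
sqrtQPow : (p e n t : ℕ) → ℚ
sqrtQPow p e n t = ℕtoℚ (p ℕ.^ (e ℕ.* n ℕ.* t)) /ℚ (p ℕ.^ (2 ℕ.* e ℕ.* n))

record FiniteField (c ℓ : Level) : Set (lsuc (c ⊔ ℓ)) where
  field
    commRing : CommutativeRing c ℓ
  open CommutativeRing commRing public
  field
    0≉1      : ¬ (0# ≈ 1#)
    inverse  : ∀ x → ¬ (x ≈ 0#) → ∃ λ y → x * y ≈ 1#
    _≟_      : Decidable _≈_
    size     : ℕ
    enum     : Fin size → Carrier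
    enum-inj : ∀ i j → enum i ≈ enum j → i ≡ j
    enum-sur : ∀ x → ∃ λ i → enum i ≈ x

module FF {c ℓ : Level} (K : FiniteField c ℓ) where
  open FiniteField K

  pow : Carrier → ℕ → Carrier
  pow x zero = 1#
  pow x (suc k) = x * pow x k

  ι : ℕ → Carrier
  ι zero = 0#
  ι (suc k) = 1# + ι k

  sumTo : ℕ → (ℕ → Carrier) → Carrier
  sumTo zero f = 0#
  sumTo (suc k) f = sumTo k f + f k

  prodTo : ℕ → (ℕ → Carrier) → Carrier
  prodTo zero f = 1#
  prodTo (suc k) f = prodTo k f * f k

  Tr : (q m : ℕ) → Carrier → Carrier
  Tr q m x = sumTo m (λ i → pow x (q ℕ.^ i))

  Nm : (q m : ℕ) → Carrier → Carrier
  Nm q m x = prodTo m (λ i → pow x (q ℕ.^ i))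

  -- relative norm F_{q^m} → F_{q^t}, m = k t : Π_{i<k} x^{q^{t i}}
  NmRel : (q t k : ℕ) → Carrier → Carrier
  NmRel q t k x = prodTo k (λ i → pow x (q ℕ.^ (t ℕ.* i)))

  InSub : (q t : ℕ) → Carrier → Set ℓ
  InSub q t x = pow x (q ℕ.^ t) ≈ x

  Primitive : Carrier → Set (c ⊔ ℓ)
  Primitive γ = ∀ x → ¬ (x ≈ 0#) → ∃ λ k → pow γ k ≈ x

  -- y ∈ g^h ⟨g^s⟩, where ⟨g^s⟩ = { (g^s)^k : 0 ≤ k < ord g } and ord g = q - 1

  InCoset : (q : ℕ) (g : Carrier) (h s : ℕ) → Carrier → Set ℓ
  InCoset q g h s y = Σ (Fin (q ℕ.∸ 1)) λ k → y ≈ pow g (h ℕ.+ s ℕ.* toℕ k)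

  inCoset? : (q : ℕ) (g : Carrier) (h s : ℕ) → ∀ y → Dec (InCoset q g h s y)
  inCoset? q g h s y = any? (λ k → y ≟ pow g (h ℕ.+ s ℕ.* toℕ k))

  countFin : (N : ℕ) → (Fin N → Bool) → ℕ
  countFin zero f = 0
  countFin (suc N) f =
    (if f Fin.zero then 1 else 0) ℕ.+ countFin N (λ i → f (Fin.suc i))
    where import Data.Fin as Fin

  Ncount : (q m t h s : ℕ) (a γm : Carrier) → ℕ
  Ncount q m t h s a γm =
    countFin size (λ i →
      ⌊ (pow (enum i) (q ℕ.^ t) ≟ enum i)
        ×-dec ((Tr q m (enum i) ≟ a)
        ×-dec inCoset? q (Nm q m γm) h s (Nm q m (enum i))) ⌋)

  F : Set c
  F = Carrier

  _≈F_ : Carrier → Carrier → Set ℓ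
  _≈F_ = _≈_

  _·_ : Carrier → Carrier → Carrier
  _·_ = _*_

  negF : Carrier → Carrier
  negF = -_

  0F : Carrier
  0F = 0#

  1F : Carrier
  1F = 1#

  card : ℕ
  card = size

  infix 4 _≈F_
  infixl 7 _·_

{-# OPTIONS --safe #-}
module Submission where

-- Write x = γ_t^i.  The norm condition becomes i ≡ i₀ modulo S = s/d, so N_t counts the
-- x ∈ γ_t^{i₀}⟨γ_t^S⟩ with Tr_t x = b := a/(m/t).  Put P = p^e.  Complex characters are avoided by
-- summing ψ(λz) over λ ∈ 𝔽_P*, which gives the integer θ(z) = P[z = 0] - 1, and Gauss sums become
-- G(c) = Σ_y θ(T(c y^S)), with T the trace to 𝔽_P.  For S = P+1 the map y ↦ T(c y^{P+1}) is a
-- Hermitian form on the field with P^{2w} elements: when it is nondegenerate, a second moment gives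
-- G(c)² = (P-1)² P^{2w}, and G(c)/(P-1) ≡ 1 modulo P+1 ≥ 3 fixes the sign, G(c) = (P-1)(-P)^w.  It
-- degenerates for one class of c modulo (P+1)-th powers, where G(c) follows from the sum over all
-- classes; the general S ∣ P+1 follows by averaging.  Fourier inversion on 𝔽_q then expresses N_t by
-- the G(λγ_t^{i₀}), λ ∈ 𝔽_q; for b ≠ 0 the exceptional λ form a coset in 𝔽_q*, over which the same
-- evaluation, in 𝔽_q and with u for S, is applied again.

open import Defs
open import Level using (Level; 0ℓ; _⊔_)
open import Algebra.Bundles using (CommutativeRing)
open import Data.Bool using (Bool; true; false; not; _∧_; if_then_else_)
open import Data.Empty using (⊥; ⊥-elim)
open import Data.Fin as Fin using (Fin; toℕ; fromℕ; fromℕ<)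
open import Data.Fin.Permutation using (permutation)
import Data.Fin.Properties as Finₚ
open import Data.Integer as ℤ using (ℤ; +_; 0ℤ; 1ℤ; -1ℤ)
open import Data.Integer.DivMod using (_%ℕ_; _/ℕ_; a≡a%ℕn+[a/ℕn]*n; n%ℕd<d)
import Data.Integer.Divisibility.Signed as S
import Data.Integer.Properties as ℤₚ
open import Data.Integer.Tactic.RingSolver using (solve-∀)
open import Data.Nat as ℕ using (ℕ; zero; suc; _≤_; _<_; _*_; _+_; _∸_; _^_; _!; s≤s; z≤n)
open import Data.Nat.Combinatorics using (_C_; nCn≡1; k![n∸k]!∣n!)
open import Data.Nat.Combinatorics.Specification using (nCk≡n!/k![n-k]!)
open import Data.Nat.Coprimality using (Coprime; coprime-Bézout)
open import Data.Nat.DivMod as ℕD using (_%_; m%n<n; m≡m%n+[m/n]*n; m/n*n≡m)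
open import Data.Nat.Divisibility using
  (_∣_; divides; ∣-refl; ∣-trans; ∣⇒≤; ∣1⇒≡1; m∣m*n; n∣m*n; ∣m⇒∣m*n; ∣m∣n⇒∣m+n;
   ∣m+n∣m⇒∣n; *-monoʳ-∣; *-cancelˡ-∣; *-cancelʳ-∣; m%n≡0⇒n∣m)
open import Data.Nat.GCD using (gcd; gcd[m,n]∣m; gcd[m,n]∣n; gcd[m,n]≢0; gcd-greatest; module Bézout)
open import Data.Nat.Primality using (Prime; euclidsLemma; prime⇒irreducible; prime⇒nonTrivial)
import Data.Nat.Properties as ℕₚ
import Data.Nat.Tactic.RingSolver as ℕS
open import Data.Product using (∃; _×_; _,_; proj₁; proj₂)
open import Data.Rational as ℚ using (ℚ; 0ℚ; 1ℚ; toℚᵘ)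
import Data.Rational.Properties as ℚₚ
open import Data.Rational.Unnormalised as ℚᵘ using (mkℚᵘ; *≡*)
import Data.Rational.Unnormalised.Properties as ℚᵘₚ
open import Data.Sum using (_⊎_; inj₁; inj₂; [_,_]′)
import Relation.Binary.Reasoning.Setoid as SetoidReasoning
open import Relation.Binary.PropositionalEquality as ≡ using (_≡_; cong; cong₂; subst; subst₂)
open import Relation.Nullary using (¬_; Dec; yes; no)
open import Relation.Nullary.Decidable using (⌊_⌋; _×-dec_; dec⇒maybe)
open import Tactic.RingSolver using () renaming (solve-∀ to solve-∀-in)
open import Tactic.RingSolver.Core.AlmostCommutativeRing using (AlmostCommutativeRing; fromCommutativeRing)

-- Sums over ranges and residue classes

-- Passing to `θ` loses nothing. In an extension of even degree the group order is divisible by P² -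
-- 1, so each λ ∈ 𝔽_P* is a (P+1)-th power there, and Σ_y ψ(λ T(c y^S)) is the same for all λ. Hence
-- `G` is P - 1 times one Gauss sum, and an additive constant b ∈ 𝔽_P can be detached: the sum of
-- θ(T(c y^S) + b) over all y is G(c) θ(b) / (P - 1). The same scaling explains the congruence: away
-- from y = 0 the terms of `G` for S = P + 1 fall into groups of P² - 1 equal ones. The form y ↦ T(c
-- y^(P+1)) degenerates exactly when c^P y^(P²) = -c y for some y ≠ 0, that is, when c^(P-1) is -1
-- times a (P²-1)-th power. With -1 = δ^ν this fixes the exponent of c modulo P + 1. In
-- characteristic 2 one may take ν = 0; for odd p, ν is half the group order, and the class is 0 or
-- (P+1)/2 according to the parity of w. The numbers `kN` are the reductions of this one class
-- modulo the divisors of P + 1.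

infixr 5 _∙_
_∙_ : ∀ {a} {A : Set a} {x y z : A} → x ≡ y → y ≡ z → x ≡ z
_∙_ = ≡.trans

module RangeSum {c ℓ : Level} (R : CommutativeRing c ℓ) where
  open CommutativeRing R renaming (_+_ to _⊕_; _*_ to _⊗_)
  open import Relation.Binary.Reasoning.Setoid setoid
  open import Algebra.Properties.CommutativeSemigroup +-commutativeSemigroup
    using (interchange)
  open import Algebra.Properties.AbelianGroup +-abelianGroup using (∙-cancelˡ)

  ∑ : ℕ → (ℕ → Carrier) → Carrier
  ∑ zero    f = 0#
  ∑ (suc n) f = ∑ n f ⊕ f n

  ∑-cong : ∀ n {f g} → (∀ i → i < n → f i ≈ g i) → ∑ n f ≈ ∑ n g
  ∑-cong zero    f≈g = refl
  ∑-cong (suc n) f≈g =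
    +-cong (∑-cong n (λ i i<n → f≈g i (ℕₚ.m<n⇒m<1+n i<n))) (f≈g n (ℕₚ.n<1+n n))

  ∑-cong′ : ∀ n {f g} → (∀ i → f i ≈ g i) → ∑ n f ≈ ∑ n g
  ∑-cong′ n f≈g = ∑-cong n (λ i _ → f≈g i)

  ∑-zero : ∀ n {f} → (∀ i → i < n → f i ≈ 0#) → ∑ n f ≈ 0#
  ∑-zero zero    f≈0 = refl
  ∑-zero (suc n) f≈0 =
    trans (+-cong (∑-zero n (λ i i<n → f≈0 i (ℕₚ.m<n⇒m<1+n i<n))) (f≈0 n (ℕₚ.n<1+n n)))
          (+-identityˡ 0#)

  ∑-distrib-+ : ∀ n f g → ∑ n (λ i → f i ⊕ g i) ≈ ∑ n f ⊕ ∑ n g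
  ∑-distrib-+ zero    f g = sym (+-identityˡ 0#)
  ∑-distrib-+ (suc n) f g =
    trans (+-congʳ (∑-distrib-+ n f g)) (interchange (∑ n f) (∑ n g) (f n) (g n))

  *-distribˡ-∑ : ∀ x n f → x ⊗ ∑ n f ≈ ∑ n (λ i → x ⊗ f i)
  *-distribˡ-∑ x zero    f = zeroʳ x
  *-distribˡ-∑ x (suc n) f =
    trans (distribˡ x (∑ n f) (f n)) (+-congʳ (*-distribˡ-∑ x n f))

  *-distribʳ-∑ : ∀ x n f → ∑ n f ⊗ x ≈ ∑ n (λ i → f i ⊗ x)
  *-distribʳ-∑ x n f =
    trans (*-comm _ x) (trans (*-distribˡ-∑ x n f) (∑-cong′ n (λ i → *-comm x (f i))))

  ∑-swap : ∀ m n (f : ℕ → ℕ → Carrier) →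
           ∑ m (λ i → ∑ n (f i)) ≈ ∑ n (λ j → ∑ m (λ i → f i j))
  ∑-swap zero    n f = sym (∑-zero n (λ _ _ → refl))
  ∑-swap (suc m) n f =
    trans (+-congʳ (∑-swap m n f)) (sym (∑-distrib-+ n (λ j → ∑ m (λ i → f i j)) (f m)))

  ∑-split : ∀ m n f → ∑ (m + n) f ≈ ∑ m f ⊕ ∑ n (λ i → f (m + i))
  ∑-split m zero    f rewrite ℕₚ.+-identityʳ m = sym (+-identityʳ _)
  ∑-split m (suc n) f rewrite ℕₚ.+-suc m n =
    trans (+-congʳ (∑-split m n f)) (+-assoc _ _ _)

  ∑-blocks : ∀ m n f → ∑ (m * n) f ≈ ∑ m (λ i → ∑ n (λ j → f (i * n + j)))
  ∑-blocks zero    n f = refl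
  ∑-blocks (suc m) n f rewrite ℕₚ.+-comm n (m * n) =
    trans (∑-split (m * n) n f) (+-congʳ (∑-blocks m n f))

  ∑-head : ∀ n f → ∑ (suc n) f ≈ f 0 ⊕ ∑ n (λ i → f (suc i))
  ∑-head n f = trans (∑-split 1 n f) (+-congʳ (+-identityˡ (f 0)))

  Periodic : ℕ → (ℕ → Carrier) → Set ℓ
  Periodic n f = ∀ i → f (i + n) ≈ f i

  periodic-* : ∀ {n f} → Periodic n f → ∀ k → Periodic (k * n) f
  periodic-* {n} {f} per zero    i = reflexive (cong f (ℕₚ.+-identityʳ i))
  periodic-* {n} {f} per (suc k) i = trans
    (reflexive (cong f (≡.sym (ℕₚ.+-assoc i n (k * n)))))
    (trans (periodic-* per k (i + n)) (per i))

  -- Moving the window by one step drops `f a` and gains `f (a + n)`, which is equal to it.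
  ∑-shift : ∀ {n f} → Periodic n f → ∀ a → ∑ n (λ i → f (a + i)) ≈ ∑ n f
  ∑-shift {n} {f} per zero    = refl
  ∑-shift {n} {f} per (suc a) = trans
    (∙-cancelˡ (f a) _ _ (begin
      f a ⊕ ∑ n (λ i → f (suc a + i)) ≈⟨ +-cong (reflexive (cong f (≡.sym (ℕₚ.+-identityʳ a))))
                                                    (∑-cong′ n (λ i → reflexive (cong f (≡.sym (ℕₚ.+-suc a i))))) ⟩
      f (a + 0) ⊕ ∑ n (λ i → f (a + suc i)) ≈⟨ ∑-head n (λ i → f (a + i)) ⟨
      ∑ n (λ i → f (a + i)) ⊕ f (a + n) ≈⟨ +-congˡ (per a) ⟩
      ∑ n (λ i → f (a + i)) ⊕ f a ≈⟨ +-comm _ _ ⟩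
      f a ⊕ ∑ n (λ i → f (a + i)) ∎))
    (∑-shift per a)

  ∑-periodic : ∀ {n f} → Periodic n f → ∀ m → ∑ (m * n) f ≈ ∑ m (λ _ → ∑ n f)
  ∑-periodic {n} {f} per m = trans (∑-blocks m n f)
    (∑-cong′ m (λ i → ∑-shift per (i * n)))

  ∑-unique : ∀ n f {j} → j < n → (∀ i → i < n → ¬ i ≡ j → f i ≈ 0#) → ∑ n f ≈ f j
  ∑-unique (suc n) f {j} j<1+n f≈0 with j ℕ.≟ n
  ... | yes ≡.refl = trans
    (+-congʳ (∑-zero n (λ i i<n → f≈0 i (ℕₚ.m<n⇒m<1+n i<n) (ℕₚ.<⇒≢ i<n))))
    (+-identityˡ (f n))
  ... | no j≢n = trans
    (+-cong (∑-unique n f (ℕₚ.≤∧≢⇒< (ℕₚ.≤-pred j<1+n) j≢n)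
              (λ i i<n → f≈0 i (ℕₚ.m<n⇒m<1+n i<n)))
            (f≈0 n (ℕₚ.n<1+n n) (λ n≡j → j≢n (≡.sym n≡j))))
    (+-identityʳ (f j))

open RangeSum ℤₚ.+-*-commutativeRing public

⟦_⟧ : ∀ {a} {A : Set a} → Dec A → ℤ
⟦ A? ⟧ = if ⌊ A? ⌋ then 1ℤ else 0ℤ

⟦⟧-yes : ∀ {a} {A : Set a} (A? : Dec A) → A → ⟦ A? ⟧ ≡ 1ℤ
⟦⟧-yes (yes _) x = ≡.refl
⟦⟧-yes (no ¬x) x = ⊥-elim (¬x x)

⟦⟧-no : ∀ {a} {A : Set a} (A? : Dec A) → ¬ A → ⟦ A? ⟧ ≡ 0ℤ
⟦⟧-no (yes x) ¬x = ⊥-elim (¬x x)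
⟦⟧-no (no _)  ¬x = ≡.refl

⟦⟧-cong : ∀ {a b} {A : Set a} {B : Set b} (A? : Dec A) (B? : Dec B) →
          (A → B) → (B → A) → ⟦ A? ⟧ ≡ ⟦ B? ⟧
⟦⟧-cong (yes x) B? f g = ≡.sym (⟦⟧-yes B? (f x))
⟦⟧-cong (no ¬x) B? f g = ≡.sym (⟦⟧-no B? (λ y → ¬x (g y)))

⟦×⟧ : ∀ {a b} {A : Set a} {B : Set b} (A? : Dec A) (B? : Dec B) →
      ⟦ A? ×-dec B? ⟧ ≡ ⟦ A? ⟧ ℤ.* ⟦ B? ⟧
⟦×⟧ (yes _) (yes _) = ≡.refl
⟦×⟧ (yes _) (no _)  = ≡.refl
⟦×⟧ (no _)  (yes _) = ≡.refl
⟦×⟧ (no _)  (no _)  = ≡.refl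

∑-const : ∀ n c → ∑ n (λ _ → c) ≡ + n ℤ.* c
∑-const zero    c = ≡.refl
∑-const (suc n) c = cong (ℤ._+ c) (∑-const n c) ∙ lemma (+ n) c
  where
  lemma : ∀ n c → n ℤ.* c ℤ.+ c ≡ (1ℤ ℤ.+ n) ℤ.* c
  lemma = solve-∀

[_∣_] : ℕ → ℤ → ℤ
[ S ∣ z ] = ⟦ + S S.∣? z ⟧

[∣]-cong : ∀ S {y z} → + S S.∣ (y ℤ.- z) → [ S ∣ y ] ≡ [ S ∣ z ]
[∣]-cong S {y} {z} S∣y-z = ⟦⟧-cong _ _
  (λ S∣y → subst (+ S S.∣_) (eq₁ y z) (S.∣m∣n⇒∣m-n S∣y S∣y-z))
  (λ S∣z → subst (+ S S.∣_) (eq₂ y z) (S.∣m∣n⇒∣m+n S∣y-z S∣z))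
  where
  eq₁ : ∀ y z → y ℤ.- (y ℤ.- z) ≡ z
  eq₁ = solve-∀
  eq₂ : ∀ y z → (y ℤ.- z) ℤ.+ z ≡ y
  eq₂ = solve-∀

private
  +-hom₃ : ∀ i n S → + (i + n * S) ≡ + i ℤ.+ + n ℤ.* + S
  +-hom₃ i n S = ℤₚ.pos-+ i (n * S) ∙ cong (ℤ._+_ (+ i)) (ℤₚ.pos-* n S)

-- Both sides run S times over the residue class of a modulo S.
∑-residue-class : ∀ {S n f} .{{_ : ℕ.NonZero S}} → Periodic (n * S) f → ∀ a →
  ∑ (n * S) (λ i → f (a + S * i)) ≡ + S ℤ.* ∑ (n * S) (λ i → [ S ∣ + i ℤ.- + a ] ℤ.* f i)
∑-residue-class {S} {n} {f} per a = begin
  ∑ (n * S) (λ i → f (a + S * i))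
    ≡⟨ cong (λ k → ∑ k (λ i → f (a + S * i))) (ℕₚ.*-comm n S) ⟩
  ∑ (S * n) (λ i → f (a + S * i))
    ≡⟨ ∑-periodic per′ S ⟩
  ∑ S (λ _ → ∑ n (λ i → f (a + S * i)))
    ≡⟨ ∑-const S _ ⟩
  + S ℤ.* ∑ n (λ i → f (a + S * i))
    ≡⟨ cong (+ S ℤ.*_) (∑-cong′ n (λ i → ≡.sym (block i))) ⟩
  + S ℤ.* ∑ n (λ i → ∑ S (λ r → h (a + (i * S + r))))
    ≡⟨ cong (+ S ℤ.*_) (∑-blocks n S (λ i → h (a + i))) ⟨
  + S ℤ.* ∑ (n * S) (λ i → h (a + i))
    ≡⟨ cong (+ S ℤ.*_) (∑-shift h-per a) ⟩
  + S ℤ.* ∑ (n * S) h ∎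
  where
  open ≡.≡-Reasoning
  h : ℕ → ℤ
  h i = [ S ∣ + i ℤ.- + a ] ℤ.* f i
  per′ : Periodic n (λ i → f (a + S * i))
  per′ i = cong f (eq a S i n) ∙ per (a + S * i)
    where
    eq : ∀ a S i n → a + S * (i + n) ≡ a + S * i + n * S
    eq = ℕS.solve-∀
  h-per : Periodic (n * S) h
  h-per i = cong₂ ℤ._*_ ([∣]-cong S (S.divides (+ n) eq)) (per i)
    where
    ring : ∀ i n a S → i ℤ.+ n ℤ.* S ℤ.- a ℤ.- (i ℤ.- a) ≡ n ℤ.* S
    ring = solve-∀
    eq : + (i + n * S) ℤ.- + a ℤ.- (+ i ℤ.- + a) ≡ + n ℤ.* + S
    eq = cong (λ k → k ℤ.- + a ℤ.- (+ i ℤ.- + a)) (+-hom₃ i n S) ∙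
                 ring (+ i) (+ n) (+ a) (+ S)
  diff : ∀ i r → + (a + (i * S + r)) ℤ.- + a ≡ + i ℤ.* + S ℤ.+ + r
  diff i r = cong (ℤ._- + a) (ℤₚ.pos-+ a (i * S + r) ∙
      cong (λ k → + a ℤ.+ k) (ℤₚ.pos-+ (i * S) r ∙ cong (ℤ._+ + r) (ℤₚ.pos-* i S))) ∙
    ring (+ a) (+ i ℤ.* + S ℤ.+ + r)
    where
    ring : ∀ a z → a ℤ.+ z ℤ.- a ≡ z
    ring = solve-∀
  block : ∀ i → ∑ S (λ r → h (a + (i * S + r))) ≡ f (a + S * i)
  block i = ∑-unique S _ {0} (ℕ.>-nonZero⁻¹ S) off ∙
    cong₂ ℤ._*_ (⟦⟧-yes (+ S S.∣? _) on) (cong (λ k → f (a + k)) (ℕₚ.+-identityʳ _ ∙ ℕₚ.*-comm i S)) ∙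
             ℤₚ.*-identityˡ _
    where
    on : + S S.∣ (+ (a + (i * S + 0)) ℤ.- + a)
    on = S.divides (+ i) (diff i 0 ∙ ℤₚ.+-identityʳ _)
    off : ∀ r → r < S → ¬ r ≡ 0 → h (a + (i * S + r)) ≡ 0ℤ
    off r r<S r≢0 = cong (ℤ._* f (a + (i * S + r))) (⟦⟧-no (+ S S.∣? _) S∤) ∙ ℤₚ.*-zeroˡ (f (a + (i * S + r)))
      where
      S∤ : ¬ (+ S S.∣ (+ (a + (i * S + r)) ℤ.- + a))
      S∤ p = ∤r r r<S r≢0 (S.∣⇒∣ᵤ (S.∣m+n∣m⇒∣n (subst (+ S S.∣_) (diff i r) p) (S.∣n⇒∣m*n (+ i) S.∣-refl)))
        where
        ∤r : ∀ r → r < S → ¬ r ≡ 0 → ¬ (S ∣ r)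
        ∤r zero    _   r≢0 _   = r≢0 ≡.refl
        ∤r (suc r) r<S _   S∣r = ℕₚ.<⇒≱ r<S (∣⇒≤ S∣r)

-- Of the R lifts z + S r modulo S R, exactly one is 0 if S divides z, and none otherwise. This is
-- what carries the evaluation from classes modulo P + 1 to classes modulo a divisor.
∑-congruence : ∀ S {R} .{{_ : ℕ.NonZero S}} .{{_ : ℕ.NonZero R}} z →
  ∑ R (λ r → [ S * R ∣ z ℤ.+ + (S * r) ]) ≡ [ S ∣ z ]
∑-congruence S {R} z = go (+ S S.∣? z)
  where
  S∣SR : + S S.∣ + (S * R)
  S∣SR = S.∣ᵤ⇒∣ (m∣m*n R)
  go : Dec (+ S S.∣ z) → ∑ R (λ r → [ S * R ∣ z ℤ.+ + (S * r) ]) ≡ [ S ∣ z ]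
  go (no S∤z) = ∑-zero R (λ r _ → ⟦⟧-no _ (λ p → S∤z (S.∣m+n∣n⇒∣m (S.∣-trans S∣SR p) (S.∣ᵤ⇒∣ (m∣m*n r))))) ∙
    ≡.sym (⟦⟧-no _ S∤z)
  go (yes S∣z@(S.divides q z≡qS)) = begin
    ∑ R (λ r → [ S * R ∣ z ℤ.+ + (S * r) ])
      ≡⟨ ∑-cong′ R (λ r → ⟦⟧-cong _ (+ R S.∣? (+ r ℤ.- + a)) (to r) (from r)) ⟩
    ∑ R (λ r → [ R ∣ + r ℤ.- + a ])
      ≡⟨ ∑-cong′ R (λ r → ≡.sym (ℤₚ.*-identityʳ _)) ⟩
    ∑ R (λ r → [ R ∣ + r ℤ.- + a ] ℤ.* 1ℤ)
      ≡⟨ cong (λ k → ∑ k (λ r → [ R ∣ + r ℤ.- + a ] ℤ.* 1ℤ)) (ℕₚ.*-identityˡ R) ⟨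
    ∑ (1 * R) (λ r → [ R ∣ + r ℤ.- + a ] ℤ.* 1ℤ)
      ≡⟨ ℤₚ.*-cancelˡ-≡ (+ R) _ 1ℤ (≡.sym (∑-residue-class {R} {1} {λ _ → 1ℤ} (λ _ → ≡.refl) a) ∙
           ∑-const (1 * R) 1ℤ ∙ cong (λ k → + k ℤ.* 1ℤ) (ℕₚ.*-identityˡ R)) ⟩
    1ℤ
      ≡⟨ ⟦⟧-yes (+ S S.∣? z) S∣z ⟨
    [ S ∣ z ] ∎
    where
    open ≡.≡-Reasoning
    -- With z = q S the condition becomes R ∣ q + r, so r has to be the residue of -q. That there is
    -- one such r below R is `∑-residue-class` for the constant 1 and a single block.
    a = (ℤ.- q) %ℕ R
    b = (ℤ.- q) /ℕ R
    q≡ : q ≡ ℤ.- (+ a ℤ.+ b ℤ.* + R)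
    q≡ = ≡.sym (ℤₚ.neg-involutive q) ∙ cong ℤ.-_ (a≡a%ℕn+[a/ℕn]*n (ℤ.- q) R)
    quotient : ∀ r → z ℤ.+ + (S * r) ≡ + S ℤ.* (q ℤ.+ + r)
    quotient r = cong₂ ℤ._+_ z≡qS (ℤₚ.pos-* S r) ∙ lemma q (+ S) (+ r)
      where
      lemma : ∀ q s r → q ℤ.* s ℤ.+ s ℤ.* r ≡ s ℤ.* (q ℤ.+ r)
      lemma = solve-∀
    shift : ∀ r → q ℤ.+ + r ≡ (+ r ℤ.- + a) ℤ.+ (ℤ.- b) ℤ.* + R
    shift r = cong (ℤ._+ + r) q≡ ∙ lemma (+ a) b (+ R) (+ r)
      where
      lemma : ∀ a b R r → ℤ.- (a ℤ.+ b ℤ.* R) ℤ.+ r ≡ (r ℤ.- a) ℤ.+ (ℤ.- b) ℤ.* R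
      lemma = solve-∀
    to : ∀ r → + (S * R) S.∣ (z ℤ.+ + (S * r)) → + R S.∣ (+ r ℤ.- + a)
    to r p = S.∣m+n∣n⇒∣m (subst (+ R S.∣_) (shift r)
      (S.*-cancelˡ-∣ (+ S) (subst₂ S._∣_ (ℤₚ.pos-* S R) (quotient r) p))) (S.∣n⇒∣m*n (ℤ.- b) S.∣-refl)
    from : ∀ r → + R S.∣ (+ r ℤ.- + a) → + (S * R) S.∣ (z ℤ.+ + (S * r))
    from r p = subst₂ S._∣_ (≡.sym (ℤₚ.pos-* S R)) (≡.sym (quotient r))
      (S.*-monoʳ-∣ (+ S) (subst (+ R S.∣_) (≡.sym (shift r)) (S.∣m∣n⇒∣m+n p (S.∣n⇒∣m*n (ℤ.- b) S.∣-refl))))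

-- Elementary number theory

-- (x^k - 1) / (x - 1) without a division. The indices of the multiplicative groups in the tower and
-- the exponents of the norms all have this form.
repunit : ℕ → ℕ → ℕ
repunit x zero    = 0
repunit x (suc k) = repunit x k + x ^ k

repunit-* : ∀ N k → suc (repunit (suc N) k * N) ≡ suc N ^ k
repunit-* N zero    = ≡.refl
repunit-* N (suc k) = eq (repunit (suc N) k) (suc N ^ k) N ∙
  (cong (_+ suc N ^ k * N) (repunit-* N k) ∙ eq′ (suc N ^ k) N)
  where
  eq : ∀ r x N → suc ((r + x) * N) ≡ suc (r * N) + x * N
  eq = ℕS.solve-∀
  eq′ : ∀ x N → x + x * N ≡ suc N * x
  eq′ = ℕS.solve-∀

repunit-+ : ∀ x k l → repunit x (k + l) ≡ repunit x k + x ^ k * repunit x l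
repunit-+ x k zero    = cong (repunit x) (ℕₚ.+-identityʳ k) ∙
  ≡.sym (cong (repunit x k ℕ.+_) (ℕₚ.*-zeroʳ (x ^ k)) ∙ ℕₚ.+-identityʳ _)
repunit-+ x k (suc l) = cong (repunit x) (ℕₚ.+-suc k l) ∙
  cong₂ _+_ (repunit-+ x k l) (ℕₚ.^-distribˡ-+-* x k l) ∙ eq (repunit x k) (x ^ k) (repunit x l) (x ^ l)
  where
  eq : ∀ a b c d → a + b * c + b * d ≡ a + b * (c + d)
  eq = ℕS.solve-∀

-- The k t digits are grouped into k blocks of length t. On exponents this is the factorisation of
-- the norm K → 𝔽_q through 𝔽_{q^t}.
repunit-product : ∀ x t k → repunit x (k * t) ≡ repunit (x ^ t) k * repunit x t
repunit-product x t zero    = ≡.refl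
repunit-product x t (suc k) = cong (repunit x) (ℕₚ.+-comm t (k * t)) ∙
  repunit-+ x (k * t) t ∙ cong₂ (λ a b → a + b * repunit x t) (repunit-product x t k) (cong (x ^_) (ℕₚ.*-comm k t) ∙ ≡.sym (ℕₚ.^-*-assoc x t k)) ∙
    ≡.sym (ℕₚ.*-distribʳ-+ (repunit x t) (repunit (x ^ t) k) ((x ^ t) ^ k))

-- All powers of `suc N` are 1 modulo `N`. It is used for t₀ ≡ t modulo q - 1 and for (P^(2w) -
-- 1)/(P² - 1) ≡ w modulo P² - 1.
repunit-mod : ∀ N k → ∃ λ z → repunit (suc N) k ≡ k + z * N
repunit-mod N zero    = 0 , ≡.refl
repunit-mod N (suc k) with repunit-mod N k
... | z , eq = z + repunit (suc N) k , cong₂ _+_ eq (≡.sym (repunit-* N k)) ∙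
    eq′ k z N (repunit (suc N) k)
  where
  eq′ : ∀ k z N r → (k + z * N) + suc (r * N) ≡ suc k + (z + r) * N
  eq′ = ℕS.solve-∀

div-* : ∀ c n .{{_ : ℕ.NonZero n}} → (c * n) div n ≡ c
div-* c (suc n) = ℕD.m*n/n≡m c (suc n)

-- Carries both the value of the Boolean on which `kN` and `sgn` branch and an explicit half of the
-- number.
data Parity (n : ℕ) : Set where
  even : isOdd n ≡ false → ∀ v → n ≡ v * 2 → Parity n
  odd  : isOdd n ≡ true  → ∀ v → n ≡ suc (v * 2) → Parity n

parity : ∀ n → Parity n
parity n = go (n ℕD.% 2) ≡.refl (ℕD.m%n<n n 2)
  where
  go : ∀ r → n ℕD.% 2 ≡ r → r < 2 → Parity n
  go 0 eq _ = even (cong (ℕ._≡ᵇ 1) eq) (n ℕD./ 2) (ℕD.m≡m%n+[m/n]*n n 2 ∙ cong (_+ n ℕD./ 2 * 2) eq)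
  go 1 eq _ = odd (cong (ℕ._≡ᵇ 1) eq) (n ℕD./ 2) (ℕD.m≡m%n+[m/n]*n n 2 ∙ cong (_+ n ℕD./ 2 * 2) eq)
  go (suc (suc _)) _ (s≤s (s≤s ()))

isOdd-even : ∀ v → isOdd (v * 2) ≡ false
isOdd-even v = cong (ℕ._≡ᵇ 1) (ℕD.m*n%n≡0 v 2)

isOdd-odd : ∀ v → isOdd (suc (v * 2)) ≡ true
isOdd-odd v = cong (ℕ._≡ᵇ 1) (ℕD.[m+kn]%n≡m%n 1 v 2 ∙ ≡.refl)

odd-^ : ∀ v e → ∃ λ w → suc (v * 2) ^ e ≡ suc (w * 2)
odd-^ v zero    = 0 , ≡.refl
odd-^ v (suc e) with odd-^ v e
... | w , eq = v + w + v * w * 2 , cong (suc (v * 2) *_) eq ∙ eq′ v w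
  where
  eq′ : ∀ v w → suc (v * 2) * suc (w * 2) ≡ suc ((v + w + v * w * 2) * 2)
  eq′ = ℕS.solve-∀

-- The class of exponents a modulo M = P+1 for which y ↦ T(δ^a y^M) is degenerate on 𝔽_{P^{2w}}.
κ : Bool → ℕ → ℕ → ℕ
κ p-odd M w = if p-odd ∧ isOdd w then M div 2 else 0

-- If (P+1)/N is odd, then (P+1)/2 ≡ N/2 modulo N; if it is even, then (P+1)/2 ≡ 0.
kN≡κ : ∀ p e n N t′ {R} → N * R ≡ p ^ e + 1 → (∀ v → p ≡ suc (v * 2) → ∃ λ h → p ^ e + 1 ≡ h * 2) →
  + N S.∣ (+ κ (isOdd p) (p ^ e + 1) (n * t′) ℤ.- + kN p e n N t′)
kN≡κ p e n N t′ {R} NR≡M M-even = go (parity p) (parity (n * t′))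
  where
  M = p ^ e + 1
  instance
    M≢0 : ℕ.NonZero M
    M≢0 = subst ℕ.NonZero (ℕₚ.+-comm 1 (p ^ e)) _
    N≢0 : ℕ.NonZero N
    N≢0 = ℕₚ.m*n≢0⇒m≢0 N {R} {{subst ℕ.NonZero (≡.sym NR≡M) M≢0}}
  quotient : M div N ≡ R
  quotient = cong (_div N) (≡.sym NR≡M ∙ ℕₚ.*-comm N R) ∙ div-* R N
  zero-case : ∀ {k k′} → k ≡ 0 → k′ ≡ 0 → + N S.∣ (+ k ℤ.- + k′)
  zero-case ≡.refl ≡.refl = S.divides 0ℤ (≡.sym (ℤₚ.*-zeroˡ (+ N)))
  go : Parity p → Parity (n * t′) → + N S.∣ (+ κ (isOdd p) M (n * t′) ℤ.- + kN p e n N t′)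
  go (even p-even _ _) _ rewrite p-even = zero-case ≡.refl ≡.refl
  go (odd p-odd _ _) (even w-even _ _) rewrite p-odd | w-even = zero-case ≡.refl ≡.refl
  go (odd p-odd x p≡) (odd w-odd _ _) rewrite p-odd | w-odd | quotient with M-even x p≡ | parity R
  ... | h , M≡2h | even R-even v R≡2v rewrite R-even = S.divides (+ v)
    (lemma (+ (M div 2)) ∙ cong +_ M/2 ∙ ℤₚ.pos-* v N)
    where
    lemma : ∀ x → x ℤ.- 0ℤ ≡ x
    lemma = solve-∀
    eq : ∀ N v → N * (v * 2) ≡ v * N * 2
    eq = ℕS.solve-∀
    M/2 : M div 2 ≡ v * N
    M/2 = cong (_div 2) (≡.sym NR≡M ∙ cong (N *_) R≡2v ∙ eq N v) ∙ div-* (v * N) 2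
  ... | h , M≡2h | odd R-odd v R≡ rewrite R-odd with parity N
  ...   | odd _ y N≡ = ⊥-elim (true≢false (≡.sym (isOdd-odd (y + v + y * v * 2)) ∙ cong isOdd (≡.sym (eq y v) ∙ cong₂ _*_ (≡.sym N≡) (≡.sym R≡) ∙ NR≡M ∙ M≡2h) ∙ isOdd-even h))
    where
    true≢false : ¬ true ≡ false
    true≢false ()
    eq : ∀ v w → suc (v * 2) * suc (w * 2) ≡ suc ((v + w + v * w * 2) * 2)
    eq = ℕS.solve-∀
  ...   | even _ y N≡ = S.divides (+ v) (cong₂ (λ a b → + a ℤ.- + b) M/2 N/2 ∙
      cong (ℤ._- + y) (ℤₚ.pos-+ y (v * N) ∙ cong (λ z → + y ℤ.+ z) (ℤₚ.pos-* v N)) ∙ lemma (+ y) (+ v ℤ.* + N))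
    where
    lemma : ∀ y z → y ℤ.+ z ℤ.- y ≡ z
    lemma = solve-∀
    N/2 : N div 2 ≡ y
    N/2 = cong (_div 2) N≡ ∙ div-* y 2
    eq : ∀ y v → y * 2 * suc (v * 2) ≡ (y + v * (y * 2)) * 2
    eq = ℕS.solve-∀
    M/2 : M div 2 ≡ y + v * N
    M/2 = cong (_div 2) (≡.sym NR≡M ∙ cong₂ _*_ N≡ R≡ ∙ eq y v) ∙
      div-* (y + v * (y * 2)) 2 ∙ cong (λ N → y + v * N) (≡.sym N≡)

-- The integer (-P)^w: of the two square roots of P^(2w), the one that is 1 modulo P + 1, because -P
-- is.
σ : ℕ → ℕ → ℤ
σ P zero    = 1ℤ
σ P (suc w) = (ℤ.- + P) ℤ.* σ P w

σ² : ∀ P w → σ P w ℤ.* σ P w ≡ + (P ^ (2 * w))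
σ² P zero    = ≡.refl
σ² P (suc w) = lemma (+ P) (σ P w) ∙ cong (+ P ℤ.* + P ℤ.*_) (σ² P w) ∙
  cong (ℤ._* + (P ^ (2 * w))) (≡.sym (ℤₚ.pos-* P P)) ∙ ≡.sym (ℤₚ.pos-* (P * P) (P ^ (2 * w))) ∙
    cong +_ (ℕₚ.*-assoc P P _ ∙ cong (P ^_) (eq w))
  where
  lemma : ∀ p s → (ℤ.- p) ℤ.* s ℤ.* ((ℤ.- p) ℤ.* s) ≡ p ℤ.* p ℤ.* (s ℤ.* s)
  lemma = solve-∀
  eq : ∀ w → suc (suc (2 * w)) ≡ 2 * suc w
  eq = ℕS.solve-∀

σ≡1 : ∀ P w → + suc P S.∣ (σ P w ℤ.- 1ℤ)
σ≡1 P zero    = S.divides 0ℤ ≡.refl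
σ≡1 P (suc w) = subst (+ suc P S.∣_) (lemma (+ P) (σ P w))
  (S.∣m∣n⇒∣m-n (S.∣n⇒∣m*n (ℤ.- + P) (σ≡1 P w)) (S.∣-refl {+ suc P}))
  where
  lemma : ∀ p s → (ℤ.- p) ℤ.* (s ℤ.- 1ℤ) ℤ.- (1ℤ ℤ.+ p) ≡ (ℤ.- p) ℤ.* s ℤ.- 1ℤ
  lemma = solve-∀

-- Only the universal property of g is assumed, since g may be given as the gcd of another pair: l
-- is defined as gcd(t, S) but is used as the gcd of t₀ and S.
coprime-quotients : ∀ {g a b a′ b′} .{{_ : ℕ.NonZero g}} → a ≡ g * a′ → b ≡ g * b′ →
  (∀ {i} → i ∣ a → i ∣ b → i ∣ g) → Coprime a′ b′
coprime-quotients {g} {a} {b} a≡ b≡ greatest {i} (i∣a′ , i∣b′) = ∣1⇒≡1 (*-cancelˡ-∣ g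
  (subst (g * i ∣_) (≡.sym (ℕₚ.*-identityʳ g)) (greatest
    (subst (g * i ∣_) (≡.sym a≡) (*-monoʳ-∣ g i∣a′)) (subst (g * i ∣_) (≡.sym b≡) (*-monoʳ-∣ g i∣b′)))))

div-exact : ∀ {m n} .{{_ : ℕ.NonZero m}} → m ∣ n → n ≡ m * n div m
div-exact {m} (divides q ≡.refl) = ℕₚ.*-comm q m ∙ cong (m *_) (≡.sym (div-* q m))

odd⇒even+1 : ∀ {p} e v → p ≡ suc (v * 2) → ∃ λ h → p ^ e + 1 ≡ h * 2
odd⇒even+1 e v ≡.refl with odd-^ v e
... | w , eq = suc w , cong (_+ 1) eq ∙ ℕₚ.+-comm (suc (w * 2)) 1

isOdd-suc : ∀ n → isOdd (suc n) ≡ not (isOdd n)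
isOdd-suc n with parity n
... | even n-even v n≡ = cong (λ x → isOdd (suc x)) n≡ ∙ isOdd-odd v ∙ cong not (≡.sym n-even)
... | odd  n-odd  v n≡ = cong (λ x → isOdd (suc x)) n≡ ∙ isOdd-even (suc v) ∙ cong not (≡.sym n-odd)

inverse-mod : ∀ {τ u} → Coprime τ u → ∃ λ c → + u S.∣ (+ τ ℤ.* c ℤ.- 1ℤ)
inverse-mod {τ} {u} cop with coprime-Bézout cop
... | Bézout.+- x y eq = + x , S.divides (+ y) (lemma (+ τ) (+ x) ∙
        cong (ℤ._- 1ℤ) (≡.sym (ℤₚ.pos-* x τ) ∙ cong +_ (≡.sym eq) ∙ ℤₚ.pos-+ 1 (y * u) ∙ cong (λ v → 1ℤ ℤ.+ v) (ℤₚ.pos-* y u)) ∙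
          lemma′ (+ y ℤ.* + u))
  where
  lemma : ∀ t x → t ℤ.* x ℤ.- 1ℤ ≡ x ℤ.* t ℤ.- 1ℤ
  lemma = solve-∀
  lemma′ : ∀ z → 1ℤ ℤ.+ z ℤ.- 1ℤ ≡ z
  lemma′ = solve-∀
... | Bézout.-+ x y eq = ℤ.- + x , S.divides (ℤ.- + y) (lemma (+ τ) (+ x) ∙
        cong ℤ.-_ (cong (λ v → 1ℤ ℤ.+ v) (≡.sym (ℤₚ.pos-* x τ)) ∙ ≡.sym (ℤₚ.pos-+ 1 (x * τ)) ∙ cong +_ eq ∙ ℤₚ.pos-* y u) ∙
          ℤₚ.neg-distribˡ-* (+ y) (+ u))
  where
  lemma : ∀ t x → t ℤ.* ℤ.- x ℤ.- 1ℤ ≡ ℤ.- (1ℤ ℤ.+ x ℤ.* t)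
  lemma = solve-∀

solve-congruence : ∀ {τ u} .{{_ : ℕ.NonZero u}} → Coprime τ u → ∀ z →
  ∃ λ i → i < u × + u S.∣ (+ (τ * i) ℤ.- z)
solve-congruence {τ} {u} cop z with inverse-mod cop
... | c , u∣ = i , n%ℕd<d (c ℤ.* z) u , subst (+ u S.∣_) (≡.sym eq)
        (S.∣m∣n⇒∣m-n (S.∣m⇒∣m*n z u∣) (S.∣n⇒∣m*n (+ τ ℤ.* v) S.∣-refl))
  where
  i = (c ℤ.* z) %ℕ u
  v = (c ℤ.* z) /ℕ u
  lemma : ∀ τ c z v u → τ ℤ.* (c ℤ.* z ℤ.- v ℤ.* u) ℤ.- z ≡ (τ ℤ.* c ℤ.- 1ℤ) ℤ.* z ℤ.- τ ℤ.* v ℤ.* u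
  lemma = solve-∀
  isolate : ∀ i w → i ≡ i ℤ.+ w ℤ.- w
  isolate = solve-∀
  eq : + (τ * i) ℤ.- z ≡ (+ τ ℤ.* c ℤ.- 1ℤ) ℤ.* z ℤ.- + τ ℤ.* v ℤ.* + u
  eq = cong (ℤ._- z) (ℤₚ.pos-* τ i ∙ cong (+ τ ℤ.*_) (isolate (+ i) (v ℤ.* + u) ∙
    cong (ℤ._- v ℤ.* + u) (≡.sym (a≡a%ℕn+[a/ℕn]*n (c ℤ.* z) u)))) ∙ lemma (+ τ) c z v (+ u)

coprime-cancel : ∀ {τ u} → Coprime τ u → ∀ x → + u S.∣ (+ τ ℤ.* x) → + u S.∣ x
coprime-cancel {τ} {u} cop x u∣τx with inverse-mod cop
... | c , u∣ = subst (+ u S.∣_) (lemma (+ τ) c x) (S.∣m∣n⇒∣m-n (S.∣m⇒∣m*n c u∣τx) (S.∣m⇒∣m*n x u∣))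
  where
  lemma : ∀ τ c x → τ ℤ.* x ℤ.* c ℤ.- (τ ℤ.* c ℤ.- 1ℤ) ℤ.* x ≡ x
  lemma = solve-∀

-- Finite fields

p∤k! : ∀ {p} → Prime p → ∀ k → k < p → ¬ (p ∣ k !)
p∤k! {p} pp zero    k<p p∣1 = ℕₚ.<⇒≱ (ℕ.nonTrivial⇒n>1 p {{prime⇒nonTrivial pp}}) (∣⇒≤ p∣1)
p∤k! {p} pp (suc k) k<p p∣ with euclidsLemma (suc k) (k !) pp p∣
... | inj₁ p∣1+k = ℕₚ.<⇒≱ k<p (∣⇒≤ p∣1+k)
... | inj₂ p∣k!  = p∤k! pp k (ℕₚ.<-trans (ℕₚ.n<1+n k) k<p) p∣k!

-- p divides p! = C(p,k) k! (p-k)! but neither of the two factorials.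
p∣pCk : ∀ {p} → Prime p → ∀ k → 0 < k → k < p → p ∣ p C k
p∣pCk {suc p} pp k 0<k k<p with euclidsLemma (suc p C k) (k ! * (suc p ∸ k) !) pp p∣
  where
  k≤p = ℕₚ.<⇒≤ k<p
  instance _ = k ℕₚ.!* (suc p ∸ k) !≢0
  p∣ : suc p ∣ (suc p C k) * (k ! * (suc p ∸ k) !)
  p∣ = subst (suc p ∣_) (≡.sym (cong (_* (k ! * (suc p ∸ k) !)) (nCk≡n!/k![n-k]! k≤p) ∙ m/n*n≡m (k![n∸k]!∣n! k≤p))) (m∣m*n (p !))
... | inj₁ p∣C = p∣C
... | inj₂ p∣! with euclidsLemma (k !) ((suc p ∸ k) !) pp p∣!
...   | inj₁ p∣k! = ⊥-elim (p∤k! pp k k<p p∣k!)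
...   | inj₂ p∣k! = ⊥-elim (p∤k! pp (suc p ∸ k) (ℕₚ.∸-monoʳ-< 0<k (ℕₚ.<⇒≤ k<p)) p∣k!)

module FieldProperties {c ℓ : Level} (K : FiniteField c ℓ) where
  open FF K public
  open FiniteField K public
    renaming (_+_ to _⊕_; _*_ to _⊗_; -_ to ⊖_; zero to ⊗-zero; _≟_ to infix 4 _≟_)
    hiding (_-_)
  open RangeSum commRing public using () renaming (∑ to ∑ᴷ)
  module ∑ᴷ = RangeSum commRing
  open import Algebra.Properties.Ring ring public
    using (-‿distribˡ-*; -‿distribʳ-*; -1*x≈-x)
  open import Algebra.Properties.AbelianGroup +-abelianGroup public
    using () renaming (∙-cancelˡ to ⊕-cancelˡ;
      inverseʳ-unique to ⊖-uniqueʳ; inverseˡ-unique to ⊖-uniqueˡ; ⁻¹-involutive to ⊖-involutive;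
      ε⁻¹≈ε to ⊖0≈0)
  open import Algebra.Properties.Semiring.Exp semiring
    using (^-homo-*; ^-assocʳ) renaming (_^_ to _^ᴷ_)
  open import Algebra.Properties.CommutativeSemiring.Exp commutativeSemiring using (^-distrib-*)
  open import Algebra.Properties.Semiring.Mult semiring as Mult using (×1-homo-*; ×-assoc-*) renaming (_×_ to _×ᴷ_)
  open import Relation.Binary.Reasoning.Setoid setoid
  open import Algebra.Properties.CommutativeMonoid.Sum +-commutativeMonoid
    using (sum; sum-permute; sum-cong-≋; sum-replicate) renaming (∑-distrib-+ to sum-distrib-+)
  import Algebra.Properties.Monoid.Sum +-monoid as MSum
  open import Algebra.Properties.CommutativeSemiring.Binomial commutativeSemiring
    using (theorem; binomialTerm)

  infixr 5 _⨾_
  _⨾_ : ∀ {x y z} → x ≈ y → y ≈ z → x ≈ z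
  _⨾_ = trans

  pow≡^ : ∀ x n → pow x n ≡ x ^ᴷ n
  pow≡^ x zero    = ≡.refl
  pow≡^ x (suc n) = cong (x ⊗_) (pow≡^ x n)

  ι≡× : ∀ n → ι n ≡ n ×ᴷ 1#
  ι≡× zero    = ≡.refl
  ι≡× (suc n) = cong (1# ⊕_) (ι≡× n)

  sumTo≡∑ : ∀ n f → sumTo n f ≡ ∑ᴷ n f
  sumTo≡∑ zero    f = ≡.refl
  sumTo≡∑ (suc n) f = cong (_⊕ f n) (sumTo≡∑ n f)

  pow-cong : ∀ n {x y} → x ≈ y → pow x n ≈ pow y n
  pow-cong zero    x≈y = refl
  pow-cong (suc n) x≈y = *-cong x≈y (pow-cong n x≈y)

  pow-congʳ : ∀ x {m n} → m ≡ n → pow x m ≈ pow x n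
  pow-congʳ x eq = reflexive (cong (pow x) eq)

  pow-+ : ∀ x m n → pow x (m + n) ≈ pow x m ⊗ pow x n
  pow-+ x m n rewrite pow≡^ x (m + n) | pow≡^ x m | pow≡^ x n = ^-homo-* x m n

  pow-* : ∀ x m n → pow x (m * n) ≈ pow (pow x m) n
  pow-* x m n rewrite pow≡^ x (m * n) | pow≡^ x m | pow≡^ (x ^ᴷ m) n = sym (^-assocʳ x m n)

  pow-comm : ∀ x m n → pow (pow x m) n ≈ pow (pow x n) m
  pow-comm x m n = sym (pow-* x m n) ⨾ pow-congʳ x (ℕₚ.*-comm m n) ⨾ pow-* x n m

  pow-⊗ : ∀ x y n → pow (x ⊗ y) n ≈ pow x n ⊗ pow y n
  pow-⊗ x y n rewrite pow≡^ (x ⊗ y) n | pow≡^ x n | pow≡^ y n = ^-distrib-* x y n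

  pow-1# : ∀ n → pow 1# n ≈ 1#
  pow-1# zero    = refl
  pow-1# (suc n) = *-identityˡ _ ⨾ pow-1# n

  pow-0# : ∀ n → 0 < n → pow 0# n ≈ 0#
  pow-0# (suc n) _ = zeroˡ _

  pow-fixed : ∀ q {x} → pow x q ≈ x → ∀ i → pow x (q ^ i) ≈ x
  pow-fixed q     x^q≈x zero    = *-identityʳ _
  pow-fixed q {x} x^q≈x (suc i) =
    pow-* x q (q ^ i) ⨾ pow-cong (q ^ i) x^q≈x ⨾ pow-fixed q x^q≈x i

  frobenius-periodic : ∀ q n {x} → pow x (q ^ n) ≈ x → ∑ᴷ.Periodic n (λ i → pow x (q ^ i))
  frobenius-periodic q n {x} fixed i =
    pow-congʳ x (cong (q ^_) (ℕₚ.+-comm i n) ∙ ℕₚ.^-distribˡ-+-* q n i) ⨾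
      pow-* x (q ^ n) (q ^ i) ⨾ pow-cong (q ^ i) fixed

  pow-% : ∀ x i .{{_ : ℕ.NonZero i}} → pow x i ≈ 1# → ∀ k → pow x (k % i) ≈ pow x k
  pow-% x i x^i≈1 k = sym (begin
    pow x k ≡⟨ cong (pow x) (m≡m%n+[m/n]*n k i) ⟩
    pow x (k % i + k ℕ./ i * i) ≈⟨ pow-+ x (k % i) _ ⟩
    pow x (k % i) ⊗ pow x (k ℕ./ i * i) ≈⟨ *-congˡ (pow-congʳ x (ℕₚ.*-comm (k ℕ./ i) i) ⨾
                                             pow-* x i (k ℕ./ i) ⨾ pow-cong (k ℕ./ i) x^i≈1 ⨾ pow-1# (k ℕ./ i)) ⟩
    pow x (k % i) ⊗ 1# ≈⟨ *-identityʳ _ ⟩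
    pow x (k % i) ∎)

  ι-* : ∀ m n → ι (m * n) ≈ ι m ⊗ ι n
  ι-* m n rewrite ι≡× (m * n) | ι≡× m | ι≡× n = ×1-homo-* m n

  ι-^ : ∀ m n → ι (m ^ n) ≈ pow (ι m) n
  ι-^ m zero    = +-identityʳ 1#
  ι-^ m (suc n) = ι-* m (m ^ n) ⨾ *-congˡ (ι-^ m n)

  ∑ᴷ-const : ∀ n x → ∑ᴷ n (λ _ → x) ≈ ι n ⊗ x
  ∑ᴷ-const zero    x = sym (zeroˡ x)
  ∑ᴷ-const (suc n) x = begin
    ∑ᴷ n (λ _ → x) ⊕ x ≈⟨ +-cong (∑ᴷ-const n x) (sym (*-identityˡ x)) ⟩
    ι n ⊗ x ⊕ 1# ⊗ x ≈⟨ +-comm _ _ ⟩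
    1# ⊗ x ⊕ ι n ⊗ x ≈⟨ distribʳ x 1# (ι n) ⟨
    (1# ⊕ ι n) ⊗ x ∎

  ⊗-cancelˡ : ∀ x {y z} → ¬ (x ≈ 0#) → x ⊗ y ≈ x ⊗ z → y ≈ z
  ⊗-cancelˡ x {y} {z} x≉0 eq with inverse x x≉0
  ... | x⁻¹ , xx⁻¹≈1 = sym (undo y) ⨾ *-congˡ eq ⨾ undo z
    where
    undo : ∀ w → x⁻¹ ⊗ (x ⊗ w) ≈ w
    undo w = sym (*-assoc _ _ _) ⨾
      *-congʳ (*-comm _ _ ⨾ xx⁻¹≈1) ⨾ *-identityˡ w

  integral : ∀ x {y} → x ⊗ y ≈ 0# → ¬ (x ≈ 0#) → y ≈ 0#
  integral x eq x≉0 = ⊗-cancelˡ x x≉0 (eq ⨾ sym (zeroʳ x))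

  ⊗-≉0 : ∀ {x y} → ¬ (x ≈ 0#) → ¬ (y ≈ 0#) → ¬ (x ⊗ y ≈ 0#)
  ⊗-≉0 {x} x≉0 y≉0 eq = y≉0 (integral x eq x≉0)

  pow-≉0 : ∀ {x} n → ¬ (x ≈ 0#) → ¬ (pow x n ≈ 0#)
  pow-≉0 zero    x≉0 1≈0 = 0≉1 (sym 1≈0)
  pow-≉0 (suc n) x≉0     = ⊗-≉0 x≉0 (pow-≉0 n x≉0)

  unit-≉0 : ∀ {x y} → x ⊗ y ≈ 1# → ¬ (x ≈ 0#)
  unit-≉0 {x} {y} xy≈1 x≈0 = 0≉1 (sym (zeroˡ y) ⨾ *-congʳ (sym x≈0) ⨾ xy≈1)

  -- Translation by 1 permutes the field, so the sum of all elements does not change when `size`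
  -- copies of 1 are added to it.
  ι-size : ι size ≈ 0#
  ι-size = sym (⊕-cancelˡ (sum enum) _ _ (begin
    sum enum ⊕ 0# ≈⟨ +-identityʳ _ ⟩
    sum enum ≈⟨ sum-permute enum π ⟩
    sum (λ i → enum (idx (enum i ⊕ 1#))) ≈⟨ sum-cong-≋ (λ i → idx-≈ (enum i ⊕ 1#)) ⟩
    sum (λ i → enum i ⊕ 1#) ≈⟨ sum-distrib-+ enum (λ _ → 1#) ⟩
    sum enum ⊕ sum {size} (λ _ → 1#) ≈⟨ +-congˡ (sum-replicate size) ⟩
    sum enum ⊕ size ×ᴷ 1# ≡⟨ cong (sum enum ⊕_) (ι≡× size) ⟨
    sum enum ⊕ ι size ∎))
    where
    idx : Carrier → Fin size
    idx x = proj₁ (enum-sur x)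
    idx-≈ : ∀ x → enum (idx x) ≈ x
    idx-≈ x = proj₂ (enum-sur x)
    cancel : ∀ x y z → y ⊕ z ≈ 0# → (x ⊕ y) ⊕ z ≈ x
    cancel x y z eq = +-assoc x y z ⨾ +-congˡ eq ⨾ +-identityʳ x
    π = permutation (λ i → idx (enum i ⊕ 1#)) (λ i → idx (enum i ⊕ ⊖ 1#))
      (λ i → enum-inj _ _ (idx-≈ _ ⨾ +-congʳ (idx-≈ _) ⨾ cancel _ _ _ (-‿inverseˡ 1#)))
      (λ i → enum-inj _ _ (idx-≈ _ ⨾ +-congʳ (idx-≈ _) ⨾ cancel _ _ _ (-‿inverseʳ 1#)))

  -- ι(p)^n = ι(size) = 0, and a field has no nilpotents.
  characteristic : ∀ p n → size ≡ p ^ n → ι p ≈ 0#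
  characteristic p n eq with ι p ≟ 0#
  ... | yes ιp≈0 = ιp≈0
  ... | no  ιp≉0 = ⊥-elim (pow-≉0 n ιp≉0
    (sym (ι-^ p n) ⨾ reflexive (cong ι (≡.sym eq)) ⨾ ι-size))

  module Frobenius {p} (prime : Prime p) (ιp≈0 : ι p ≈ 0#) where

    multiple≈0 : ∀ {k} x → p ∣ k → k ×ᴷ x ≈ 0#
    multiple≈0 {k} x (divides q k≡qp) = begin
      k ×ᴷ x ≈⟨ Mult.×-congʳ k (sym (*-identityˡ x)) ⟩
      k ×ᴷ (1# ⊗ x) ≈⟨ ×-assoc-* k 1# x ⟨
      (k ×ᴷ 1#) ⊗ x ≡⟨ cong (_⊗ x) (≡.sym (ι≡× k) ∙ cong ι k≡qp) ⟩
      ι (q * p) ⊗ x ≈⟨ *-congʳ (ι-* q p ⨾ *-congˡ ιp≈0 ⨾ zeroʳ _) ⟩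
      0# ⊗ x ≈⟨ zeroˡ x ⟩
      0# ∎

    sum-ends : ∀ n (f : Fin (suc (suc n)) → Carrier) →
      (∀ i → f (Fin.suc (Fin.inject₁ i)) ≈ 0#) →
      sum f ≈ f Fin.zero ⊕ f (fromℕ (suc n))
    sum-ends n f mid = +-congˡ (begin
      sum (λ i → f (Fin.suc i)) ≈⟨ MSum.sum-init-last (λ i → f (Fin.suc i)) ⟩
      sum (λ i → f (Fin.suc (Fin.inject₁ i))) ⊕ f (fromℕ (suc n)) ≈⟨ +-congʳ (sum-cong-≋ mid ⨾ MSum.sum-replicate-zero n) ⟩
      0# ⊕ f (fromℕ (suc n)) ≈⟨ +-identityˡ _ ⟩
      f (fromℕ (suc n)) ∎)

    frobenius-⊕ : ∀ x y → pow (x ⊕ y) p ≈ pow x p ⊕ pow y p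
    frobenius-⊕ = go p ≡.refl
      where
      go : ∀ k → k ≡ p → ∀ x y → pow (x ⊕ y) k ≈ pow x k ⊕ pow y k
      go zero          ≡.refl = ⊥-elim (ℕₚ.<⇒≱ (ℕ.nonTrivial⇒n>1 p {{prime⇒nonTrivial prime}}) z≤n)
      go (suc zero)    ≡.refl = ⊥-elim (ℕₚ.<-irrefl ≡.refl (ℕ.nonTrivial⇒n>1 p {{prime⇒nonTrivial prime}}))
      go (suc (suc n)) ≡.refl x y = begin
        pow (x ⊕ y) k ≡⟨ pow≡^ _ k ⟩
        (x ⊕ y) ^ᴷ k ≈⟨ theorem k x y ⟩
        sum (binomialTerm x y k) ≈⟨ sum-ends (suc n) (binomialTerm x y k) mid ⟩
        binomialTerm x y k Fin.zero ⊕ binomialTerm x y k (fromℕ k) ≈⟨ +-cong first last ⟩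
        pow y k ⊕ pow x k ≈⟨ +-comm _ _ ⟩
        pow x k ⊕ pow y k ∎
        where
        k = suc (suc n)
        mid : ∀ i → binomialTerm x y k (Fin.suc (Fin.inject₁ i)) ≈ 0#
        mid i = multiple≈0 _ (p∣pCk prime _ (s≤s z≤n)
          (s≤s (subst (_< suc n) (≡.sym (Finₚ.toℕ-inject₁ i)) (Finₚ.toℕ<n i))))
        first : binomialTerm x y k Fin.zero ≈ pow y k
        first = +-identityʳ _ ⨾ *-identityˡ _ ⨾ reflexive (≡.sym (pow≡^ y k))
        last : binomialTerm x y k (fromℕ k) ≈ pow x k
        last = reflexive (cong (λ j → (k C j) ×ᴷ ((x ^ᴷ j) ⊗ (y ^ᴷ (k ∸ j)))) (Finₚ.toℕ-fromℕ k)) ⨾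
          top k
          where
          top : ∀ k → (k C k) ×ᴷ ((x ^ᴷ k) ⊗ (y ^ᴷ (k ∸ k))) ≈ pow x k
          top k rewrite nCn≡1 k | ℕₚ.n∸n≡0 k =
            +-identityʳ _ ⨾ *-identityʳ _ ⨾ reflexive (≡.sym (pow≡^ x k))

    frobenius-^-⊕ : ∀ e x y → pow (x ⊕ y) (p ^ e) ≈ pow x (p ^ e) ⊕ pow y (p ^ e)
    frobenius-^-⊕ zero    x y = *-identityʳ _ ⨾ +-cong (sym (*-identityʳ x)) (sym (*-identityʳ y))
    frobenius-^-⊕ (suc e) x y = begin
      pow (x ⊕ y) (p * p ^ e) ≈⟨ pow-* (x ⊕ y) p (p ^ e) ⟩
      pow (pow (x ⊕ y) p) (p ^ e) ≈⟨ pow-cong (p ^ e) (frobenius-⊕ x y) ⟩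
      pow (pow x p ⊕ pow y p) (p ^ e) ≈⟨ frobenius-^-⊕ e (pow x p) (pow y p) ⟩
      pow (pow x p) (p ^ e) ⊕ pow (pow y p) (p ^ e) ≈⟨ +-cong (pow-* x p (p ^ e)) (pow-* y p (p ^ e)) ⟨
      pow x (p * p ^ e) ⊕ pow y (p * p ^ e) ∎

-- Orders of elements and of primitive elements

module Cyclic {c ℓ : Level} (K : FiniteField c ℓ) where
  open FieldProperties K public
  open import Relation.Binary.Reasoning.Setoid setoid

  record HasOrder (δ : Carrier) (N : ℕ) : Set ℓ where
    field
      0<N   : 0 < N
      pow-N : pow δ N ≈ 1#
      order : ∀ i → pow δ i ≈ 1# → N ∣ i

    instance
      N-nonZero : ℕ.NonZero N
      N-nonZero = ℕ.>-nonZero 0<N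

    pow-N* : ∀ k → pow δ (N * k) ≈ 1#
    pow-N* k = pow-* δ N k ⨾ pow-cong k pow-N ⨾ pow-1# k

    δ≉0 : ¬ (δ ≈ 0#)
    δ≉0 δ≈0 = 0≉1 (sym (pow-0# N 0<N) ⨾ pow-cong N (sym δ≈0) ⨾ pow-N)

    ≈⇒∣∸ : ∀ i j → i ≤ j → pow δ i ≈ pow δ j → N ∣ j ∸ i
    ≈⇒∣∸ i j i≤j eq = order (j ∸ i) (⊗-cancelˡ (pow δ i) (pow-≉0 i δ≉0) (begin
      pow δ i ⊗ pow δ (j ∸ i) ≈⟨ pow-+ δ i (j ∸ i) ⟨
      pow δ (i + (j ∸ i)) ≡⟨ cong (pow δ) (ℕₚ.m+[n∸m]≡n i≤j) ⟩
      pow δ j ≈⟨ eq ⟨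
      pow δ i ≈⟨ *-identityʳ _ ⟨
      pow δ i ⊗ 1# ∎))

    private
      ∸⇒- : ∀ {i j} → i ≤ j → + (j ∸ i) ≡ + j ℤ.- + i
      ∸⇒- {i} {j} i≤j = ≡.sym (ℤₚ.⊖-≥ i≤j) ∙ ≡.sym (ℤₚ.m-n≡m⊖n j i)
      swap- : ∀ x y → ℤ.- (y ℤ.- x) ≡ x ℤ.- y
      swap- = solve-∀

    ≈⇒∣ : ∀ i j → pow δ i ≈ pow δ j → + N S.∣ (+ i ℤ.- + j)
    ≈⇒∣ i j eq with ℕₚ.≤-total i j
    ... | inj₁ i≤j = subst (+ N S.∣_) (cong ℤ.-_ (∸⇒- i≤j) ∙ swap- (+ i) (+ j))
      (S.∣m⇒∣-m (S.∣ᵤ⇒∣ (≈⇒∣∸ i j i≤j eq)))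
    ... | inj₂ j≤i = subst (+ N S.∣_) (∸⇒- j≤i) (S.∣ᵤ⇒∣ (≈⇒∣∸ j i j≤i (sym eq)))

    private
      ∣⇒≈′ : ∀ {i j} → i ≤ j → N ∣ j ∸ i → pow δ i ≈ pow δ j
      ∣⇒≈′ {i} {j} i≤j (divides k eq) = begin
        pow δ i ≈⟨ *-identityʳ _ ⟨
        pow δ i ⊗ 1# ≈⟨ *-congˡ (pow-N* k) ⟨
        pow δ i ⊗ pow δ (N * k) ≈⟨ pow-+ δ i (N * k) ⟨
        pow δ (i + N * k) ≡⟨ cong (pow δ) (cong (i ℕ.+_) (ℕₚ.*-comm N k ∙ ≡.sym eq) ∙ ℕₚ.m+[n∸m]≡n i≤j) ⟩
        pow δ j ∎

    ∣⇒≈ : ∀ i j → + N S.∣ (+ i ℤ.- + j) → pow δ i ≈ pow δ j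
    ∣⇒≈ i j N∣ with ℕₚ.≤-total i j
    ... | inj₁ i≤j = ∣⇒≈′ i≤j (S.∣⇒∣ᵤ (subst (+ N S.∣_)
      (swap- (+ j) (+ i) ∙ ≡.sym (∸⇒- i≤j)) (S.∣m⇒∣-m N∣)))
    ... | inj₂ j≤i = sym (∣⇒≈′ j≤i (S.∣⇒∣ᵤ (subst (+ N S.∣_) (≡.sym (∸⇒- j≤i)) N∣)))

  hasOrder-pow : ∀ {δ N} k N′ → HasOrder δ N → N ≡ k * N′ → HasOrder (pow δ k) N′
  hasOrder-pow {δ} {N} zero    N′ o ≡.refl = ⊥-elim (ℕₚ.<-irrefl ≡.refl (HasOrder.0<N o))
  hasOrder-pow {δ} {N} (suc k) zero o N≡ =
    ⊥-elim (ℕₚ.<-irrefl ≡.refl (subst (0 <_) (N≡ ∙ ℕₚ.*-zeroʳ k) (HasOrder.0<N o)))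
  hasOrder-pow {δ} {N} (suc k) (suc N′) o ≡.refl = record
    { 0<N   = s≤s z≤n
    ; pow-N = sym (pow-* δ (suc k) (suc N′)) ⨾ HasOrder.pow-N o
    ; order = λ i eq → *-cancelˡ-∣ (suc k) (HasOrder.order o (suc k * i)
        (pow-* δ (suc k) i ⨾ eq))
    }

  module _ {γ : Carrier} (prim : Primitive γ) (2<size : 2 < size) where

    private
      size≤ : ∀ {n} (f : Carrier → Fin n) → (∀ x y → f x ≡ f y → x ≈ y) → size ≤ n
      size≤ f inj = Finₚ.injective⇒≤ {f = λ i → f (enum i)}
        (λ {i} {j} eq → enum-inj i j (inj _ _ eq))

      0or1 : ∀ {x} → Dec (x ≈ 0#) → Fin 2
      0or1 (yes _) = Fin.zero
      0or1 (no  _) = Fin.suc Fin.zero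

    -- Since the zeroth power of 0 is 1, the element 0 satisfies `Primitive` in the field with two
    -- elements; `2 < size` excludes that case.
    primitive≉0 : ¬ (γ ≈ 0#)
    primitive≉0 γ≈0 = ℕₚ.<⇒≱ 2<size (size≤ (λ x → 0or1 (x ≟ 0#)) inj)
      where
      ≈1 : ∀ x → ¬ (x ≈ 0#) → x ≈ 1#
      ≈1 x x≉0 with prim x x≉0
      ... | zero  , eq = sym eq
      ... | suc k , eq = ⊥-elim (x≉0 (sym eq ⨾ *-congʳ γ≈0 ⨾ zeroˡ _))
      inj : ∀ x y → 0or1 (x ≟ 0#) ≡ 0or1 (y ≟ 0#) → x ≈ y
      inj x y eq with x ≟ 0# | y ≟ 0#
      ... | yes x≈0 | yes y≈0 = x≈0 ⨾ sym y≈0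
      ... | no x≉0  | no y≉0  = ≈1 x x≉0 ⨾ sym (≈1 y y≉0)

    private
      -- If γ^i = 1, logarithms modulo i already separate the nonzero elements, so there are at most
      -- i of these.
      size≤1+ : ∀ i → 0 < i → pow γ i ≈ 1# → size ≤ suc i
      size≤1+ i@(suc _) 0<i γ^i≈1 = size≤ (λ x → log x (x ≟ 0#)) (λ x y → inj x y (x ≟ 0#) (y ≟ 0#))
        where
        log : ∀ x → Dec (x ≈ 0#) → Fin (suc i)
        log x (yes _)   = Fin.zero
        log x (no x≉0)  = Fin.suc (fromℕ< (m%n<n (proj₁ (prim x x≉0)) i))
        inj : ∀ x y dx dy → log x dx ≡ log y dy → x ≈ y
        inj x y (yes x≈0) (yes y≈0) eq = x≈0 ⨾ sym y≈0
        inj x y (no x≉0)  (no y≉0)  eq = begin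
          x ≈⟨ proj₂ (prim x x≉0) ⟨
          pow γ k ≈⟨ pow-% γ i γ^i≈1 k ⟨
          pow γ (k % i) ≡⟨ cong (pow γ) (≡.sym (Finₚ.toℕ-fromℕ< _) ∙ cong toℕ (Finₚ.suc-injective eq) ∙ Finₚ.toℕ-fromℕ< _) ⟩
          pow γ (l % i) ≈⟨ pow-% γ i γ^i≈1 l ⟩
          pow γ l ≈⟨ proj₂ (prim y y≉0) ⟩
          y ∎
          where
          k = proj₁ (prim x x≉0)
          l = proj₁ (prim y y≉0)

      -- Two of the `size + 1` elements 0, γ^0, ..., γ^(size - 1) coincide, and 0 is not one of the
      -- two. The exponents differ by a period below `size`; together with `size≤1+` this forces it
      -- to be `size - 1`.
      cycle : ∃ λ o → 0 < o × o < size × pow γ o ≈ 1#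
      cycle = analyse (Finₚ.pigeonhole (ℕₚ.n<1+n size) (λ i → proj₁ (enum-sur (val i))))
        where
        val : Fin (suc size) → Carrier
        val Fin.zero    = 0#
        val (Fin.suc i) = pow γ (toℕ i)
        analyse : (∃ λ i → ∃ λ j → i Fin.< j × proj₁ (enum-sur (val i)) ≡ proj₁ (enum-sur (val j))) → _
        analyse (i , j , i<j , eq) = go i j i<j
          (sym (proj₂ (enum-sur (val i))) ⨾ reflexive (cong enum eq) ⨾ proj₂ (enum-sur (val j)))
          where
          go : ∀ i j → i Fin.< j → val i ≈ val j → _
          go Fin.zero    (Fin.suc j) _         0≈ = ⊥-elim (pow-≉0 (toℕ j) primitive≉0 (sym 0≈))
          go (Fin.suc i) (Fin.suc j) (s≤s i<j) eq = toℕ j ∸ toℕ i , ℕₚ.m<n⇒0<n∸m i<j ,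
            ℕₚ.≤-<-trans (ℕₚ.m∸n≤m (toℕ j) (toℕ i)) (Finₚ.toℕ<n j) ,
            ⊗-cancelˡ (pow γ (toℕ i)) (pow-≉0 (toℕ i) primitive≉0) (begin
              pow γ (toℕ i) ⊗ pow γ (toℕ j ∸ toℕ i) ≈⟨ pow-+ γ (toℕ i) _ ⟨
              pow γ (toℕ i + (toℕ j ∸ toℕ i)) ≡⟨ cong (pow γ) (ℕₚ.m+[n∸m]≡n (ℕₚ.<⇒≤ i<j)) ⟩
              pow γ (toℕ j) ≈⟨ eq ⟨
              pow γ (toℕ i) ≈⟨ *-identityʳ _ ⟨
              pow γ (toℕ i) ⊗ 1# ∎)

    primitive-order : ∀ {N} → size ≡ suc N → HasOrder γ N
    primitive-order {N} size≡ = record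
      { 0<N   = subst (0 <_) o≡N (proj₁ (proj₂ cycle))
      ; pow-N = γ^N≈1
      ; order = order
      }
      where
      0<o = proj₁ (proj₂ cycle)
      o≡N : proj₁ cycle ≡ N
      o≡N = ℕₚ.≤-antisym
        (ℕₚ.≤-pred (subst (proj₁ cycle <_) size≡ (proj₁ (proj₂ (proj₂ cycle)))))
        (ℕₚ.≤-pred (subst (_≤ suc (proj₁ cycle)) size≡ (size≤1+ _ 0<o (proj₂ (proj₂ (proj₂ cycle))))))
      γ^N≈1 : pow γ N ≈ 1#
      γ^N≈1 = subst (λ o → pow γ o ≈ 1#) o≡N (proj₂ (proj₂ (proj₂ cycle)))
      instance _ = ℕ.>-nonZero (subst (0 <_) o≡N 0<o)
      order : ∀ i → pow γ i ≈ 1# → N ∣ i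
      order i γ^i≈1 with i % N in eq
      ... | zero  = m%n≡0⇒n∣m i N eq
      ... | suc r = ⊥-elim (ℕₚ.<⇒≱ (subst (_< N) eq (m%n<n i N))
        (ℕₚ.≤-pred (subst (_≤ suc (suc r)) size≡ (size≤1+ (suc r) (s≤s z≤n) γ^r≈1))))
        where
        γ^r≈1 : pow γ (suc r) ≈ 1#
        γ^r≈1 = pow-congʳ γ (≡.sym eq) ⨾ pow-% γ N γ^N≈1 i ⨾ γ^i≈1

-- Subfields and sums over their elements

module Subfields {c ℓ : Level} (K : FiniteField c ℓ) where
  open Cyclic K public
  module ≈-Reasoning = SetoidReasoning setoid

  FrobeniusAdditive : ℕ → Set (c ⊔ ℓ)
  FrobeniusAdditive P = ∀ i x y → pow (x ⊕ y) (P ^ i) ≈ pow x (P ^ i) ⊕ pow y (P ^ i)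

  Vanishes : ℕ → Set ℓ
  Vanishes n = ι n ≈ 0#

  -- The fixed field of x ↦ x^(N+1), with multiplicative generator δ.
  record Subfield (N : ℕ) (δ : Carrier) : Set (c ⊔ ℓ) where
    field
      hasOrder : HasOrder δ N
      log      : ∀ x → pow x (suc N) ≈ x → ¬ (x ≈ 0#) → ∃ λ i → pow δ i ≈ x
      additive : ∀ x y → pow (x ⊕ y) (suc N) ≈ pow x (suc N) ⊕ pow y (suc N)
    open HasOrder hasOrder public

    Mem : Carrier → Set ℓ
    Mem x = pow x (suc N) ≈ x

    mem-0 : Mem 0#
    mem-0 = zeroˡ _

    mem-⊕ : ∀ {x y} → Mem x → Mem y → Mem (x ⊕ y)
    mem-⊕ mx my = additive _ _ ⨾ +-cong mx my

    mem-⊗ : ∀ {x y} → Mem x → Mem y → Mem (x ⊗ y)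
    mem-⊗ mx my = pow-⊗ _ _ (suc N) ⨾ *-cong mx my

    mem-⊖ : ∀ {x} → Mem x → Mem (⊖ x)
    mem-⊖ {x} mx = ⊖-uniqueʳ x (pow (⊖ x) (suc N)) (begin
      x ⊕ pow (⊖ x) (suc N) ≈⟨ +-congʳ mx ⟨
      pow x (suc N) ⊕ pow (⊖ x) (suc N) ≈⟨ additive x (⊖ x) ⟨
      pow (x ⊕ ⊖ x) (suc N) ≈⟨ pow-cong (suc N) (-‿inverseʳ x) ⟩
      pow 0# (suc N) ≈⟨ mem-0 ⟩
      0# ∎)
      where open ≈-Reasoning

    mem-inv : ∀ {x y} → x ⊗ y ≈ 1# → Mem x → Mem y
    mem-inv {x} {y} xy≈1 mx = ⊗-cancelˡ x (unit-≉0 xy≈1) (begin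
      x ⊗ pow y (suc N) ≈⟨ *-congʳ mx ⟨
      pow x (suc N) ⊗ pow y (suc N) ≈⟨ pow-⊗ x y (suc N) ⟨
      pow (x ⊗ y) (suc N) ≈⟨ pow-cong (suc N) xy≈1 ⟩
      pow 1# (suc N) ≈⟨ pow-1# (suc N) ⟩
      1# ≈⟨ xy≈1 ⟨
      x ⊗ y ∎)
      where open ≈-Reasoning

    mem-pow : ∀ {x} n → Mem x → Mem (pow x n)
    mem-pow {x} n mx = pow-comm x n (suc N) ⨾ pow-cong n mx

    mem-gen : ∀ i → Mem (pow δ i)
    mem-gen i = mem-pow i (*-congˡ pow-N ⨾ *-identityʳ δ)

    mem-≈ : ∀ {x y} → x ≈ y → Mem x → Mem y
    mem-≈ x≈y mx = pow-cong (suc N) (sym x≈y) ⨾ mx ⨾ x≈y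

    elt : ℕ → Carrier
    elt zero    = 0#
    elt (suc i) = pow δ i

    mem-elt : ∀ i → Mem (elt i)
    mem-elt zero    = mem-0
    mem-elt (suc i) = mem-gen i

    ∑ꟳ : (Carrier → ℤ) → ℤ
    ∑ꟳ f = ∑ (suc N) (λ i → f (elt i))

    ∑ꟳ-head : ∀ f → ∑ꟳ f ≡ f 0# ℤ.+ ∑ N (λ i → f (pow δ i))
    ∑ꟳ-head f = ∑-head N (λ i → f (elt i))

    ∑ꟳ-cong : ∀ {f g} → (∀ x → Mem x → f x ≡ g x) → ∑ꟳ f ≡ ∑ꟳ g
    ∑ꟳ-cong f≡g = ∑-cong′ (suc N) (λ i → f≡g (elt i) (mem-elt i))

    elt-injective : ∀ {i j} → i < suc N → j < suc N → elt i ≈ elt j → i ≡ j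
    elt-injective {zero}  {zero}  _ _ _ = ≡.refl
    elt-injective {zero}  {suc j} _ _ eq = ⊥-elim (pow-≉0 j δ≉0 (sym eq))
    elt-injective {suc i} {zero}  _ _ eq = ⊥-elim (pow-≉0 i δ≉0 eq)
    elt-injective {suc i} {suc j} (s≤s i<N) (s≤s j<N) eq =
      cong suc ([ (λ i≤j → small i≤j j<N eq) , (λ j≤i → ≡.sym (small j≤i i<N (sym eq))) ]′ (ℕₚ.≤-total i j))
      where
      small : ∀ {i j} → i ≤ j → j < N → pow δ i ≈ pow δ j → i ≡ j
      small {i} {j} i≤j j<N eq with j ∸ i in d | ≈⇒∣∸ i j i≤j eq
      ... | zero  | _  = ℕₚ.≤-antisym i≤j (ℕₚ.m∸n≡0⇒m≤n d)
      ... | suc _ | N∣ = ⊥-elim (ℕₚ.<⇒≱ j<N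
        (ℕₚ.≤-trans (∣⇒≤ N∣) (subst (_≤ j) d (ℕₚ.m∸n≤m j i))))

    elt-surjective : ∀ {x} → Mem x → ∃ λ i → i < suc N × elt i ≈ x
    elt-surjective {x} mx with x ≟ 0#
    ... | yes x≈0 = 0 , s≤s z≤n , sym x≈0
    ... | no  x≉0 with log x mx x≉0
    ...   | i , eq = suc (i % N) , s≤s (m%n<n i N) , pow-% δ N pow-N i ⨾ eq

    ∑ꟳ-delta : ∀ {x} → Mem x → ∑ꟳ (λ y → ⟦ y ≟ x ⟧) ≡ 1ℤ
    ∑ꟳ-delta {x} mx with elt-surjective mx
    ... | j , j<Q , eq = ∑-unique (suc N) _ j<Q (λ i i<Q i≢j → ⟦⟧-no _ (λ eq′ → i≢j (elt-injective i<Q j<Q (eq′ ⨾ sym eq)))) ∙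
      ⟦⟧-yes _ eq

    Respects : (Carrier → ℤ) → Set (c ⊔ ℓ)
    Respects f = ∀ {x y} → x ≈ y → f x ≡ f y

    ∑ꟳ-evaluate : ∀ {f x} → Respects f → Mem x → ∑ꟳ (λ y → ⟦ y ≟ x ⟧ ℤ.* f y) ≡ f x
    ∑ꟳ-evaluate {f} {x} resp mx = ∑-cong′ (suc N) (λ i → swap-arg (elt i)) ∙
      ≡.sym (*-distribʳ-∑ (f x) (suc N) (λ i → ⟦ elt i ≟ x ⟧)) ∙
        cong (ℤ._* f x) (∑ꟳ-delta mx) ∙ ℤₚ.*-identityˡ (f x)
      where
      swap-arg : ∀ y → ⟦ y ≟ x ⟧ ℤ.* f y ≡ ⟦ y ≟ x ⟧ ℤ.* f x
      swap-arg y with y ≟ x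
      ... | yes y≈x = cong (1ℤ ℤ.*_) (resp y≈x)
      ... | no  _   = ℤₚ.*-zeroˡ (f y) ∙ ≡.sym (ℤₚ.*-zeroˡ (f x))

    -- Each `f (φ x)` is spread out as a sum over y of [y = φ x] f(y), and the two sums are
    -- exchanged. In this way only the inverse map ψ on elements is needed, not the permutation that
    -- φ induces on exponents.
    ∑ꟳ-reindex : ∀ {f} → Respects f → (φ ψ : Carrier → Carrier) →
      (∀ {x} → Mem x → Mem (φ x)) → (∀ {x} → Mem x → Mem (ψ x)) →
      (∀ x y → x ≈ ψ y → y ≈ φ x) → (∀ x y → y ≈ φ x → x ≈ ψ y) →
      ∑ꟳ (λ x → f (φ x)) ≡ ∑ꟳ f
    ∑ꟳ-reindex {f} resp φ ψ φ∈ ψ∈ to from = begin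
      ∑ꟳ (λ x → f (φ x))
        ≡⟨ ∑ꟳ-cong (λ x mx → ≡.sym (∑ꟳ-evaluate resp (φ∈ mx))) ⟩
      ∑ꟳ (λ x → ∑ꟳ (λ y → ⟦ y ≟ φ x ⟧ ℤ.* f y))
        ≡⟨ ∑-swap (suc N) (suc N) (λ i j → ⟦ elt j ≟ φ (elt i) ⟧ ℤ.* f (elt j)) ⟩
      ∑ꟳ (λ y → ∑ꟳ (λ x → ⟦ y ≟ φ x ⟧ ℤ.* f y))
        ≡⟨ ∑ꟳ-cong (λ y my → ≡.sym (*-distribʳ-∑ (f y) (suc N) (λ i → ⟦ y ≟ φ (elt i) ⟧)) ∙
             cong (ℤ._* f y) (∑-cong′ (suc N) (λ i → ⟦⟧-cong _ (elt i ≟ ψ y) (from (elt i) y) (to (elt i) y)) ∙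
               ∑ꟳ-delta (ψ∈ my)) ∙
             ℤₚ.*-identityˡ (f y)) ⟩
      ∑ꟳ f ∎
      where open ≡.≡-Reasoning

    ∑ꟳ-translate : ∀ {f z} → Respects f → Mem z → ∑ꟳ (λ x → f (x ⊕ z)) ≡ ∑ꟳ f
    ∑ꟳ-translate {f} {z} resp mz = ∑ꟳ-reindex resp (_⊕ z) (_⊕ ⊖ z)
      (λ mx → mem-⊕ mx mz) (λ mx → mem-⊕ mx (mem-⊖ mz))
      (λ x y eq → sym (+-congʳ eq ⨾ cancel (-‿inverseˡ z)))
      (λ x y eq → sym (+-congʳ eq ⨾ cancel (-‿inverseʳ z)))
      where
      cancel : ∀ {x y z} → y ⊕ z ≈ 0# → (x ⊕ y) ⊕ z ≈ x
      cancel eq = +-assoc _ _ _ ⨾ +-congˡ eq ⨾ +-identityʳ _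

    ∑ꟳ-scale : ∀ {f z} → Respects f → Mem z → ¬ (z ≈ 0#) → ∑ꟳ (λ x → f (x ⊗ z)) ≡ ∑ꟳ f
    ∑ꟳ-scale {f} {z} resp mz z≉0 with inverse z z≉0
    ... | z⁻¹ , zz⁻¹≈1 = ∑ꟳ-reindex resp (_⊗ z) (_⊗ z⁻¹)
      (λ mx → mem-⊗ mx mz) (λ mx → mem-⊗ mx (mem-inv zz⁻¹≈1 mz))
      (λ x y eq → sym (*-congʳ eq ⨾ cancel (*-comm _ _ ⨾ zz⁻¹≈1)))
      (λ x y eq → sym (*-congʳ eq ⨾ cancel zz⁻¹≈1))
      where
      cancel : ∀ {x y z} → y ⊗ z ≈ 1# → (x ⊗ y) ⊗ z ≈ x
      cancel eq = *-assoc _ _ _ ⨾ *-congˡ eq ⨾ *-identityʳ _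

  -- A nonzero fixed point γ^k of x ↦ x^(N+1) has γ^(kN) = 1, so c N divides k N and γ^k is a power
  -- of γ^c.
  subfield : ∀ {γ N c} → HasOrder γ (c * N) → .{{ℕ.NonZero c}} → 0 < N →
    (∀ x → pow x (suc N) ≈ x → ¬ (x ≈ 0#) → ∃ λ i → pow γ i ≈ x) →
    (∀ x y → pow (x ⊕ y) (suc N) ≈ pow x (suc N) ⊕ pow y (suc N)) →
    Subfield N (pow γ c)
  subfield {γ} {N} {c} o 0<N gen add = record
    { hasOrder = hasOrder-pow c N o ≡.refl
    ; log      = log
    ; additive = add
    }
    where
    open ≈-Reasoning
    instance _ = ℕ.>-nonZero 0<N
    log : ∀ x → pow x (suc N) ≈ x → ¬ (x ≈ 0#) → ∃ λ i → pow (pow γ c) i ≈ x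
    log x mx x≉0 with gen x mx x≉0
    ... | k , eq with *-cancelʳ-∣ {c} {k} N (HasOrder.order o (k * N) (begin
          pow γ (k * N) ≈⟨ pow-* γ k N ⟩
          pow (pow γ k) N ≈⟨ pow-cong N eq ⟩
          pow x N ≈⟨ ⊗-cancelˡ x x≉0 (mx ⨾ sym (*-identityʳ x)) ⟩
          1# ∎))
    ...   | divides i k≡ic = i , sym (pow-* γ c i) ⨾ pow-congʳ γ (ℕₚ.*-comm c i ∙ ≡.sym k≡ic) ⨾ eq

-- Counting by exponents instead of by the enumeration of the field

open import Algebra.Properties.CommutativeMonoid.Sum ℤₚ.+-0-commutativeMonoid
  using (sum; sum-cong-≗) renaming (∑-distrib-+ to sum-distrib-+)
open import Algebra.Properties.Monoid.Sum ℤₚ.+-0-monoid using (sum-replicate-zero)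

sum-∑-swap : ∀ {n} N (f : Fin n → ℕ → ℤ) → sum (λ i → ∑ N (f i)) ≡ ∑ N (λ j → sum (λ i → f i j))
sum-∑-swap {n} zero    f = sum-replicate-zero n
sum-∑-swap     (suc N) f = sum-distrib-+ (λ i → ∑ N (f i)) (λ i → f i N) ∙
  cong (ℤ._+ sum (λ i → f i N)) (sum-∑-swap N f)

sum-unique : ∀ {n} (f : Fin n → ℤ) j → (∀ i → ¬ i ≡ j → f i ≡ 0ℤ) → sum f ≡ f j
sum-unique {suc n} f Fin.zero    f≡0 = cong (λ v → f Fin.zero ℤ.+ v) (sum-cong-≗ (λ i → f≡0 (Fin.suc i) (λ ())) ∙ sum-replicate-zero n) ∙
  ℤₚ.+-identityʳ _
sum-unique {suc n} f (Fin.suc j) f≡0 = cong₂ ℤ._+_ (f≡0 Fin.zero (λ ())) (sum-unique (λ i → f (Fin.suc i)) j (λ i i≢j → f≡0 (Fin.suc i) (λ eq → i≢j (Finₚ.suc-injective eq)))) ∙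
  ℤₚ.+-identityˡ _

sum-*ʳ : ∀ {n} (f : Fin n → ℤ) x → sum (λ i → f i ℤ.* x) ≡ sum f ℤ.* x
sum-*ʳ {zero}  f x = ≡.sym (ℤₚ.*-zeroˡ x)
sum-*ʳ {suc n} f x = cong (λ v → f Fin.zero ℤ.* x ℤ.+ v) (sum-*ʳ (λ i → f (Fin.suc i)) x) ∙
  ≡.sym (ℤₚ.*-distribʳ-+ x (f Fin.zero) (sum (λ i → f (Fin.suc i))))

module Enumeration {c ℓ : Level} (K : FiniteField c ℓ) where
  open Subfields K

  countFin≡sum : ∀ n (f : Fin n → Bool) → + countFin n f ≡ sum (λ i → if f i then 1ℤ else 0ℤ)
  countFin≡sum zero    f = ≡.refl
  countFin≡sum (suc n) f = ℤₚ.pos-+ (if f Fin.zero then 1 else 0) _ ∙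
    cong₂ ℤ._+_ (bit (f Fin.zero)) (countFin≡sum n (λ i → f (Fin.suc i)))
    where
    bit : ∀ b → + (if b then 1 else 0) ≡ (if b then 1ℤ else 0ℤ)
    bit true  = ≡.refl
    bit false = ≡.refl

  module _ {N : ℕ} {δ : Carrier} (ext : Subfield N δ) where
    open Subfield ext

    -- Double counting: [V x] is written as the sum over y in the subfield of [y = x] [V y], and
    -- each such y occurs exactly once in `enum`, whose order is unknown. The zero element drops out
    -- because of `¬V0`.
    count-units : ∀ {v} {V : Carrier → Set v} (V? : ∀ x → Dec (V x)) →
      (∀ {x y} → x ≈ y → V x → V y) → (∀ {x} → V x → Mem x) → ¬ V 0# →
      + countFin size (λ i → ⌊ V? (enum i) ⌋) ≡ ∑ N (λ i → ⟦ V? (pow δ i) ⟧)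
    count-units {V = V} V? resp V⊆ ¬V0 = begin
      + countFin size (λ i → ⌊ V? (enum i) ⌋)
        ≡⟨ countFin≡sum size _ ⟩
      sum (λ i → ⟦ V? (enum i) ⟧)
        ≡⟨ sum-cong-≗ (λ i → locate (enum i)) ⟩
      sum (λ i → ∑ꟳ (λ y → ⟦ y ≟ enum i ⟧ ℤ.* ⟦ V? y ⟧))
        ≡⟨ sum-∑-swap (suc N) (λ i l → ⟦ elt l ≟ enum i ⟧ ℤ.* ⟦ V? (elt l) ⟧) ⟩
      ∑ꟳ (λ y → sum (λ i → ⟦ y ≟ enum i ⟧ ℤ.* ⟦ V? y ⟧))
        ≡⟨ ∑ꟳ-cong (λ y _ → sum-*ʳ (λ i → ⟦ y ≟ enum i ⟧) ⟦ V? y ⟧ ∙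
             cong (ℤ._* ⟦ V? y ⟧) (one y) ∙ ℤₚ.*-identityˡ _) ⟩
      ∑ꟳ (λ y → ⟦ V? y ⟧)
        ≡⟨ ∑ꟳ-head (λ y → ⟦ V? y ⟧) ⟩
      ⟦ V? 0# ⟧ ℤ.+ ∑ N (λ i → ⟦ V? (pow δ i) ⟧)
        ≡⟨ cong (ℤ._+ ∑ N (λ i → ⟦ V? (pow δ i) ⟧)) (⟦⟧-no (V? 0#) ¬V0) ∙ ℤₚ.+-identityˡ _ ⟩
      ∑ N (λ i → ⟦ V? (pow δ i) ⟧) ∎
      where
      open ≡.≡-Reasoning
      locate : ∀ x → ⟦ V? x ⟧ ≡ ∑ꟳ (λ y → ⟦ y ≟ x ⟧ ℤ.* ⟦ V? y ⟧)
      locate x with V? x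
      ... | yes Vx = ≡.sym (∑ꟳ-evaluate {λ y → ⟦ V? y ⟧} (λ eq → ⟦⟧-cong (V? _) (V? _) (resp eq) (resp (sym eq))) (V⊆ Vx) ∙ ⟦⟧-yes (V? x) Vx)
      ... | no ¬Vx = ≡.sym (∑-zero (suc N) (λ i _ → vanish (elt i)))
        where
        vanish : ∀ y → ⟦ y ≟ x ⟧ ℤ.* ⟦ V? y ⟧ ≡ 0ℤ
        vanish y with y ≟ x
        ... | yes y≈x = ℤₚ.*-identityˡ _ ∙ ⟦⟧-no (V? y) (λ Vy → ¬Vx (resp y≈x Vy))
        ... | no _    = ℤₚ.*-zeroˡ ⟦ V? y ⟧
      one : ∀ y → sum (λ i → ⟦ y ≟ enum i ⟧) ≡ 1ℤ
      one y with enum-sur y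
      ... | j , eq = sum-unique (λ i → ⟦ y ≟ enum i ⟧) j
        (λ i i≢j → ⟦⟧-no (y ≟ enum i) (λ eq′ → i≢j (enum-inj i j (sym eq′ ⨾ sym eq)))) ∙
        ⟦⟧-yes (y ≟ enum j) (sym eq)

-- Traces and semiprimitive periods

module Traces {c ℓ : Level} (K : FiniteField c ℓ) (P₁ : ℕ)
  (frobenius : Subfields.FrobeniusAdditive K (suc P₁)) (ιP≈0 : Subfields.Vanishes K (suc P₁))
  {δ₁ : FF.F K} (base : Subfields.Subfield K P₁ δ₁)
  where

  open Subfields K
  open Enumeration K

  P : ℕ
  P = suc P₁

  module B = Subfield base

  instance
    P₁≢0 : ℕ.NonZero P₁
    P₁≢0 = B.N-nonZero

  -- The sum of the values at z of the nontrivial additive characters of 𝔽_P.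
  θ : Carrier → ℤ
  θ z = + P ℤ.* ⟦ z ≟ 0# ⟧ ℤ.- 1ℤ

  θ-cong : ∀ {x y} → x ≈ y → θ x ≡ θ y
  θ-cong {x} {y} x≈y = cong (λ v → + P ℤ.* v ℤ.- 1ℤ)
    (⟦⟧-cong (x ≟ 0#) (y ≟ 0#) (trans (sym x≈y)) (trans x≈y))

  private
    P*1-1 : + P ℤ.* 1ℤ ℤ.- 1ℤ ≡ + P₁
    P*1-1 = cong (ℤ._- 1ℤ) (ℤₚ.*-identityʳ (+ P) ∙ ℤₚ.pos-+ 1 P₁) ∙ lemma (+ P₁)
      where
      lemma : ∀ x → 1ℤ ℤ.+ x ℤ.- 1ℤ ≡ x
      lemma = solve-∀

  θ-0 : ∀ {z} → z ≈ 0# → θ z ≡ + P₁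
  θ-0 {z} z≈0 = cong (λ v → + P ℤ.* v ℤ.- 1ℤ) (⟦⟧-yes (z ≟ 0#) z≈0) ∙ P*1-1

  θ-≉0 : ∀ {z} → ¬ (z ≈ 0#) → θ z ≡ -1ℤ
  θ-≉0 {z} z≉0 = cong (λ v → + P ℤ.* v ℤ.- 1ℤ) (⟦⟧-no (z ≟ 0#) z≉0) ∙
    cong (ℤ._- 1ℤ) (ℤₚ.*-zeroʳ (+ P))

  θ-⊖ : ∀ z → θ (⊖ z) ≡ θ z
  θ-⊖ z = cong (λ v → + P ℤ.* v ℤ.- 1ℤ) (⟦⟧-cong (⊖ z ≟ 0#) (z ≟ 0#)
    (λ eq → sym (⊖-involutive z) ⨾ -‿cong eq ⨾ ⊖0≈0)
    (λ eq → -‿cong eq ⨾ ⊖0≈0))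

  -- z + β vanishes for one β only, which contributes P against P copies of -1.
  ∑θ-translates : ∀ {z} → B.Mem z → B.∑ꟳ (λ β → θ (z ⊕ β)) ≡ 0ℤ
  ∑θ-translates {z} mz = begin
    B.∑ꟳ (λ β → θ (z ⊕ β))
      ≡⟨ B.∑ꟳ-cong {λ β → θ (z ⊕ β)} {λ β → + P ℤ.* ⟦ β ≟ ⊖ z ⟧ ℤ.+ -1ℤ} (λ β _ → cong (λ v → + P ℤ.* v ℤ.+ -1ℤ) (⟦⟧-cong (z ⊕ β ≟ 0#) (β ≟ ⊖ z)
           (⊖-uniqueʳ z β) (λ eq → +-congˡ eq ⨾ -‿inverseʳ z))) ⟩
    B.∑ꟳ (λ β → + P ℤ.* ⟦ β ≟ ⊖ z ⟧ ℤ.+ -1ℤ)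
      ≡⟨ ∑-distrib-+ P (λ i → + P ℤ.* ⟦ B.elt i ≟ ⊖ z ⟧) (λ _ → -1ℤ) ⟩
    B.∑ꟳ (λ β → + P ℤ.* ⟦ β ≟ ⊖ z ⟧) ℤ.+ B.∑ꟳ (λ _ → -1ℤ)
      ≡⟨ cong₂ ℤ._+_ (≡.sym (*-distribˡ-∑ (+ P) P (λ i → ⟦ B.elt i ≟ ⊖ z ⟧)) ∙
           cong (+ P ℤ.*_) (B.∑ꟳ-delta (B.mem-⊖ mz))) (∑-const P -1ℤ) ⟩
    + P ℤ.* 1ℤ ℤ.+ + P ℤ.* -1ℤ
      ≡⟨ cancel (+ P) ⟩
    0ℤ ∎
    where
    open ≡.≡-Reasoning
    cancel : ∀ x → x ℤ.* 1ℤ ℤ.+ x ℤ.* -1ℤ ≡ 0ℤ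
    cancel = solve-∀

  pow-P-∑ : ∀ i n f → pow (∑ᴷ n f) (P ^ i) ≈ ∑ᴷ n (λ l → pow (f l) (P ^ i))
  pow-P-∑ i zero    f = pow-0# (P ^ i) (ℕₚ.m^n>0 P i)
  pow-P-∑ i (suc n) f = frobenius i _ _ ⨾ +-congʳ (pow-P-∑ i n f)

  -- Trace sums and periods in an extension whose group order is divisible by P² - 1

  module Extension {j N W : ℕ} {δ : Carrier} (0<j : 0 < j) (P^j≡ : P ^ j ≡ suc N) (ext : Subfield N δ)
    (N≡ : N ≡ W * (P₁ * suc P)) where
    open Subfield ext public

    T : Carrier → Carrier
    T x = ∑ᴷ j (λ i → pow x (P ^ i))

    T-cong : ∀ {x y} → x ≈ y → T x ≈ T y
    T-cong x≈y = ∑ᴷ.∑-cong′ j (λ i → pow-cong (P ^ i) x≈y)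

    T-⊕ : ∀ x y → T (x ⊕ y) ≈ T x ⊕ T y
    T-⊕ x y = ∑ᴷ.∑-cong′ j (λ i → frobenius i x y) ⨾ ∑ᴷ.∑-distrib-+ j _ _

    T-⊗ : ∀ {b} x → B.Mem b → T (b ⊗ x) ≈ b ⊗ T x
    T-⊗ {b} x mb = ∑ᴷ.∑-cong′ j (λ i → pow-⊗ b x (P ^ i) ⨾ *-congʳ (pow-fixed P mb i)) ⨾
      sym (∑ᴷ.*-distribˡ-∑ b j _)

    mem-P^j : ∀ {x} → Mem x → pow x (P ^ j) ≈ x
    mem-P^j {x} mx = pow-congʳ x P^j≡ ⨾ mx

    base⊆ : ∀ {x} → B.Mem x → Mem x
    base⊆ {x} mx = pow-congʳ x (≡.sym P^j≡) ⨾ pow-fixed P mx j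

    T-frobenius : ∀ {x} → Mem x → ∑ᴷ j (λ i → pow x (P ^ suc i)) ≈ T x
    T-frobenius mx = ∑ᴷ.∑-shift (frobenius-periodic P j (mem-P^j mx)) 1

    T-pow : ∀ {x} → Mem x → T (pow x P) ≈ T x
    T-pow {x} mx = ∑ᴷ.∑-cong′ j (λ i → sym (pow-* x P (P ^ i))) ⨾ T-frobenius mx

    T-mem : ∀ {x} → Mem x → B.Mem (T x)
    T-mem {x} mx = pow-congʳ (T x) (≡.sym (ℕₚ.*-identityʳ P)) ⨾ pow-P-∑ 1 j _ ⨾
      ∑ᴷ.∑-cong′ j (λ i → sym (pow-* x (P ^ i) (P * 1)) ⨾
        pow-congʳ x (cong (P ^ i *_) (ℕₚ.*-identityʳ P) ∙ ℕₚ.*-comm (P ^ i) P)) ⨾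
      T-frobenius mx

    T-0 : T 0# ≈ 0#
    T-0 = ∑ᴷ.∑-zero j (λ i _ → pow-0# (P ^ i) (ℕₚ.m^n>0 P i))

    T-⊖ : ∀ x → T (⊖ x) ≈ ⊖ T x
    T-⊖ x = ⊖-uniqueʳ _ _ (sym (T-⊕ x (⊖ x)) ⨾ T-cong (-‿inverseʳ x) ⨾ T-0)

    ιQ≈0 : ι (suc N) ≈ 0#
    ιQ≈0 = reflexive (cong ι (≡.sym P^j≡)) ⨾ ι-^ P j ⨾
      pow-cong j ιP≈0 ⨾ pow-0# j 0<j

    ιN≉0 : ¬ (ι N ≈ 0#)
    ιN≉0 ιN≈0 = 0≉1 (sym ιQ≈0 ⨾ +-congˡ ιN≈0 ⨾ +-identityʳ 1#)

    geometric-1 : ∀ {r} → r ≈ 1# → ∑ᴷ N (pow r) ≈ ι N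
    geometric-1 r≈1 = ∑ᴷ.∑-cong′ N (λ i → pow-cong i r≈1 ⨾ pow-1# i) ⨾
      ∑ᴷ-const N 1# ⨾ *-identityʳ (ι N)

    geometric-0 : ∀ {r} → pow r N ≈ 1# → ¬ (r ≈ 1#) → ∑ᴷ N (pow r) ≈ 0#
    geometric-0 {r} r^N≈1 r≉1 with ∑ᴷ N (pow r) ≟ 0#
    ... | yes ≈0 = ≈0
    ... | no  ≉0 = ⊥-elim (r≉1 (⊗-cancelˡ _ ≉0 (begin
      ∑ᴷ N (pow r) ⊗ r ≈⟨ *-comm _ r ⟩
      r ⊗ ∑ᴷ N (pow r) ≈⟨ ∑ᴷ.*-distribˡ-∑ r N (pow r) ⟩
      ∑ᴷ N (λ i → pow r (suc i)) ≈⟨ ∑ᴷ.∑-shift per 1 ⟩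
      ∑ᴷ N (pow r) ≈⟨ *-identityʳ _ ⟨
      ∑ᴷ N (pow r) ⊗ 1# ∎)))
      where
      open ≈-Reasoning
      per : ∀ i → pow r (i + N) ≈ pow r i
      per i = pow-+ r i N ⨾ *-congˡ r^N≈1 ⨾ *-identityʳ _

    -- Orthogonality of the monomials x ↦ x^(N-1) and x ↦ x^(P^i) for 0 < i < j:
    -- only i = 0 contributes to Σ x^(N-1) T(x) over x ≉ 0.
    T-≉0 : ¬ (∀ i → i < N → T (pow δ i) ≈ 0#)
    T-≉0 T≈0 = ιN≉0 (begin
      ι N
        ≈⟨ geometric-1 r₀≈1 ⟨
      ∑ᴷ N (pow (r 0))
        ≈⟨ ∑ᴷ.∑-unique j (λ l → ∑ᴷ N (pow (r l))) 0<j
             (λ l l<j l≢0 → geometric-0 (pow-comm δ (N ∸ 1 + P ^ l) N ⨾ pow-cong (N ∸ 1 + P ^ l) pow-N ⨾ pow-1# (N ∸ 1 + P ^ l))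
               (r≉1 l l<j l≢0)) ⟨
      ∑ᴷ j (λ l → ∑ᴷ N (pow (r l)))
        ≈⟨ ∑ᴷ.∑-swap j N (λ l → pow (r l)) ⟩
      ∑ᴷ N (λ i → ∑ᴷ j (λ l → pow (r l) i))
        ≈⟨ ∑ᴷ.∑-cong′ N (λ i → ∑ᴷ.∑-cong′ j (λ l → split l i) ⨾ sym (∑ᴷ.*-distribˡ-∑ (pow (pow δ (N ∸ 1)) i) j (λ l → pow (pow δ i) (P ^ l)))) ⟩
      ∑ᴷ N (λ i → pow (pow δ (N ∸ 1)) i ⊗ T (pow δ i))
        ≈⟨ ∑ᴷ.∑-zero N (λ i i<N → *-congˡ (T≈0 i i<N) ⨾ zeroʳ _) ⟩
      0# ∎)
      where
      open ≈-Reasoning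
      r : ℕ → Carrier
      r l = pow δ (N ∸ 1 + P ^ l)
      split : ∀ l i → pow (r l) i ≈ pow (pow δ (N ∸ 1)) i ⊗ pow (pow δ i) (P ^ l)
      split l i = pow-cong i (pow-+ δ (N ∸ 1) (P ^ l)) ⨾
        pow-⊗ _ _ i ⨾ *-congˡ (pow-comm δ (P ^ l) i)
      N-1+ : ∀ {a} → 0 < a → N ∸ 1 + a ≡ N + (a ∸ 1)
      N-1+ {suc a} _ = ℕₚ.+-suc (N ∸ 1) a ∙ cong (_+ a) (ℕₚ.m+[n∸m]≡n 0<N)
      r₀≈1 : r 0 ≈ 1#
      r₀≈1 = pow-congʳ δ (N-1+ {1} (s≤s z≤n) ∙ ℕₚ.+-identityʳ N) ⨾ pow-N
      r≉1 : ∀ l → l < j → ¬ l ≡ 0 → ¬ (r l ≈ 1#)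
      r≉1 l l<j l≢0 r≈1 = ℕₚ.<⇒≱ small (∣⇒≤ {{ℕ.>-nonZero 0<P^l-1}}
        (∣m+n∣m⇒∣n (subst (N ∣_) (N-1+ (ℕₚ.<-trans (s≤s z≤n) 1<P^l)) (order _ r≈1)) ∣-refl))
        where
        1<P : 1 < P
        1<P = s≤s B.0<N
        1<P^l : 1 < P ^ l
        1<P^l = ℕₚ.^-monoʳ-< P 1<P {0} (ℕₚ.n≢0⇒n>0 l≢0)
        0<P^l-1 : 0 < P ^ l ∸ 1
        0<P^l-1 = ℕₚ.m<n⇒0<n∸m 1<P^l
        small : P ^ l ∸ 1 < N
        small = ℕₚ.+-cancelˡ-< 1 _ _ (subst₂ _<_ (≡.sym (ℕₚ.m+[n∸m]≡n (ℕₚ.<⇒≤ 1<P^l))) P^j≡ (ℕₚ.^-monoʳ-< P 1<P l<j))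

    -- T is 𝔽_P-linear, so one element of nonzero trace suffices; its multiples by 𝔽_P reach every
    -- value.
    T-surjective : ∀ {b} → B.Mem b → ∃ λ z → Mem z × T z ≈ b
    T-surjective {b} mb = solve (search N)
      where
      search : ∀ n → (∃ λ i → ¬ (T (pow δ i) ≈ 0#)) ⊎ (∀ i → i < n → T (pow δ i) ≈ 0#)
      search zero = inj₂ (λ i ())
      search (suc n) with T (pow δ n) ≟ 0# | search n
      ... | _      | inj₁ found = inj₁ found
      ... | no ≉0  | inj₂ _     = inj₁ (n , ≉0)
      ... | yes ≈0 | inj₂ all   = inj₂ (λ i i<1+n → [ all i , (λ { ≡.refl → ≈0 }) ]′ (ℕₚ.m<1+n⇒m<n∨m≡n i<1+n))
      solve : (∃ λ i → ¬ (T (pow δ i) ≈ 0#)) ⊎ (∀ i → i < N → T (pow δ i) ≈ 0#) → ∃ λ z → Mem z × T z ≈ b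
      solve (inj₂ all) = ⊥-elim (T-≉0 all)
      solve (inj₁ (i , ≉0)) with inverse _ ≉0
      ... | t⁻¹ , tt⁻¹≈1 = (b ⊗ t⁻¹) ⊗ pow δ i , mem-⊗ (base⊆ mbt) (mem-gen i) ,
          T-⊗ (pow δ i) mbt ⨾ *-assoc _ _ _ ⨾
            *-congˡ (*-comm _ _ ⨾ tt⁻¹≈1) ⨾ *-identityʳ b
        where
        mbt : B.Mem (b ⊗ t⁻¹)
        mbt = B.mem-⊗ mb (B.mem-inv tt⁻¹≈1 (T-mem (mem-gen i)))

    -- Translation by an element of trace b replaces T z by T z + b without changing the sum.
    -- Averaging over all b ∈ 𝔽_P makes the contribution of each single z vanish.
    ∑θT≡0 : ∑ꟳ (λ z → θ (T z)) ≡ 0ℤ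
    ∑θT≡0 = ℤₚ.*-cancelˡ-≡ (+ P) _ _ (begin
      + P ℤ.* ∑ꟳ (λ z → θ (T z))
        ≡⟨ ∑-const P (∑ꟳ (λ z → θ (T z))) ⟨
      B.∑ꟳ (λ _ → ∑ꟳ (λ z → θ (T z)))
        ≡⟨ B.∑ꟳ-cong (λ b mb → ≡.sym (shift mb)) ⟩
      B.∑ꟳ (λ b → ∑ꟳ (λ z → θ (T z ⊕ b)))
        ≡⟨ ∑-swap P (suc N) (λ i l → θ (T (elt l) ⊕ B.elt i)) ⟩
      ∑ꟳ (λ z → B.∑ꟳ (λ b → θ (T z ⊕ b)))
        ≡⟨ ∑-zero (suc N) (λ i _ → ∑θ-translates (T-mem (mem-elt i))) ⟩
      0ℤ
        ≡⟨ ℤₚ.*-zeroʳ (+ P) ⟨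
      + P ℤ.* 0ℤ ∎)
      where
      open ≡.≡-Reasoning
      shift : ∀ {b} → B.Mem b → ∑ꟳ (λ z → θ (T z ⊕ b)) ≡ ∑ꟳ (λ z → θ (T z))
      shift {b} mb with T-surjective mb
      ... | z₀ , mz₀ , Tz₀≈b = ∑ꟳ-cong (λ z _ → θ-cong (sym (T-⊕ z z₀ ⨾ +-congˡ Tz₀≈b))) ∙
        ∑ꟳ-translate {λ z → θ (T z)} (λ eq → θ-cong (T-cong eq)) mz₀

    ∑θ-affine≡0 : ∀ {D b} → Mem D → ¬ (D ≈ 0#) → B.Mem b → ∑ꟳ (λ z → θ (T (z ⊗ D) ⊕ b)) ≡ 0ℤ
    ∑θ-affine≡0 {D} {b} mD D≉0 mb with T-surjective mb
    ... | z₀ , mz₀ , Tz₀≈b = begin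
      ∑ꟳ (λ z → θ (T (z ⊗ D) ⊕ b)) ≡⟨ ∑ꟳ-scale {λ z → θ (T z ⊕ b)} (λ eq → θ-cong (+-congʳ (T-cong eq))) mD D≉0 ⟩
      ∑ꟳ (λ z → θ (T z ⊕ b)) ≡⟨ ∑ꟳ-cong (λ z _ → θ-cong (sym (T-⊕ z z₀ ⨾ +-congˡ Tz₀≈b))) ⟩
      ∑ꟳ (λ z → θ (T (z ⊕ z₀))) ≡⟨ ∑ꟳ-translate {λ z → θ (T z)} (λ eq → θ-cong (T-cong eq)) mz₀ ⟩
      ∑ꟳ (λ z → θ (T z)) ≡⟨ ∑θT≡0 ⟩
      0ℤ ∎
      where open ≡.≡-Reasoning

    M : ℕ
    M = suc P

    f : ℕ → ℤ
    f i = θ (T (pow δ i))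

    -- The sum of θ(T(δ^a y^S)) over all y ≠ 0. Since i runs over all N exponents, for S ∣ N each
    -- element of the coset of S-th powers is counted S times.
    period : ℕ → ℕ → ℤ
    period S a = ∑ N (λ i → f (a + S * i))

    pow-shift : ∀ i k → pow δ (i + k * N) ≈ pow δ i
    pow-shift i k = pow-+ δ i (k * N) ⨾ *-congˡ (pow-congʳ δ (ℕₚ.*-comm k N) ⨾ pow-N* k) ⨾ *-identityʳ _

    f-periodic : Periodic N f
    f-periodic i = θ-cong (T-cong (pow-congʳ δ (cong (i ℕ.+_) (≡.sym (ℕₚ.*-identityˡ N))) ⨾ pow-shift i 1))

    private
      tail≡ : ∀ {x y} → x ℤ.+ y ≡ 0ℤ → y ≡ ℤ.- x
      tail≡ {x} {y} eq = lemma x y ∙ cong (ℤ._- x) eq ∙ ℤₚ.+-identityˡ (ℤ.- x)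
        where
        lemma : ∀ x y → y ≡ (x ℤ.+ y) ℤ.- x
        lemma = solve-∀

    ∑f : ∑ N f ≡ ℤ.- + P₁
    ∑f = tail≡ (≡.sym (∑ꟳ-head (λ z → θ (T z))) ∙ ∑θT≡0) ∙ cong ℤ.-_ (θ-0 T-0)

    ∑f-shift : ∀ a → ∑ N (λ i → f (a + i)) ≡ ℤ.- + P₁
    ∑f-shift a = ∑-shift f-periodic a ∙ ∑f

    private
      λ₀ : Carrier
      λ₀ = pow δ (M * W)

      λ₀-mem : B.Mem λ₀
      λ₀-mem = *-congˡ (sym (pow-* δ (M * W) P₁) ⨾
        pow-congʳ δ (eq M W P₁ ∙ ≡.sym N≡) ⨾ pow-N) ⨾ *-identityʳ λ₀
        where
        eq : ∀ M W P₁ → M * W * P₁ ≡ W * (P₁ * M)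
        eq = ℕS.solve-∀

    -- M W = N / (P - 1), so δ^(MW) lies in 𝔽_P*. Such a factor comes out of T, and θ only tests for
    -- zero.
    f-base-periodic : Periodic (M * W) f
    f-base-periodic i = θ-cong (T-cong (pow-+ δ i (M * W) ⨾ *-comm _ _) ⨾ T-⊗ _ λ₀-mem) ∙
      ⟦⟧-cong-θ
      where
      ⟦⟧-cong-θ : θ (λ₀ ⊗ T (pow δ i)) ≡ f i
      ⟦⟧-cong-θ = cong (λ v → + P ℤ.* v ℤ.- 1ℤ) (⟦⟧-cong (λ₀ ⊗ T (pow δ i) ≟ 0#) (T (pow δ i) ≟ 0#)
        (λ eq → integral λ₀ eq (pow-≉0 (M * W) δ≉0)) (λ eq → *-congˡ eq ⨾ zeroʳ λ₀))

    -- For z = 0 all P - 1 terms are -1. For z ≠ 0 the arguments run through 𝔽_P except b; the full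
    -- sum is 0 and the missing term θ(b) is -1, so 1 = -θ(z) remains.
    ∑θ-line : ∀ {z b} → B.Mem z → B.Mem b → ¬ (b ≈ 0#) → ∑ P₁ (λ e → θ (pow δ₁ e ⊗ z ⊕ b)) ≡ ℤ.- θ z
    ∑θ-line {z} {b} mz mb b≉0 = go (z ≟ 0#)
      where
      go : Dec (z ≈ 0#) → ∑ P₁ (λ e → θ (pow δ₁ e ⊗ z ⊕ b)) ≡ ℤ.- θ z
      go (yes z≈0) = begin
        ∑ P₁ (λ e → θ (pow δ₁ e ⊗ z ⊕ b)) ≡⟨ ∑-cong′ P₁ (λ e → θ-cong (+-congʳ (*-congˡ z≈0 ⨾ zeroʳ _) ⨾ +-identityˡ b) ∙ θ-≉0 b≉0) ⟩
        ∑ P₁ (λ _ → -1ℤ) ≡⟨ ∑-const P₁ -1ℤ ⟩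
        + P₁ ℤ.* -1ℤ ≡⟨ neg (+ P₁) ⟩
        ℤ.- + P₁ ≡⟨ cong ℤ.-_ (θ-0 z≈0) ⟨
        ℤ.- θ z ∎
        where
        open ≡.≡-Reasoning
        neg : ∀ x → x ℤ.* -1ℤ ≡ ℤ.- x
        neg = solve-∀
      go (no z≉0) = begin
        ∑ P₁ (λ e → θ (pow δ₁ e ⊗ z ⊕ b)) ≡⟨ tail≡ (≡.sym (B.∑ꟳ-head (λ x → θ (x ⊗ z ⊕ b))) ∙ scaled) ⟩
        ℤ.- θ (0# ⊗ z ⊕ b) ≡⟨ cong ℤ.-_ (θ-cong (+-congʳ (zeroˡ z) ⨾ +-identityˡ b) ∙ θ-≉0 b≉0 ∙ ≡.sym (θ-≉0 z≉0)) ⟩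
        ℤ.- θ z ∎
        where
        open ≡.≡-Reasoning
        scaled : B.∑ꟳ (λ x → θ (x ⊗ z ⊕ b)) ≡ 0ℤ
        scaled = B.∑ꟳ-scale {λ x → θ (x ⊕ b)} (λ eq → θ-cong (+-congʳ eq)) mz z≉0 ∙
          B.∑ꟳ-cong (λ x _ → θ-cong (+-comm x b)) ∙ ∑θ-translates mb

    private
      -- The generator of 𝔽_P* is an M-th power: if it is δ^i, then N = W M P₁ divides i P₁, hence W
      -- M divides i.
      base-log : ∃ λ v → pow δ (M * v) ≈ δ₁
      base-log with log δ₁ (base⊆ (mem-≈₁ (B.mem-gen 1))) B.δ≉0
        where
        mem-≈₁ : B.Mem (pow δ₁ 1) → B.Mem δ₁
        mem-≈₁ = B.mem-≈ (*-identityʳ δ₁)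
      ... | i , δ^i≈δ₁ with *-cancelʳ-∣ {W * M} {i} P₁ (subst (_∣ i * P₁) (N≡ ∙ eq W P₁ M) (order (i * P₁)
            (pow-* δ i P₁ ⨾ pow-cong P₁ δ^i≈δ₁ ⨾ B.pow-N)))
        where
        eq : ∀ W P₁ M → W * (P₁ * M) ≡ W * M * P₁
        eq = ℕS.solve-∀
      ...   | divides k ≡.refl = k * W , pow-congʳ δ (eq M k W) ⨾ δ^i≈δ₁
        where
        eq : ∀ M k W → M * (k * W) ≡ k * (W * M)
        eq = ℕS.solve-∀

    -- Scaling by 𝔽_P* shows that T takes each nonzero value b ∈ 𝔽_P equally often on a coset of the S-th powers.
    separation : ∀ {S R} → S * R ≡ M → ∀ a {b} → B.Mem b →
      + P₁ ℤ.* ∑ N (λ i → θ (T (pow δ (a + S * i)) ⊕ b)) ≡ period S a ℤ.* θ b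
    separation {S} {R} SR≡M a {b} mb = go (b ≟ 0#)
      where
      open ≡.≡-Reasoning
      neg : ∀ x → ℤ.- x ≡ x ℤ.* -1ℤ
      neg = solve-∀
      v = proj₁ base-log
      h : ℕ → ℤ
      h i = θ (T (pow δ (a + S * i)) ⊕ b)
      h-periodic : Periodic N h
      h-periodic i = θ-cong (+-congʳ (T-cong (pow-congʳ δ (eq a S i N) ⨾ pow-shift (a + S * i) S)))
        where
        eq : ∀ a S i N → a + S * (i + N) ≡ a + S * i + S * N
        eq = ℕS.solve-∀
      scaled : ∀ e i → T (pow δ (a + S * (R * v * e + i))) ≈ pow δ₁ e ⊗ T (pow δ (a + S * i))
      scaled e i = T-cong (pow-congʳ δ (eq a S R v e i ∙ cong (λ m → m * v * e + (a + S * i)) SR≡M) ⨾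
        pow-+ δ (M * v * e) (a + S * i) ⨾ *-congʳ (pow-* δ (M * v) e ⨾ pow-cong e (proj₂ base-log))) ⨾
        T-⊗ _ (B.mem-gen e)
        where
        eq : ∀ a S R v e i → a + S * (R * v * e + i) ≡ S * R * v * e + (a + S * i)
        eq = ℕS.solve-∀
      go : Dec (b ≈ 0#) → + P₁ ℤ.* ∑ N h ≡ period S a ℤ.* θ b
      go (yes b≈0) = begin
        + P₁ ℤ.* ∑ N h ≡⟨ cong₂ ℤ._*_ (≡.sym (θ-0 b≈0)) (∑-cong′ N (λ i → θ-cong (+-congˡ b≈0 ⨾ +-identityʳ _))) ⟩
        θ b ℤ.* period S a ≡⟨ ℤₚ.*-comm (θ b) (period S a) ⟩
        period S a ℤ.* θ b ∎
      go (no b≉0) = begin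
        + P₁ ℤ.* ∑ N h
          ≡⟨ ∑-const P₁ _ ⟨
        ∑ P₁ (λ _ → ∑ N h)
          ≡⟨ ∑-cong′ P₁ (λ e → ≡.sym (∑-shift {N} {h} h-periodic (R * v * e))) ⟩
        ∑ P₁ (λ e → ∑ N (λ i → h (R * v * e + i)))
          ≡⟨ ∑-cong′ P₁ (λ e → ∑-cong′ N (λ i → θ-cong (+-congʳ (scaled e i)))) ⟩
        ∑ P₁ (λ e → ∑ N (λ i → θ (pow δ₁ e ⊗ T (pow δ (a + S * i)) ⊕ b)))
          ≡⟨ ∑-swap P₁ N (λ e i → θ (pow δ₁ e ⊗ T (pow δ (a + S * i)) ⊕ b)) ⟩
        ∑ N (λ i → ∑ P₁ (λ e → θ (pow δ₁ e ⊗ T (pow δ (a + S * i)) ⊕ b)))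
          ≡⟨ ∑-cong′ N (λ i → ∑θ-line (T-mem (mem-gen (a + S * i))) mb b≉0 ∙ neg (f (a + S * i))) ⟩
        ∑ N (λ i → f (a + S * i) ℤ.* -1ℤ)
          ≡⟨ *-distribʳ-∑ -1ℤ N (λ i → f (a + S * i)) ⟨
        period S a ℤ.* -1ℤ
          ≡⟨ cong (period S a ℤ.*_) (θ-≉0 b≉0) ⟨
        period S a ℤ.* θ b ∎

    -- As M = S R, the exponent a + S r + M i is a + S (i R + r). The index i R + r takes N R
    -- values, which is R full rounds of the coarser period.
    period-blocks : ∀ {S R} → S * R ≡ M → ∀ a → ∑ R (λ r → period M (a + S * r)) ≡ + R ℤ.* period S a
    period-blocks {S} {R} SR≡M a = begin
      ∑ R (λ r → ∑ N (λ i → f (a + S * r + M * i)))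
        ≡⟨ ∑-swap R N (λ r i → f (a + S * r + M * i)) ⟩
      ∑ N (λ i → ∑ R (λ r → f (a + S * r + M * i)))
        ≡⟨ ∑-cong′ N (λ i → ∑-cong′ R (λ r → cong f (cong (λ m → a + S * r + m * i) (≡.sym SR≡M) ∙ eq a S r R i))) ⟩
      ∑ N (λ i → ∑ R (λ r → h (i * R + r)))
        ≡⟨ ∑-blocks N R h ⟨
      ∑ (N * R) h
        ≡⟨ cong (λ k → ∑ k h) (ℕₚ.*-comm N R) ⟩
      ∑ (R * N) h
        ≡⟨ ∑-periodic h-periodic R ⟩
      ∑ R (λ _ → ∑ N h)
        ≡⟨ ∑-const R _ ⟩
      + R ℤ.* period S a ∎
      where
      open ≡.≡-Reasoning
      h : ℕ → ℤ
      h i = f (a + S * i)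
      eq : ∀ a S r R i → a + S * r + S * R * i ≡ a + S * (i * R + r)
      eq = ℕS.solve-∀
      h-periodic : Periodic N h
      h-periodic i = cong f (eq′ a S i N) ∙ periodic-* {N} {f} f-periodic S (a + S * i)
        where
        eq′ : ∀ a S i N → a + S * (i + N) ≡ a + S * i + S * N
        eq′ = ℕS.solve-∀

    -- Evaluation of the periods by a second moment

    module Semiprimitive {κ ν : ℕ} (δ^ν≈-1 : pow δ ν ≈ ⊖ 1#) (ν≡κ : + (P₁ * M) S.∣ (+ ν ℤ.- + (P₁ * κ)))
      {s : ℤ} (s²≡Q : s ℤ.* s ≡ + suc N) (s≡1 : + M S.∣ (s ℤ.- 1ℤ)) where

      module Moment (a : ℕ) (a≢κ : ¬ (+ M S.∣ (+ a ℤ.- + κ))) where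
        c₀ : Carrier
        c₀ = pow δ a

        -- `D y` represents the polar form of `H`: H(y + z) - H(y) - H(z) = T(z D(y)). Its second
        -- summand is the P-th root of c₀ y, written as the power P^(j-1).
        H D : Carrier → Carrier
        H y = T (c₀ ⊗ pow y M)
        D y = c₀ ⊗ pow y P ⊕ pow (c₀ ⊗ y) (P ^ (j ∸ 1))

        H-mem : ∀ {y} → Mem y → B.Mem (H y)
        H-mem my = T-mem (mem-⊗ (mem-gen a) (mem-pow M my))

        D-mem : ∀ {y} → Mem y → Mem (D y)
        D-mem my = mem-⊕ (mem-⊗ (mem-gen a) (mem-pow P my)) (mem-pow (P ^ (j ∸ 1)) (mem-⊗ (mem-gen a) my))

        H-cong : ∀ {x y} → x ≈ y → H x ≈ H y
        H-cong eq = T-cong (*-congˡ (pow-cong M eq))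

        pow-P-⊕ : ∀ x y → pow (x ⊕ y) P ≈ pow x P ⊕ pow y P
        pow-P-⊕ x y = pow-congʳ _ (≡.sym (ℕₚ.*-identityʳ P)) ⨾
          frobenius 1 x y ⨾ +-cong (pow-congʳ x (ℕₚ.*-identityʳ P)) (pow-congʳ y (ℕₚ.*-identityʳ P))

        root-P : ∀ {x} → Mem x → pow (pow x (P ^ (j ∸ 1))) P ≈ x
        root-P {x} mx = sym (pow-* x (P ^ (j ∸ 1)) P) ⨾ pow-congʳ x
          (ℕₚ.*-comm (P ^ (j ∸ 1)) P ∙ cong (P ^_) (ℕₚ.m+[n∸m]≡n 0<j)) ⨾ mem-P^j mx

        H-⊕ : ∀ {y z} → Mem y → Mem z → H (y ⊕ z) ≈ (H z ⊕ T (z ⊗ D y)) ⊕ H y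
        H-⊕ {y} {z} my mz = begin
          T (c₀ ⊗ ((y ⊕ z) ⊗ pow (y ⊕ z) P))
            ≈⟨ T-cong (*-congˡ (*-congˡ (pow-P-⊕ y z))) ⟩
          T (c₀ ⊗ ((y ⊕ z) ⊗ (pow y P ⊕ pow z P)))
            ≈⟨ T-cong (expand c₀ y z (pow y P) (pow z P)) ⟩
          T ((c₀ ⊗ pow z M ⊕ (z ⊗ (c₀ ⊗ pow y P) ⊕ (c₀ ⊗ y) ⊗ pow z P)) ⊕ c₀ ⊗ pow y M)
            ≈⟨ T-⊕ _ _ ⨾ +-congʳ (T-⊕ _ _ ⨾ +-congˡ (T-⊕ _ _)) ⟩
          (H z ⊕ (T (z ⊗ (c₀ ⊗ pow y P)) ⊕ T ((c₀ ⊗ y) ⊗ pow z P))) ⊕ H y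
            ≈⟨ +-congʳ (+-congˡ (+-congˡ adjoint ⨾ sym (T-cong (distribˡ z _ _) ⨾ T-⊕ _ _))) ⟩
          (H z ⊕ T (z ⊗ D y)) ⊕ H y ∎
          where
          open ≈-Reasoning
          expand : ∀ c y z yP zP → c ⊗ ((y ⊕ z) ⊗ (yP ⊕ zP)) ≈
            (c ⊗ (z ⊗ zP) ⊕ (z ⊗ (c ⊗ yP) ⊕ (c ⊗ y) ⊗ zP)) ⊕ c ⊗ (y ⊗ yP)
          expand = solve 5 (λ c y z yP zP → c :* ((y :+ z) :* (yP :+ zP)) :=
            (c :* (z :* zP) :+ (z :* (c :* yP) :+ (c :* y) :* zP)) :+ c :* (y :* yP)) refl
            where open import Algebra.Solver.Ring.NaturalCoefficients.Default commutativeSemiring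
          mcy : Mem (c₀ ⊗ y)
          mcy = mem-⊗ (mem-gen a) my
          -- T does not change under x ↦ x^P, so the Frobenius on z can be traded for a P-th root on
          -- the other factor.
          adjoint : T ((c₀ ⊗ y) ⊗ pow z P) ≈ T (z ⊗ pow (c₀ ⊗ y) (P ^ (j ∸ 1)))
          adjoint = sym (sym (T-pow (mem-⊗ mz (mem-pow (P ^ (j ∸ 1)) mcy))) ⨾
            T-cong (pow-⊗ _ _ P ⨾ *-comm _ _ ⨾ *-congʳ (root-P mcy)))

        -- The P-th power of D(δ^i) = 0 reads δ^(aP + iP²) = -δ^(a + i), that is, a P₁ + i P₁ M ≡ ν
        -- modulo N. Modulo P₁ M the unknown i disappears, and ν ≡ P₁ κ leaves a ≡ κ modulo M.
        D-≉0 : ∀ i → ¬ (D (pow δ i) ≈ 0#)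
        D-≉0 i D≈0 = a≢κ (S.*-cancelˡ-∣ (+ P₁) (subst₂ S._∣_ (ℤₚ.pos-* P₁ M) final
          (S.∣m∣n⇒∣m+n (S.∣m∣n⇒∣m-n (S.∣-trans N∣ (≈⇒∣ (a * P + i * P * P) (ν + (a + i)) exps)) M∣) ν≡κ)))
          where
          open ≈-Reasoning
          y : Carrier
          y = pow δ i
          N∣ : + (P₁ * M) S.∣ + N
          N∣ = S.∣ᵤ⇒∣ (divides W N≡)
          M∣ : + (P₁ * M) S.∣ + (P₁ * M * i)
          M∣ = S.∣ᵤ⇒∣ (m∣m*n i)
          frob-D : pow c₀ P ⊗ pow (pow y P) P ⊕ c₀ ⊗ y ≈ 0#
          frob-D = begin
            pow c₀ P ⊗ pow (pow y P) P ⊕ c₀ ⊗ y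
              ≈⟨ +-cong (pow-⊗ c₀ (pow y P) P) (root-P (mem-⊗ (mem-gen a) (mem-gen i))) ⟨
            pow (c₀ ⊗ pow y P) P ⊕ pow (pow (c₀ ⊗ y) (P ^ (j ∸ 1))) P
              ≈⟨ pow-P-⊕ _ _ ⟨
            pow (D y) P
              ≈⟨ pow-cong P D≈0 ⨾ pow-0# P (s≤s z≤n) ⟩
            0# ∎
          exps : pow δ (a * P + i * P * P) ≈ pow δ (ν + (a + i))
          exps = begin
            pow δ (a * P + i * P * P)
              ≈⟨ pow-+ δ (a * P) _ ⟩
            pow δ (a * P) ⊗ pow δ (i * P * P)
              ≈⟨ *-cong (pow-* δ a P) (pow-* δ (i * P) P ⨾ pow-cong P (pow-* δ i P)) ⟩
            pow c₀ P ⊗ pow (pow y P) P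
              ≈⟨ ⊖-uniqueˡ _ _ frob-D ⟩
            ⊖ (c₀ ⊗ y)
              ≈⟨ -1*x≈-x _ ⟨
            ⊖ 1# ⊗ (c₀ ⊗ y)
              ≈⟨ *-cong (sym δ^ν≈-1) (sym (pow-+ δ a i)) ⟩
            pow δ ν ⊗ pow δ (a + i)
              ≈⟨ pow-+ δ ν (a + i) ⟨
            pow δ (ν + (a + i)) ∎
          final : + (a * P + i * P * P) ℤ.- + (ν + (a + i)) ℤ.- + (P₁ * M * i) ℤ.+ (+ ν ℤ.- + (P₁ * κ))
                ≡ + P₁ ℤ.* (+ a ℤ.- + κ)
          final = cong₂ ℤ._+_ (cong₂ ℤ._-_ (cong₂ ℤ._-_
              (ℤₚ.pos-+ (a * P) (i * P * P) ∙ cong₂ ℤ._+_ (pos-*P a) (pos-*P (i * P) ∙ cong (ℤ._* (1ℤ ℤ.+ + P₁)) (pos-*P i)))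
              (ℤₚ.pos-+ ν (a + i) ∙ cong (λ v → + ν ℤ.+ v) (ℤₚ.pos-+ a i)))
              (ℤₚ.pos-* (P₁ * M) i ∙ cong (ℤ._* + i) (ℤₚ.pos-* P₁ M)))
              (cong (λ v → + ν ℤ.- v) (ℤₚ.pos-* P₁ κ)) ∙
            lemma (+ a) (+ i) (+ P₁) (+ ν) (+ κ)
            where
            pos-*P : ∀ x → + (x * P) ≡ + x ℤ.* (1ℤ ℤ.+ + P₁)
            pos-*P x = ℤₚ.pos-* x P
            lemma : ∀ a i p ν κ → (a ℤ.* (1ℤ ℤ.+ p) ℤ.+ i ℤ.* (1ℤ ℤ.+ p) ℤ.* (1ℤ ℤ.+ p)) ℤ.- (ν ℤ.+ (a ℤ.+ i))
              ℤ.- p ℤ.* (1ℤ ℤ.+ (1ℤ ℤ.+ p)) ℤ.* i ℤ.+ (ν ℤ.- p ℤ.* κ) ≡ p ℤ.* (a ℤ.- κ)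
            lemma = solve-∀

        G : ℤ
        G = ∑ꟳ (λ y → θ (H y))

        H-0 : H 0# ≈ 0#
        H-0 = T-cong (*-congˡ (zeroˡ _) ⨾ zeroʳ _) ⨾ T-0

        H-gen : ∀ i → H (pow δ i) ≈ T (pow δ (a + M * i))
        H-gen i = T-cong (*-congˡ (sym (pow-* δ i M) ⨾ pow-congʳ δ (ℕₚ.*-comm i M)) ⨾ sym (pow-+ δ a (M * i)))

        G≡ : G ≡ + P₁ ℤ.+ period M a
        G≡ = ∑ꟳ-head (λ y → θ (H y)) ∙ cong₂ ℤ._+_ (θ-0 H-0) (∑-cong′ N (λ i → θ-cong (H-gen i)))

        G-separation : ∀ {b} → B.Mem b → + P₁ ℤ.* ∑ꟳ (λ y → θ (H y ⊕ b)) ≡ G ℤ.* θ b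
        G-separation {b} mb = begin
          + P₁ ℤ.* ∑ꟳ (λ y → θ (H y ⊕ b))
            ≡⟨ cong (+ P₁ ℤ.*_) (∑ꟳ-head (λ y → θ (H y ⊕ b))) ⟩
          + P₁ ℤ.* (θ (H 0# ⊕ b) ℤ.+ ∑ N (λ i → θ (H (pow δ i) ⊕ b)))
            ≡⟨ cong (+ P₁ ℤ.*_) (cong₂ ℤ._+_ (θ-cong (+-congʳ H-0 ⨾ +-identityˡ b))
                 (∑-cong′ N (λ i → θ-cong (+-congʳ (H-gen i))))) ⟩
          + P₁ ℤ.* (θ b ℤ.+ ∑ N (λ i → θ (T (pow δ (a + M * i)) ⊕ b)))
            ≡⟨ ℤₚ.*-distribˡ-+ (+ P₁) (θ b) _ ⟩
          + P₁ ℤ.* θ b ℤ.+ + P₁ ℤ.* ∑ N (λ i → θ (T (pow δ (a + M * i)) ⊕ b))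
            ≡⟨ cong (λ v → + P₁ ℤ.* θ b ℤ.+ v) (separation {M} {1} (ℕₚ.*-identityʳ M) a mb) ⟩
          + P₁ ℤ.* θ b ℤ.+ period M a ℤ.* θ b
            ≡⟨ ℤₚ.*-distribʳ-+ (θ b) (+ P₁) (period M a) ⟨
          (+ P₁ ℤ.+ period M a) ℤ.* θ b
            ≡⟨ cong (ℤ._* θ b) G≡ ⟨
          G ℤ.* θ b ∎
          where open ≡.≡-Reasoning

        -- The second moment of `H`. With z as inner variable the summand is affine in z with slope
        -- `D y`, so only y = 0 survives. With y as inner variable, translation by z removes z from
        -- H(y + z), and `G-separation` with b = -H(z) produces `G` twice.
        E : ℤ
        E = ∑ꟳ (λ y → ∑ꟳ (λ z → θ (H (y ⊕ z) ⊕ ⊖ H z)))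

        E-radical : E ≡ + suc N ℤ.* + P₁
        E-radical = begin
          E
            ≡⟨ ∑ꟳ-cong (λ y my → ∑ꟳ-cong (λ z mz → θ-cong (cancel my mz))) ⟩
          ∑ꟳ (λ y → ∑ꟳ (λ z → θ (T (z ⊗ D y) ⊕ H y)))
            ≡⟨ ∑ꟳ-head (λ y → ∑ꟳ (λ z → θ (T (z ⊗ D y) ⊕ H y))) ⟩
          ∑ꟳ (λ z → θ (T (z ⊗ D 0#) ⊕ H 0#)) ℤ.+ ∑ N (λ i → ∑ꟳ (λ z → θ (T (z ⊗ D (pow δ i)) ⊕ H (pow δ i))))
            ≡⟨ cong₂ ℤ._+_
                 (∑ꟳ-cong {_} {λ _ → + P₁} (λ z _ → θ-0 (+-cong (T-cong (*-congˡ D-0 ⨾ zeroʳ z) ⨾ T-0) H-0 ⨾ +-identityˡ 0#)) ∙ ∑-const (suc N) (+ P₁))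
                 (∑-zero N (λ i _ → ∑θ-affine≡0 (D-mem (mem-gen i)) (D-≉0 i) (H-mem (mem-gen i)))) ⟩
          + suc N ℤ.* + P₁ ℤ.+ 0ℤ
            ≡⟨ ℤₚ.+-identityʳ _ ⟩
          + suc N ℤ.* + P₁ ∎
          where
          open ≡.≡-Reasoning
          D-0 : D 0# ≈ 0#
          D-0 = +-cong (*-congˡ (zeroˡ _) ⨾ zeroʳ _)
            (pow-cong (P ^ (j ∸ 1)) (zeroʳ c₀) ⨾ pow-0# (P ^ (j ∸ 1)) (ℕₚ.m^n>0 P (j ∸ 1))) ⨾
            +-identityˡ 0#
          cancel : ∀ {y z} → Mem y → Mem z → H (y ⊕ z) ⊕ ⊖ H z ≈ T (z ⊗ D y) ⊕ H y
          cancel {y} {z} my mz = begin′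
            H (y ⊕ z) ⊕ ⊖ H z ≈⟨ +-congʳ (H-⊕ my mz ⨾ +-assoc _ _ _) ⟩
            (H z ⊕ (T (z ⊗ D y) ⊕ H y)) ⊕ ⊖ H z ≈⟨ xyx⁻¹≈y (H z) _ ⟩
            T (z ⊗ D y) ⊕ H y ∎′
            where
            open import Algebra.Properties.AbelianGroup +-abelianGroup using (xyx⁻¹≈y)
            open ≈-Reasoning using (step-≈-⟩) renaming (begin_ to begin′_; _∎ to _∎′)

        E-square : + P₁ ℤ.* E ≡ G ℤ.* G
        E-square = begin
          + P₁ ℤ.* E
            ≡⟨ cong (+ P₁ ℤ.*_) (∑-swap (suc N) (suc N) (λ i l → θ (H (elt i ⊕ elt l) ⊕ ⊖ H (elt l)))) ⟩
          + P₁ ℤ.* ∑ꟳ (λ z → ∑ꟳ (λ y → θ (H (y ⊕ z) ⊕ ⊖ H z)))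
            ≡⟨ cong (+ P₁ ℤ.*_) (∑ꟳ-cong (λ z mz → ∑ꟳ-translate {λ y → θ (H y ⊕ ⊖ H z)} (λ eq → θ-cong (+-congʳ (H-cong eq))) mz)) ⟩
          + P₁ ℤ.* ∑ꟳ (λ z → ∑ꟳ (λ y → θ (H y ⊕ ⊖ H z)))
            ≡⟨ *-distribˡ-∑ (+ P₁) (suc N) (λ i → ∑ꟳ (λ y → θ (H y ⊕ ⊖ H (elt i)))) ⟩
          ∑ꟳ (λ z → + P₁ ℤ.* ∑ꟳ (λ y → θ (H y ⊕ ⊖ H z)))
            ≡⟨ ∑ꟳ-cong (λ z mz → G-separation (B.mem-⊖ (H-mem mz)) ∙ cong (G ℤ.*_) (θ-⊖ (H z))) ⟩
          ∑ꟳ (λ z → G ℤ.* θ (H z))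
            ≡⟨ *-distribˡ-∑ G (suc N) (λ i → θ (H (elt i))) ⟨
          G ℤ.* G ∎
          where
          open ≡.≡-Reasoning

        G² : G ℤ.* G ≡ (+ P₁ ℤ.* + P₁) ℤ.* + suc N
        G² = ≡.sym E-square ∙ cong (+ P₁ ℤ.*_) E-radical ∙ lemma (+ P₁) (+ suc N)
          where
          lemma : ∀ p q → p ℤ.* (q ℤ.* p) ≡ (p ℤ.* p) ℤ.* q
          lemma = solve-∀

        Y : ℤ
        Y = ∑ W (λ i → f (a + M * i))

        -- Along the class of a modulo M the values of `f` repeat after W steps, so the terms with y
        -- ≠ 0 are P₁ M copies of `Y`. This fixes G / P₁ modulo M.
        G≡1 : G ≡ + P₁ ℤ.* (1ℤ ℤ.+ + M ℤ.* Y)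
        G≡1 = begin
          G
            ≡⟨ G≡ ⟩
          + P₁ ℤ.+ ∑ N (λ i → f (a + M * i))
            ≡⟨ cong (λ n → + P₁ ℤ.+ ∑ n (λ i → f (a + M * i))) (N≡ ∙ ℕₚ.*-comm W (P₁ * M)) ⟩
          + P₁ ℤ.+ ∑ (P₁ * M * W) (λ i → f (a + M * i))
            ≡⟨ cong (λ v → + P₁ ℤ.+ v) (∑-periodic per (P₁ * M) ∙ ∑-const (P₁ * M) Y) ⟩
          + P₁ ℤ.+ + (P₁ * M) ℤ.* Y
            ≡⟨ cong (λ v → + P₁ ℤ.+ v ℤ.* Y) (ℤₚ.pos-* P₁ M) ⟩
          + P₁ ℤ.+ + P₁ ℤ.* + M ℤ.* Y
            ≡⟨ lemma (+ P₁) (+ M) Y ⟩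
          + P₁ ℤ.* (1ℤ ℤ.+ + M ℤ.* Y) ∎
          where
          open ≡.≡-Reasoning
          lemma : ∀ p m y → p ℤ.+ p ℤ.* m ℤ.* y ≡ p ℤ.* (1ℤ ℤ.+ m ℤ.* y)
          lemma = solve-∀
          per : Periodic W (λ i → f (a + M * i))
          per i = cong f (eq a M i W) ∙ f-base-periodic (a + M * i)
            where
            eq : ∀ a M i W → a + M * (i + W) ≡ a + M * i + M * W
            eq = ℕS.solve-∀

        -- G / P₁ and s have the same square and are both 1 modulo M ≥ 3.
        G≡P₁s : G ≡ + P₁ ℤ.* s
        G≡P₁s = G≡1 ∙ cong (+ P₁ ℤ.*_) (conclude (ℤₚ.i*j≡0⇒i≡0∨j≡0 (x ℤ.- s) difference))
          where
          x : ℤ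
          x = 1ℤ ℤ.+ + M ℤ.* Y
          x²≡s² : x ℤ.* x ≡ s ℤ.* s
          x²≡s² = ℤₚ.*-cancelˡ-≡ (+ P₁) _ _ (ℤₚ.*-cancelˡ-≡ (+ P₁) _ _ (lemma (+ P₁) x ∙
            cong₂ ℤ._*_ (≡.sym G≡1) (≡.sym G≡1) ∙ G² ∙ ℤₚ.*-assoc (+ P₁) (+ P₁) _)) ∙ ≡.sym s²≡Q
            where
            lemma : ∀ p x → p ℤ.* (p ℤ.* (x ℤ.* x)) ≡ (p ℤ.* x) ℤ.* (p ℤ.* x)
            lemma = solve-∀
          difference : (x ℤ.- s) ℤ.* (x ℤ.+ s) ≡ 0ℤ
          difference = lemma x s ∙ ℤₚ.i≡j⇒i-j≡0 x²≡s²
            where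
            lemma : ∀ x s → (x ℤ.- s) ℤ.* (x ℤ.+ s) ≡ x ℤ.* x ℤ.- s ℤ.* s
            lemma = solve-∀
          conclude : x ℤ.- s ≡ 0ℤ ⊎ x ℤ.+ s ≡ 0ℤ → x ≡ s
          conclude (inj₁ eq) = ℤₚ.i-j≡0⇒i≡j x s eq
          conclude (inj₂ eq) = ⊥-elim (ℕₚ.<⇒≱ (s≤s (s≤s B.0<N)) (∣⇒≤ (S.∣⇒∣ᵤ {+ M} {+ 2}
            (subst (+ M S.∣_) two (S.∣m⇒∣-m (S.∣m∣n⇒∣m+n s≡1 (S.∣m⇒∣m*n Y (S.∣-refl {+ M}))))))))
            where
            lemma : ∀ m y s → ℤ.- ((s ℤ.- 1ℤ) ℤ.+ m ℤ.* y) ≡ + 2 ℤ.- ((1ℤ ℤ.+ m ℤ.* y) ℤ.+ s)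
            lemma = solve-∀
            two : ℤ.- ((s ℤ.- 1ℤ) ℤ.+ + M ℤ.* Y) ≡ + 2
            two = lemma (+ M) Y s ∙ cong (λ v → + 2 ℤ.- v) eq

        period-generic : period M a ≡ + P₁ ℤ.* (s ℤ.- 1ℤ)
        period-generic = lemma₁ (+ P₁) (period M a) ∙ cong (ℤ._- + P₁) (≡.sym G≡ ∙ G≡P₁s) ∙ lemma₂ (+ P₁) s
          where
          lemma₁ : ∀ p x → x ≡ (p ℤ.+ x) ℤ.- p
          lemma₁ = solve-∀
          lemma₂ : ∀ p s → p ℤ.* s ℤ.- p ≡ p ℤ.* (s ℤ.- 1ℤ)
          lemma₂ = solve-∀

      -- The periods of all classes modulo M add up to M times a full sum, which determines the exceptional one.
      period-special : ∀ a → + M S.∣ (+ a ℤ.- + κ) → period M a ≡ + P₁ ℤ.* (s ℤ.* (1ℤ ℤ.- + M) ℤ.- 1ℤ)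
      period-special a a≡κ = lemma₁ (period M a) _ _ total ∙
        cong₂ (λ m p → m ℤ.* (ℤ.- + P₁) ℤ.- p ℤ.* (+ P₁ ℤ.* (s ℤ.- 1ℤ))) (≡.refl {x = + M}) (≡.refl {x = + P}) ∙
          lemma₂ (+ P₁) s
        where
        open ≡.≡-Reasoning
        lemma₁ : ∀ x y z → x ℤ.+ y ≡ z → x ≡ z ℤ.- y
        lemma₁ x y z eq = l x y ∙ cong (ℤ._- y) eq
          where
          l : ∀ x y → x ≡ (x ℤ.+ y) ℤ.- y
          l = solve-∀
        lemma₂ : ∀ p s → (1ℤ ℤ.+ (1ℤ ℤ.+ p)) ℤ.* (ℤ.- p) ℤ.- (1ℤ ℤ.+ p) ℤ.* (p ℤ.* (s ℤ.- 1ℤ))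
          ≡ p ℤ.* (s ℤ.* (1ℤ ℤ.- (1ℤ ℤ.+ (1ℤ ℤ.+ p))) ℤ.- 1ℤ)
        lemma₂ = solve-∀
        others : ∀ r → r < P → ¬ (+ M S.∣ (+ (a + 1 * suc r) ℤ.- + κ))
        others r r<P M∣ = ℕₚ.<⇒≱ (s≤s r<P) (∣⇒≤ (S.∣⇒∣ᵤ {+ M} {+ suc r}
          (subst (+ M S.∣_) (cong (λ v → v ℤ.- + κ ℤ.- (+ a ℤ.- + κ))
            (cong (λ k → + (a + k)) (ℕₚ.*-identityˡ (suc r)) ∙ ℤₚ.pos-+ a (suc r)) ∙ l (+ a) (+ suc r) (+ κ))
            (S.∣m∣n⇒∣m-n M∣ a≡κ))))
          where
          l : ∀ a r k → a ℤ.+ r ℤ.- k ℤ.- (a ℤ.- k) ≡ r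
          l = solve-∀
        total : period M a ℤ.+ + P ℤ.* (+ P₁ ℤ.* (s ℤ.- 1ℤ)) ≡ + M ℤ.* (ℤ.- + P₁)
        total = begin
          period M a ℤ.+ + P ℤ.* (+ P₁ ℤ.* (s ℤ.- 1ℤ))
            ≡⟨ cong₂ ℤ._+_ (cong (period M) (≡.sym (ℕₚ.+-identityʳ a))) (≡.sym (∑-const P _)) ⟩
          period M (a + 1 * 0) ℤ.+ ∑ P (λ _ → + P₁ ℤ.* (s ℤ.- 1ℤ))
            ≡⟨ cong (λ v → period M (a + 1 * 0) ℤ.+ v) (∑-cong P (λ r r<P → ≡.sym (Moment.period-generic (a + 1 * suc r) (others r r<P)))) ⟩
          period M (a + 1 * 0) ℤ.+ ∑ P (λ r → period M (a + 1 * suc r))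
            ≡⟨ ∑-head P (λ r → period M (a + 1 * r)) ⟨
          ∑ M (λ r → period M (a + 1 * r))
            ≡⟨ period-blocks {1} {M} (ℕₚ.*-identityˡ M) a ⟩
          + M ℤ.* period 1 a
            ≡⟨ cong (+ M ℤ.*_) (∑-cong′ N (λ i → cong (λ k → f (a + k)) (ℕₚ.*-identityˡ i)) ∙ ∑f-shift a) ⟩
          + M ℤ.* (ℤ.- + P₁) ∎

      period-M : ∀ a → period M a ≡ + P₁ ℤ.* (s ℤ.* (1ℤ ℤ.- + M ℤ.* [ M ∣ + a ℤ.- + κ ]) ℤ.- 1ℤ)
      period-M a = go (+ M S.∣? (+ a ℤ.- + κ))
        where
        lemma : ∀ s m p v w → v ≡ w → p ℤ.* (s ℤ.* (1ℤ ℤ.- m ℤ.* v) ℤ.- 1ℤ) ≡ p ℤ.* (s ℤ.* (1ℤ ℤ.- m ℤ.* w) ℤ.- 1ℤ)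
        lemma s m p v w ≡.refl = ≡.refl
        one : ∀ s m p → p ℤ.* (s ℤ.* (1ℤ ℤ.- m) ℤ.- 1ℤ) ≡ p ℤ.* (s ℤ.* (1ℤ ℤ.- m ℤ.* 1ℤ) ℤ.- 1ℤ)
        one = solve-∀
        zer : ∀ s m p → p ℤ.* (s ℤ.- 1ℤ) ≡ p ℤ.* (s ℤ.* (1ℤ ℤ.- m ℤ.* 0ℤ) ℤ.- 1ℤ)
        zer = solve-∀
        go : Dec (+ M S.∣ (+ a ℤ.- + κ)) → _
        go (yes p) = period-special a p ∙ one s (+ M) (+ P₁) ∙ lemma s (+ M) (+ P₁) _ _ (≡.sym (⟦⟧-yes (+ M S.∣? _) p))
        go (no ¬p) = Moment.period-generic a ¬p ∙ zer s (+ M) (+ P₁) ∙ lemma s (+ M) (+ P₁) _ _ (≡.sym (⟦⟧-no (+ M S.∣? _) ¬p))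

      -- R times the period is a sum over the R classes modulo M that lie above a modulo S. One of
      -- them is exceptional if a ≡ κ modulo S, and none otherwise.
      semiprimitive : ∀ {S R} → S * R ≡ M → ∀ a →
        period S a ≡ + P₁ ℤ.* (s ℤ.* (1ℤ ℤ.- + S ℤ.* [ S ∣ + a ℤ.- + κ ]) ℤ.- 1ℤ)
      semiprimitive {S} {R} SR≡M a = ℤₚ.*-cancelˡ-≡ (+ R) _ _ (begin
        + R ℤ.* period S a
          ≡⟨ period-blocks {S} {R} SR≡M a ⟨
        ∑ R (λ r → period M (a + S * r))
          ≡⟨ ∑-cong′ R (λ r → period-M (a + S * r) ∙ (affine (+ P₁) s (+ M) [ M ∣ + (a + S * r) ℤ.- + κ ])) ⟩
        ∑ R (λ r → + P₁ ℤ.* (s ℤ.- 1ℤ) ℤ.+ (ℤ.- (+ P₁ ℤ.* s ℤ.* + M)) ℤ.* [ M ∣ + (a + S * r) ℤ.- + κ ])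
          ≡⟨ ∑-distrib-+ R (λ _ → + P₁ ℤ.* (s ℤ.- 1ℤ)) (λ r → (ℤ.- (+ P₁ ℤ.* s ℤ.* + M)) ℤ.* [ M ∣ + (a + S * r) ℤ.- + κ ]) ⟩
        ∑ R (λ _ → + P₁ ℤ.* (s ℤ.- 1ℤ)) ℤ.+ ∑ R (λ r → (ℤ.- (+ P₁ ℤ.* s ℤ.* + M)) ℤ.* [ M ∣ + (a + S * r) ℤ.- + κ ])
          ≡⟨ cong₂ ℤ._+_ (∑-const R _) (≡.sym (*-distribˡ-∑ (ℤ.- (+ P₁ ℤ.* s ℤ.* + M)) R (λ r → [ M ∣ + (a + S * r) ℤ.- + κ ]))) ⟩
        + R ℤ.* (+ P₁ ℤ.* (s ℤ.- 1ℤ)) ℤ.+ (ℤ.- (+ P₁ ℤ.* s ℤ.* + M)) ℤ.* ∑ R (λ r → [ M ∣ + (a + S * r) ℤ.- + κ ])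
          ≡⟨ cong₂ (λ m v → + R ℤ.* (+ P₁ ℤ.* (s ℤ.- 1ℤ)) ℤ.+ (ℤ.- (+ P₁ ℤ.* s ℤ.* m)) ℤ.* v) (cong +_ (≡.sym SR≡M) ∙ ℤₚ.pos-* S R) count ⟩
        + R ℤ.* (+ P₁ ℤ.* (s ℤ.- 1ℤ)) ℤ.+ (ℤ.- (+ P₁ ℤ.* s ℤ.* (+ S ℤ.* + R))) ℤ.* [ S ∣ + a ℤ.- + κ ]
          ≡⟨ collect (+ R) (+ P₁) s (+ S) [ S ∣ + a ℤ.- + κ ] ⟩
        + R ℤ.* (+ P₁ ℤ.* (s ℤ.* (1ℤ ℤ.- + S ℤ.* [ S ∣ + a ℤ.- + κ ]) ℤ.- 1ℤ)) ∎)
        where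
        open ≡.≡-Reasoning
        instance
          SR≢0 : ℕ.NonZero (S * R)
          SR≢0 = subst ℕ.NonZero (≡.sym SR≡M) _
          S≢0 : ℕ.NonZero S
          S≢0 = ℕₚ.m*n≢0⇒m≢0 S
          R≢0 : ℕ.NonZero R
          R≢0 = ℕₚ.m*n≢0⇒n≢0 S
        affine : ∀ p s m v → p ℤ.* (s ℤ.* (1ℤ ℤ.- m ℤ.* v) ℤ.- 1ℤ) ≡ p ℤ.* (s ℤ.- 1ℤ) ℤ.+ (ℤ.- (p ℤ.* s ℤ.* m)) ℤ.* v
        affine = solve-∀
        collect : ∀ r p s S v → r ℤ.* (p ℤ.* (s ℤ.- 1ℤ)) ℤ.+ (ℤ.- (p ℤ.* s ℤ.* (S ℤ.* r))) ℤ.* v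
          ≡ r ℤ.* (p ℤ.* (s ℤ.* (1ℤ ℤ.- S ℤ.* v) ℤ.- 1ℤ))
        collect = solve-∀
        swap : ∀ a r k → a ℤ.+ r ℤ.- k ≡ a ℤ.- k ℤ.+ r
        swap = solve-∀
        count : ∑ R (λ r → [ M ∣ + (a + S * r) ℤ.- + κ ]) ≡ [ S ∣ + a ℤ.- + κ ]
        count = ∑-cong′ R (λ r → cong₂ [_∣_] (≡.sym SR≡M)
            (cong (ℤ._- + κ) (ℤₚ.pos-+ a (S * r)) ∙ swap (+ a) (+ (S * r)) (+ κ))) ∙
          ∑-congruence S {R} (+ a ℤ.- + κ)

  -- Bundled because the evaluation is applied twice in one tower: in 𝔽_{q^t} with s = (-P)^(nt) and
  -- in 𝔽_q with s = (-P)^n.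
  record SemiprimitiveField (j N : ℕ) (δ : Carrier) (κ : ℕ) (s : ℤ) : Set (c ⊔ ℓ) where
    field
      0<j   : 0 < j
      P^j≡  : P ^ j ≡ suc N
      ext   : Subfield N δ
      W     : ℕ
      N≡    : N ≡ W * (P₁ * suc P)
      ν     : ℕ
      δ^ν≈-1 : pow δ ν ≈ ⊖ 1#
      ν≡κ   : + (P₁ * suc P) S.∣ (+ ν ℤ.- + (P₁ * κ))
      s²≡Q  : s ℤ.* s ≡ + suc N
      s≡1   : + suc P S.∣ (s ℤ.- 1ℤ)
    open Extension {j} {N} {W} {δ} 0<j P^j≡ ext N≡ public
    open Semiprimitive {κ} {ν} δ^ν≈-1 ν≡κ {s} s²≡Q s≡1 public

    N-multiple : ∀ {S R} → S * R ≡ suc P → N ≡ W * (P₁ * R) * S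
    N-multiple {S} {R} SR≡M = N≡ ∙ cong (λ m → W * (P₁ * m)) (≡.sym SR≡M) ∙ eq W P₁ S R
      where
      eq : ∀ W P₁ S R → W * (P₁ * (S * R)) ≡ W * (P₁ * R) * S
      eq = ℕS.solve-∀

  -- Fourier inversion on 𝔽_q for the trace of 𝔽_{q^t}

  module Relative {j j′ N N′ t₀ t : ℕ} {δ : Carrier} {κ κ′ : ℕ} {s s′ : ℤ}
    (big : SemiprimitiveField j N δ κ s)
    (small : SemiprimitiveField j′ N′ (pow δ t₀) κ′ s′)
    (N≡t₀N′ : N ≡ t₀ * N′) (j≡tj′ : j ≡ t * j′)
    where

    module L = SemiprimitiveField big
    module k = SemiprimitiveField small
    open ≡.≡-Reasoning

    g₀ : Carrier
    g₀ = pow δ t₀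

    trace : Carrier → Carrier
    trace x = ∑ᴷ t (λ i → pow x (suc N′ ^ i))

    trace-cong : ∀ {x y} → x ≈ y → trace x ≈ trace y
    trace-cong eq = ∑ᴷ.∑-cong′ t (λ i → pow-cong (suc N′ ^ i) eq)

    pow-q^ : ∀ i x → pow x (suc N′ ^ i) ≈ pow x (P ^ (i * j′))
    pow-q^ i x = pow-congʳ x (cong (_^ i) (≡.sym k.P^j≡) ∙
      ℕₚ.^-*-assoc P j′ i ∙ cong (P ^_) (ℕₚ.*-comm j′ i))

    -- Transitivity of the trace: the Frobenius exponents l j′ + i with i < j′ and l < t are those
    -- below j = t j′.
    T-trace : ∀ x → k.T (trace x) ≈ L.T x
    T-trace x = ∑ᴷ.∑-cong′ j′ (λ i → pow-P-∑ i t (λ l → pow x (suc N′ ^ l)) ⨾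
        ∑ᴷ.∑-cong′ t (λ l → pow-cong (P ^ i) (pow-q^ l x) ⨾ sym (pow-* x (P ^ (l * j′)) (P ^ i)) ⨾
          pow-congʳ x (≡.sym (ℕₚ.^-distribˡ-+-* P (l * j′) i)))) ⨾
      ∑ᴷ.∑-swap j′ t (λ i l → pow x (P ^ (l * j′ + i))) ⨾
        sym (∑ᴷ.∑-blocks t j′ (λ i → pow x (P ^ i))) ⨾
          reflexive (cong (λ n → ∑ᴷ n (λ i → pow x (P ^ i))) (≡.sym j≡tj′))

    trace-⊗ : ∀ {a} x → k.Mem a → trace (a ⊗ x) ≈ a ⊗ trace x
    trace-⊗ {a} x ma = ∑ᴷ.∑-cong′ t (λ i → pow-⊗ a x (suc N′ ^ i) ⨾ *-congʳ (pow-fixed (suc N′) ma i)) ⨾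
      sym (∑ᴷ.*-distribˡ-∑ a t _)

    trace-mem : ∀ {x} → L.Mem x → k.Mem (trace x)
    trace-mem {x} mx = pow-congʳ _ (≡.sym k.P^j≡) ⨾ pow-P-∑ j′ t (λ i → pow x (suc N′ ^ i)) ⨾
      ∑ᴷ.∑-cong′ t (λ i → sym (pow-* x (suc N′ ^ i) (P ^ j′)) ⨾
        pow-congʳ x (cong (suc N′ ^ i *_) k.P^j≡ ∙ ℕₚ.*-comm (suc N′ ^ i) (suc N′))) ⨾
        ∑ᴷ.∑-shift (frobenius-periodic (suc N′) t
          (pow-q^ t x ⨾ pow-congʳ x (cong (P ^_) (≡.sym j≡tj′)) ⨾ L.mem-P^j mx)) 1

    orthogonality : ∀ {z} → k.Mem z → k.∑ꟳ (λ a → θ (k.T (a ⊗ z))) ≡ + P₁ ℤ.* (+ suc N′ ℤ.* ⟦ z ≟ 0# ⟧)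
    orthogonality {z} mz = go (z ≟ 0#)
      where
      go : Dec (z ≈ 0#) → k.∑ꟳ (λ a → θ (k.T (a ⊗ z))) ≡ + P₁ ℤ.* (+ suc N′ ℤ.* ⟦ z ≟ 0# ⟧)
      go (yes z≈0) = begin
        k.∑ꟳ (λ a → θ (k.T (a ⊗ z))) ≡⟨ k.∑ꟳ-cong {λ a → θ (k.T (a ⊗ z))} {λ _ → + P₁} (λ a _ → θ-0 (k.T-cong (*-congˡ z≈0 ⨾ zeroʳ a) ⨾ k.T-0)) ⟩
        k.∑ꟳ (λ _ → + P₁) ≡⟨ ∑-const (suc N′) (+ P₁) ⟩
        + suc N′ ℤ.* + P₁ ≡⟨ lemma (+ suc N′) (+ P₁) ⟩
        + P₁ ℤ.* (+ suc N′ ℤ.* 1ℤ) ≡⟨ cong (λ v → + P₁ ℤ.* (+ suc N′ ℤ.* v)) (⟦⟧-yes (z ≟ 0#) z≈0) ⟨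
        + P₁ ℤ.* (+ suc N′ ℤ.* ⟦ z ≟ 0# ⟧) ∎
        where
        lemma : ∀ q p → q ℤ.* p ≡ p ℤ.* (q ℤ.* 1ℤ)
        lemma = solve-∀
      go (no z≉0) = begin
        k.∑ꟳ (λ a → θ (k.T (a ⊗ z))) ≡⟨ k.∑ꟳ-cong (λ a _ → θ-cong (sym (+-identityʳ (k.T (a ⊗ z))))) ⟩
        k.∑ꟳ (λ a → θ (k.T (a ⊗ z) ⊕ 0#)) ≡⟨ k.∑θ-affine≡0 mz z≉0 B.mem-0 ⟩
        0ℤ ≡⟨ lemma (+ P₁) (+ suc N′) ⟩
        + P₁ ℤ.* (+ suc N′ ℤ.* 0ℤ) ≡⟨ cong (λ v → + P₁ ℤ.* (+ suc N′ ℤ.* v)) (⟦⟧-no (z ≟ 0#) z≉0) ⟨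
        + P₁ ℤ.* (+ suc N′ ℤ.* ⟦ z ≟ 0# ⟧) ∎
        where
        lemma : ∀ p q → 0ℤ ≡ p ℤ.* (q ℤ.* 0ℤ)
        lemma = solve-∀

    module Fibre {S R : ℕ} (SR≡M : S * R ≡ suc P) (i₀ : ℕ) {b : Carrier} (mb : k.Mem b) where

      instance
        SR≢0 : ℕ.NonZero (S * R)
        SR≢0 = subst ℕ.NonZero (≡.sym SR≡M) _
        S≢0 : ℕ.NonZero S
        S≢0 = ℕₚ.m*n≢0⇒m≢0 S

      Nb : ℤ
      Nb = ∑ N (λ i → [ S ∣ + i ℤ.- + i₀ ] ℤ.* ⟦ trace (pow δ i) ≟ b ⟧)

      β : ℕ → Carrier
      β i = k.T (pow g₀ i ⊗ b)

      β-mem : ∀ i → B.Mem (β i)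
      β-mem i = k.T-mem (k.mem-⊗ (k.mem-gen i) mb)

      -- The period of the class of λ δ^(i₀), divided by P₁. Here λ = g₀^i is δ^(t₀ i), whence the
      -- exponent i₀ + t₀ i.
      coefficient : ℕ → ℤ
      coefficient i = s ℤ.* (1ℤ ℤ.- + S ℤ.* [ S ∣ + (i₀ + t₀ * i) ℤ.- + κ ]) ℤ.- 1ℤ

      private
        x : ℕ → Carrier
        x i = pow δ (i₀ + S * i)

        n : ℕ
        n = L.W * (P₁ * R)
        N≡nS : N ≡ n * S
        N≡nS = L.N-multiple {S} {R} SR≡M

      S*Nb : + S ℤ.* Nb ≡ ∑ N (λ i → ⟦ trace (x i) ≟ b ⟧)
      S*Nb = ≡.sym (subst (λ N → ∑ N (λ i → ⟦ trace (x i) ≟ b ⟧) ≡ + S ℤ.* ∑ N (λ i → [ S ∣ + i ℤ.- + i₀ ] ℤ.* ⟦ trace (pow δ i) ≟ b ⟧))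
        (≡.sym N≡nS) (∑-residue-class {S} {n} {λ i → ⟦ trace (pow δ i) ≟ b ⟧} per i₀))
        where
        per : Periodic (n * S) (λ i → ⟦ trace (pow δ i) ≟ b ⟧)
        per i = ⟦⟧-cong _ _ (trans (sym eq)) (trans eq)
          where
          eq : trace (pow δ (i + n * S)) ≈ trace (pow δ i)
          eq = trace-cong (pow-congʳ δ (cong (i ℕ.+_) (≡.sym N≡nS ∙ ≡.sym (ℕₚ.*-identityˡ N))) ⨾ L.pow-shift i 1)

      inner : ∀ {a} → k.Mem a → ∀ i → θ (k.T (a ⊗ (trace (x i) ⊕ ⊖ b))) ≡ θ (L.T (a ⊗ x i) ⊕ ⊖ k.T (a ⊗ b))
      inner {a} ma i = θ-cong (k.T-cong (distribˡ a _ _ ⨾ +-congˡ (sym (-‿distribʳ-* a b))) ⨾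
        k.T-⊕ _ _ ⨾ +-cong (k.T-cong (sym (trace-⊗ (x i) ma)) ⨾ T-trace (a ⊗ x i)) (k.T-⊖ (a ⊗ b)))

      -- For fixed λ ∈ 𝔽_q* the constant T(λ b) lies in 𝔽_P, so `separation` splits the sum into a
      -- period and θ(T(λ b)).
      column : ∀ i → ∑ N (λ l → θ (L.T (pow g₀ i ⊗ x l) ⊕ ⊖ β i)) ≡ coefficient i ℤ.* θ (β i)
      column i = ℤₚ.*-cancelˡ-≡ (+ P₁) _ _ (begin
        + P₁ ℤ.* ∑ N (λ l → θ (L.T (pow g₀ i ⊗ x l) ⊕ ⊖ β i))
          ≡⟨ cong (+ P₁ ℤ.*_) (∑-cong′ N (λ l → θ-cong (+-congʳ (L.T-cong (*-congʳ (sym (pow-* δ t₀ i)) ⨾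
               sym (pow-+ δ (t₀ * i) (i₀ + S * l)) ⨾ pow-congʳ δ (eq t₀ i i₀ S l)))))) ⟩
        + P₁ ℤ.* ∑ N (λ l → θ (L.T (pow δ ((i₀ + t₀ * i) + S * l)) ⊕ ⊖ β i))
          ≡⟨ L.separation {S} {R} SR≡M (i₀ + t₀ * i) (B.mem-⊖ (β-mem i)) ⟩
        L.period S (i₀ + t₀ * i) ℤ.* θ (⊖ β i)
          ≡⟨ cong₂ ℤ._*_ (L.semiprimitive {S} {R} SR≡M (i₀ + t₀ * i)) (θ-⊖ (β i)) ⟩
        + P₁ ℤ.* coefficient i ℤ.* θ (β i)
          ≡⟨ ℤₚ.*-assoc (+ P₁) (coefficient i) (θ (β i)) ⟩
        + P₁ ℤ.* (coefficient i ℤ.* θ (β i)) ∎)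
        where
        eq : ∀ t₀ i i₀ S l → t₀ * i + (i₀ + S * l) ≡ (i₀ + t₀ * i) + S * l
        eq = ℕS.solve-∀

      -- Each indicator [trace x = b] is expanded over λ ∈ 𝔽_q by `orthogonality`. The factor P₁ on
      -- the left counts the characters summed in θ, the factor S the multiplicity with which the
      -- coset is run through, and N P₁ on the right is the term λ = 0.
      fourier : + P₁ ℤ.* (+ suc N′ ℤ.* (+ S ℤ.* Nb)) ≡ + N ℤ.* + P₁ ℤ.+ ∑ N′ (λ i → coefficient i ℤ.* θ (β i))
      fourier = begin
        + P₁ ℤ.* (+ suc N′ ℤ.* (+ S ℤ.* Nb))
          ≡⟨ cong (λ v → + P₁ ℤ.* (+ suc N′ ℤ.* v)) S*Nb ⟩
        + P₁ ℤ.* (+ suc N′ ℤ.* ∑ N (λ i → ⟦ trace (x i) ≟ b ⟧))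
          ≡⟨ cong (+ P₁ ℤ.*_) (*-distribˡ-∑ (+ suc N′) N (λ i → ⟦ trace (x i) ≟ b ⟧)) ∙
               *-distribˡ-∑ (+ P₁) N (λ i → + suc N′ ℤ.* ⟦ trace (x i) ≟ b ⟧) ⟩
        ∑ N (λ i → + P₁ ℤ.* (+ suc N′ ℤ.* ⟦ trace (x i) ≟ b ⟧))
          ≡⟨ ∑-cong′ N (λ i → cong (λ v → + P₁ ℤ.* (+ suc N′ ℤ.* v))
               (⟦⟧-cong (trace (x i) ≟ b) (trace (x i) ⊕ ⊖ b ≟ 0#) (λ eq → +-congʳ eq ⨾ -‿inverseʳ b)
                 (λ eq → ⊖-uniqueˡ _ _ eq ⨾ ⊖-involutive b)) ∙
               ≡.sym (orthogonality (k.mem-⊕ (trace-mem (L.mem-gen (i₀ + S * i))) (k.mem-⊖ mb)))) ⟩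
        ∑ N (λ i → k.∑ꟳ (λ a → θ (k.T (a ⊗ (trace (x i) ⊕ ⊖ b)))))
          ≡⟨ ∑-cong′ N (λ i → k.∑ꟳ-cong (λ a ma → inner ma i)) ⟩
        ∑ N (λ i → k.∑ꟳ (λ a → θ (L.T (a ⊗ x i) ⊕ ⊖ k.T (a ⊗ b))))
          ≡⟨ ∑-swap N (suc N′) (λ i l → θ (L.T (k.elt l ⊗ x i) ⊕ ⊖ k.T (k.elt l ⊗ b))) ⟩
        k.∑ꟳ (λ a → ∑ N (λ i → θ (L.T (a ⊗ x i) ⊕ ⊖ k.T (a ⊗ b))))
          ≡⟨ k.∑ꟳ-head (λ a → ∑ N (λ i → θ (L.T (a ⊗ x i) ⊕ ⊖ k.T (a ⊗ b)))) ⟩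
        ∑ N (λ i → θ (L.T (0# ⊗ x i) ⊕ ⊖ k.T (0# ⊗ b))) ℤ.+ ∑ N′ (λ i → ∑ N (λ l → θ (L.T (pow g₀ i ⊗ x l) ⊕ ⊖ β i)))
          ≡⟨ cong₂ ℤ._+_ (∑-cong′ N {_} {λ _ → + P₁} (λ i → θ-0 (+-cong (L.T-cong (zeroˡ _) ⨾ L.T-0)
                (-‿cong (k.T-cong (zeroˡ b) ⨾ k.T-0) ⨾ ⊖0≈0) ⨾ +-identityˡ 0#)) ∙ ∑-const N (+ P₁))
              (∑-cong′ N′ column) ⟩
        + N ℤ.* + P₁ ℤ.+ ∑ N′ (λ i → coefficient i ℤ.* θ (β i)) ∎

      ∑-coefficient : ∀ (v : ℕ → ℤ) → ∑ N′ (λ i → coefficient i ℤ.* v i) ≡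
        (s ℤ.- 1ℤ) ℤ.* ∑ N′ v ℤ.- s ℤ.* (+ S ℤ.* ∑ N′ (λ i → [ S ∣ + (i₀ + t₀ * i) ℤ.- + κ ] ℤ.* v i))
      ∑-coefficient v = begin
        ∑ N′ (λ i → coefficient i ℤ.* v i)
          ≡⟨ ∑-cong′ N′ (λ i → expand s (+ S) (w i) (v i)) ⟩
        ∑ N′ (λ i → (s ℤ.- 1ℤ) ℤ.* v i ℤ.+ (ℤ.- (s ℤ.* + S)) ℤ.* (w i ℤ.* v i))
          ≡⟨ ∑-distrib-+ N′ (λ i → (s ℤ.- 1ℤ) ℤ.* v i) (λ i → (ℤ.- (s ℤ.* + S)) ℤ.* (w i ℤ.* v i)) ⟩
        ∑ N′ (λ i → (s ℤ.- 1ℤ) ℤ.* v i) ℤ.+ ∑ N′ (λ i → (ℤ.- (s ℤ.* + S)) ℤ.* (w i ℤ.* v i))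
          ≡⟨ cong₂ ℤ._+_ (*-distribˡ-∑ (s ℤ.- 1ℤ) N′ v) (*-distribˡ-∑ (ℤ.- (s ℤ.* + S)) N′ (λ i → w i ℤ.* v i)) ⟨
        (s ℤ.- 1ℤ) ℤ.* ∑ N′ v ℤ.+ (ℤ.- (s ℤ.* + S)) ℤ.* ∑ N′ (λ i → w i ℤ.* v i)
          ≡⟨ collect s (+ S) (∑ N′ v) (∑ N′ (λ i → w i ℤ.* v i)) ⟩
        (s ℤ.- 1ℤ) ℤ.* ∑ N′ v ℤ.- s ℤ.* (+ S ℤ.* ∑ N′ (λ i → w i ℤ.* v i)) ∎
        where
        w : ℕ → ℤ
        w i = [ S ∣ + (i₀ + t₀ * i) ℤ.- + κ ]
        expand : ∀ s S w v → (s ℤ.* (1ℤ ℤ.- S ℤ.* w) ℤ.- 1ℤ) ℤ.* v ≡ (s ℤ.- 1ℤ) ℤ.* v ℤ.+ (ℤ.- (s ℤ.* S)) ℤ.* (w ℤ.* v)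
        expand = solve-∀
        collect : ∀ s S x y → (s ℤ.- 1ℤ) ℤ.* x ℤ.+ (ℤ.- (s ℤ.* S)) ℤ.* y ≡ (s ℤ.- 1ℤ) ℤ.* x ℤ.- s ℤ.* (S ℤ.* y)
        collect = solve-∀

      module Congruence {l τ u : ℕ} (S≡lu : S ≡ l * u) (t₀≡lτ : t₀ ≡ l * τ) (τ⊥u : Coprime τ u) where

        instance
          lu≢0 : ℕ.NonZero (l * u)
          lu≢0 = subst ℕ.NonZero S≡lu S≢0
          l≢0 : ℕ.NonZero l
          l≢0 = ℕₚ.m*n≢0⇒m≢0 l
          u≢0 : ℕ.NonZero u
          u≢0 = ℕₚ.m*n≢0⇒n≢0 l

        private
          ulR≡M : u * (l * R) ≡ suc P
          ulR≡M = eq u l R ∙ cong (_* R) (≡.sym S≡lu) ∙ SR≡M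
            where
            eq : ∀ u l R → u * (l * R) ≡ l * u * R
            eq = ℕS.solve-∀
          n′ : ℕ
          n′ = k.W * (P₁ * (l * R))
          N′≡n′u : N′ ≡ n′ * u
          N′≡n′u = k.N-multiple {u} {l * R} ulR≡M

        insoluble : ∀ {D} → ¬ (+ l S.∣ D) → ∀ i → [ S ∣ + (t₀ * i) ℤ.- D ] ≡ 0ℤ
        insoluble {D} l∤D i = ⟦⟧-no _ (λ S∣ → l∤D (subst (+ l S.∣_) (lemma (+ (t₀ * i)) D)
          (S.∣m∣n⇒∣m-n (S.∣ᵤ⇒∣ {+ l} {+ (t₀ * i)} (subst (λ t → l ∣ t * i) (≡.sym t₀≡lτ) (∣m⇒∣m*n i (m∣m*n τ))))
            (S.∣-trans (S.∣ᵤ⇒∣ (subst (l ∣_) (≡.sym S≡lu) (m∣m*n u))) S∣))))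
          where
          lemma : ∀ x D → x ℤ.- (x ℤ.- D) ≡ D
          lemma = solve-∀

        -- Division by l turns t₀ i ≡ D modulo S into τ i ≡ D′ modulo u, where τ is invertible; the
        -- solutions are the single class of j₀.
        soluble : ∀ {D D′ j₀} → D ≡ D′ ℤ.* + l → + u S.∣ (+ (τ * j₀) ℤ.- D′) →
          ∀ i → [ S ∣ + (t₀ * i) ℤ.- D ] ≡ [ u ∣ + i ℤ.- + j₀ ]
        soluble {D} {D′} {j₀} D≡ u∣ i = ⟦⟧-cong _ _
          (λ S∣ → coprime-cancel τ⊥u _ (subst (+ u S.∣_) (lemma₂ (+ τ) (+ i) (+ j₀) D′)
            (S.∣m∣n⇒∣m-n (S.*-cancelˡ-∣ (+ l) (subst₂ S._∣_ (cong +_ S≡lu ∙ ℤₚ.pos-* l u) factor S∣)) u∣′)))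
          (λ u∣i → subst₂ S._∣_ (≡.sym (cong +_ S≡lu ∙ ℤₚ.pos-* l u)) (≡.sym factor)
            (S.*-monoʳ-∣ (+ l) (subst (+ u S.∣_) (lemma₃ (+ τ) (+ i) (+ j₀) D′) (S.∣m∣n⇒∣m+n (S.∣n⇒∣m*n (+ τ) u∣i) u∣′))))
          where
          u∣′ : + u S.∣ (+ τ ℤ.* + j₀ ℤ.- D′)
          u∣′ = subst (λ v → + u S.∣ (v ℤ.- D′)) (ℤₚ.pos-* τ j₀) u∣
          lemma₁ : ∀ l τ i D′ → l ℤ.* τ ℤ.* i ℤ.- D′ ℤ.* l ≡ l ℤ.* (τ ℤ.* i ℤ.- D′)
          lemma₁ = solve-∀
          factor : + (t₀ * i) ℤ.- D ≡ + l ℤ.* (+ τ ℤ.* + i ℤ.- D′)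
          factor = cong₂ ℤ._-_ (cong (λ t → + (t * i)) t₀≡lτ ∙
            ℤₚ.pos-* (l * τ) i ∙ cong (ℤ._* + i) (ℤₚ.pos-* l τ)) D≡ ∙ lemma₁ (+ l) (+ τ) (+ i) D′
          lemma₂ : ∀ τ i j D → (τ ℤ.* i ℤ.- D) ℤ.- (τ ℤ.* j ℤ.- D) ≡ τ ℤ.* (i ℤ.- j)
          lemma₂ = solve-∀
          lemma₃ : ∀ τ i j D → τ ℤ.* (i ℤ.- j) ℤ.+ (τ ℤ.* j ℤ.- D) ≡ τ ℤ.* i ℤ.- D
          lemma₃ = solve-∀

        u*∑ : ∀ {h : ℕ → ℤ} → Periodic N′ h → ∀ j₀ →
          + u ℤ.* ∑ N′ (λ i → [ u ∣ + i ℤ.- + j₀ ] ℤ.* h i) ≡ ∑ N′ (λ i → h (j₀ + u * i))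
        u*∑ {h} per j₀ = subst (λ N → + u ℤ.* ∑ N (λ i → [ u ∣ + i ℤ.- + j₀ ] ℤ.* h i) ≡ ∑ N (λ i → h (j₀ + u * i)))
          (≡.sym N′≡n′u) (≡.sym (∑-residue-class {u} {n′} {h} (subst (λ N → Periodic N h) N′≡n′u per) j₀))

        -- The map i ↦ j₀ + u i runs u times over the class of j₀ modulo u, so of S = l u only the
        -- factor l remains outside the sum.
        S*soluble : ∀ {D D′ j₀} → D ≡ D′ ℤ.* + l → + u S.∣ (+ (τ * j₀) ℤ.- D′) →
          ∀ {h} → Periodic N′ h →
          + S ℤ.* ∑ N′ (λ i → [ S ∣ + (t₀ * i) ℤ.- D ] ℤ.* h i) ≡ + l ℤ.* ∑ N′ (λ i → h (j₀ + u * i))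
        S*soluble {D} {D′} {j₀} D≡ u∣ {h} per = cong₂ ℤ._*_ (cong +_ S≡lu ∙ ℤₚ.pos-* l u)
            (∑-cong′ N′ (λ i → cong (ℤ._* h i) (soluble {D} {D′} {j₀} D≡ u∣ i))) ∙
          ℤₚ.*-assoc (+ l) (+ u) _ ∙ cong (+ l ℤ.*_) (u*∑ {h} per j₀)

        D₀ : ℤ
        D₀ = + κ ℤ.- + i₀

        private
          target : ∀ i → + (i₀ + t₀ * i) ℤ.- + κ ≡ + (t₀ * i) ℤ.- D₀
          target i = cong (ℤ._- + κ) (ℤₚ.pos-+ i₀ (t₀ * i)) ∙ lemma (+ i₀) (+ (t₀ * i)) (+ κ)
            where
            lemma : ∀ i x k → i ℤ.+ x ℤ.- k ≡ x ℤ.- (k ℤ.- i)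
            lemma = solve-∀

        -- S times the number of exceptional λ ∈ 𝔽_q*: there are none unless l divides κ - i₀, and
        -- otherwise they fill one class modulo u, which has N′ / u members.
        S*count : + S ℤ.* ∑ N′ (λ i → [ S ∣ + (i₀ + t₀ * i) ℤ.- + κ ] ℤ.* 1ℤ) ≡ + N′ ℤ.* (+ l ℤ.* [ l ∣ D₀ ])
        S*count = go (+ l S.∣? D₀)
          where
          go : Dec (+ l S.∣ D₀) → + S ℤ.* ∑ N′ (λ i → [ S ∣ + (i₀ + t₀ * i) ℤ.- + κ ] ℤ.* 1ℤ) ≡ + N′ ℤ.* (+ l ℤ.* [ l ∣ D₀ ])
          go (no l∤D) = cong (+ S ℤ.*_) (∑-zero N′ (λ i _ → ℤₚ.*-identityʳ _ ∙
              cong [ S ∣_] (target i) ∙ insoluble l∤D i)) ∙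
            lemma (+ S) (+ N′) (+ l) ∙ cong (λ v → + N′ ℤ.* (+ l ℤ.* v)) (≡.sym (⟦⟧-no (+ l S.∣? D₀) l∤D))
            where
            lemma : ∀ S N l → S ℤ.* 0ℤ ≡ N ℤ.* (l ℤ.* 0ℤ)
            lemma = solve-∀
          go (yes l∣D@(S.divides D′ D≡)) = begin
            + S ℤ.* ∑ N′ (λ i → [ S ∣ + (i₀ + t₀ * i) ℤ.- + κ ] ℤ.* 1ℤ)
              ≡⟨ cong (+ S ℤ.*_) (∑-cong′ N′ (λ i → cong (λ z → [ S ∣ z ] ℤ.* 1ℤ) (target i))) ⟩
            + S ℤ.* ∑ N′ (λ i → [ S ∣ + (t₀ * i) ℤ.- D₀ ] ℤ.* 1ℤ)
              ≡⟨ S*soluble {D₀} {D′} {proj₁ sol} D≡ (proj₂ (proj₂ sol)) {λ _ → 1ℤ} (λ _ → ≡.refl) ⟩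
            + l ℤ.* ∑ N′ (λ _ → 1ℤ)
              ≡⟨ cong (+ l ℤ.*_) (∑-const N′ 1ℤ) ⟩
            + l ℤ.* (+ N′ ℤ.* 1ℤ)
              ≡⟨ lemma (+ l) (+ N′) ⟩
            + N′ ℤ.* (+ l ℤ.* 1ℤ)
              ≡⟨ cong (λ v → + N′ ℤ.* (+ l ℤ.* v)) (⟦⟧-yes (+ l S.∣? D₀) l∣D) ⟨
            + N′ ℤ.* (+ l ℤ.* [ l ∣ D₀ ]) ∎
            where
            sol = solve-congruence τ⊥u D′
            lemma : ∀ l N → l ℤ.* (N ℤ.* 1ℤ) ≡ N ℤ.* (l ℤ.* 1ℤ)
            lemma = solve-∀

        -- For b = 0 every θ(β i) equals P₁, so only the number of exceptional λ enters.
        fibre-zero : b ≈ 0# → + suc N′ ℤ.* (+ S ℤ.* Nb) ≡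
          + N ℤ.+ ((s ℤ.- 1ℤ) ℤ.* + N′ ℤ.- s ℤ.* (+ N′ ℤ.* (+ l ℤ.* [ l ∣ D₀ ])))
        fibre-zero b≈0 = ℤₚ.*-cancelˡ-≡ (+ P₁) _ _ (begin
          + P₁ ℤ.* (+ suc N′ ℤ.* (+ S ℤ.* Nb))
            ≡⟨ fourier ⟩
          + N ℤ.* + P₁ ℤ.+ ∑ N′ (λ i → coefficient i ℤ.* θ (β i))
            ≡⟨ cong (λ v → + N ℤ.* + P₁ ℤ.+ v) (∑-cong′ N′ (λ i → cong (coefficient i ℤ.*_) (θ-0 (β≈0 i)) ∙ one (coefficient i) (+ P₁))) ⟩
          + N ℤ.* + P₁ ℤ.+ ∑ N′ (λ i → + P₁ ℤ.* (coefficient i ℤ.* 1ℤ))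
            ≡⟨ cong (λ v → + N ℤ.* + P₁ ℤ.+ v) (≡.sym (*-distribˡ-∑ (+ P₁) N′ (λ i → coefficient i ℤ.* 1ℤ)) ∙
                 cong (+ P₁ ℤ.*_) (∑-coefficient (λ _ → 1ℤ))) ⟩
          + N ℤ.* + P₁ ℤ.+ + P₁ ℤ.* ((s ℤ.- 1ℤ) ℤ.* ∑ N′ (λ _ → 1ℤ) ℤ.- s ℤ.* (+ S ℤ.* ∑ N′ (λ i → [ S ∣ + (i₀ + t₀ * i) ℤ.- + κ ] ℤ.* 1ℤ)))
            ≡⟨ cong₂ (λ x y → + N ℤ.* + P₁ ℤ.+ + P₁ ℤ.* ((s ℤ.- 1ℤ) ℤ.* x ℤ.- s ℤ.* y)) (∑-const N′ 1ℤ) S*count ⟩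
          + N ℤ.* + P₁ ℤ.+ + P₁ ℤ.* ((s ℤ.- 1ℤ) ℤ.* (+ N′ ℤ.* 1ℤ) ℤ.- s ℤ.* (+ N′ ℤ.* (+ l ℤ.* [ l ∣ D₀ ])))
            ≡⟨ collect (+ N) (+ P₁) s (+ N′) (+ N′ ℤ.* (+ l ℤ.* [ l ∣ D₀ ])) ⟩
          + P₁ ℤ.* (+ N ℤ.+ ((s ℤ.- 1ℤ) ℤ.* + N′ ℤ.- s ℤ.* (+ N′ ℤ.* (+ l ℤ.* [ l ∣ D₀ ])))) ∎)
          where
          β≈0 : ∀ i → β i ≈ 0#
          β≈0 i = k.T-cong (*-congˡ b≈0 ⨾ zeroʳ _) ⨾ k.T-0
          one : ∀ c p → c ℤ.* p ≡ p ℤ.* (c ℤ.* 1ℤ)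
          one = solve-∀
          collect : ∀ N p s N′ y → N ℤ.* p ℤ.+ p ℤ.* ((s ℤ.- 1ℤ) ℤ.* (N′ ℤ.* 1ℤ) ℤ.- s ℤ.* y) ≡ p ℤ.* (N ℤ.+ ((s ℤ.- 1ℤ) ℤ.* N′ ℤ.- s ℤ.* y))
          collect = solve-∀

        module NonZero {e : ℕ} (g₀^e*b≈-1 : pow g₀ e ⊗ b ≈ ⊖ 1#) {D : ℤ}
          (D≡ : + S S.∣ (D ℤ.- (+ κ ℤ.- + i₀ ℤ.- + (t₀ * e)))) where

          θβ-periodic : Periodic N′ (λ i → θ (β i))
          θβ-periodic i = θ-cong (k.T-cong (*-congʳ (pow-congʳ g₀ (cong (i ℕ.+_) (≡.sym (ℕₚ.*-identityˡ N′))) ⨾ k.pow-shift i 1)))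

          -- `e` is the logarithm of -1/b to the base g₀. Replacing λ by -λ/b turns T(λ b) into
          -- -T(λ), and θ is even. Thus b leaves the summand and survives only as the shift t₀ e of
          -- the congruence.
          θβ-shift : ∀ i → θ (β (e + i)) ≡ k.f i
          θβ-shift i = θ-cong (k.T-cong eq ⨾ k.T-⊖ (pow g₀ i)) ∙ θ-⊖ _
            where
            eq : pow g₀ (e + i) ⊗ b ≈ ⊖ pow g₀ i
            eq = *-congʳ (pow-+ g₀ e i ⨾ *-comm _ _) ⨾ *-assoc _ _ _ ⨾
              *-congˡ g₀^e*b≈-1 ⨾ sym (-‿distribʳ-* _ 1#) ⨾ -‿cong (*-identityʳ _)

          ∑θβ : ∑ N′ (λ i → θ (β i)) ≡ ℤ.- + P₁
          ∑θβ = ≡.sym (∑-shift θβ-periodic e) ∙ ∑-cong′ N′ θβ-shift ∙ k.∑f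

          J : ℤ
          J = ∑ N′ (λ i → [ S ∣ + (t₀ * i) ℤ.- D ] ℤ.* k.f i)

          J-shift : ∑ N′ (λ i → [ S ∣ + (i₀ + t₀ * i) ℤ.- + κ ] ℤ.* θ (β i)) ≡ J
          J-shift = ≡.sym (∑-shift {N′} {h} h-periodic e) ∙ ∑-cong′ N′ (λ i → cong₂ ℤ._*_ (congruent i) (θβ-shift i))
            where
            h : ℕ → ℤ
            h i = [ S ∣ + (i₀ + t₀ * i) ℤ.- + κ ] ℤ.* θ (β i)
            h-periodic : Periodic N′ h
            h-periodic i = cong₂ ℤ._*_ ([∣]-cong S (subst (+ S S.∣_) (≡.sym eq) (S.∣n⇒∣m*n (+ t₀) S∣N′))) (θβ-periodic i)
              where
              S∣N′ : + S S.∣ + N′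
              S∣N′ = S.∣ᵤ⇒∣ (divides (k.W * (P₁ * R)) (k.N-multiple {S} {R} SR≡M))
              lemma : ∀ i₀ t i N k → (i₀ ℤ.+ t ℤ.* (i ℤ.+ N)) ℤ.- k ℤ.- ((i₀ ℤ.+ t ℤ.* i) ℤ.- k) ≡ t ℤ.* N
              lemma = solve-∀
              eq : + (i₀ + t₀ * (i + N′)) ℤ.- + κ ℤ.- (+ (i₀ + t₀ * i) ℤ.- + κ) ≡ + t₀ ℤ.* + N′
              eq = cong₂ (λ x y → x ℤ.- + κ ℤ.- (y ℤ.- + κ))
                (ℤₚ.pos-+ i₀ (t₀ * (i + N′)) ∙ cong (λ v → + i₀ ℤ.+ v) (ℤₚ.pos-* t₀ (i + N′) ∙ cong (+ t₀ ℤ.*_) (ℤₚ.pos-+ i N′)))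
                (ℤₚ.pos-+ i₀ (t₀ * i) ∙ cong (λ v → + i₀ ℤ.+ v) (ℤₚ.pos-* t₀ i)) ∙
                lemma (+ i₀) (+ t₀) (+ i) (+ N′) (+ κ)
            congruent : ∀ i → [ S ∣ + (i₀ + t₀ * (e + i)) ℤ.- + κ ] ≡ [ S ∣ + (t₀ * i) ℤ.- D ]
            congruent i = [∣]-cong S (subst (+ S S.∣_) (≡.sym eq) D≡)
              where
              lemma : ∀ i₀ x y k D → (i₀ ℤ.+ (x ℤ.+ y)) ℤ.- k ℤ.- (y ℤ.- D) ≡ D ℤ.- (k ℤ.- i₀ ℤ.- x)
              lemma = solve-∀
              eq : + (i₀ + t₀ * (e + i)) ℤ.- + κ ℤ.- (+ (t₀ * i) ℤ.- D) ≡ D ℤ.- (+ κ ℤ.- + i₀ ℤ.- + (t₀ * e))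
              eq = cong (λ x → x ℤ.- + κ ℤ.- (+ (t₀ * i) ℤ.- D))
                (ℤₚ.pos-+ i₀ (t₀ * (e + i)) ∙ cong (λ v → + i₀ ℤ.+ v)
                  (cong +_ (ℕₚ.*-distribˡ-+ t₀ e i) ∙ ℤₚ.pos-+ (t₀ * e) (t₀ * i))) ∙
                lemma (+ i₀) (+ (t₀ * e)) (+ (t₀ * i)) (+ κ) D

          fibre-J : + P₁ ℤ.* (+ suc N′ ℤ.* (+ S ℤ.* Nb)) ≡ + N ℤ.* + P₁ ℤ.+ ((s ℤ.- 1ℤ) ℤ.* (ℤ.- + P₁) ℤ.- s ℤ.* (+ S ℤ.* J))
          fibre-J = fourier ∙ cong (λ v → + N ℤ.* + P₁ ℤ.+ v) (∑-coefficient (λ i → θ (β i)) ∙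
            cong₂ (λ x y → (s ℤ.- 1ℤ) ℤ.* x ℤ.- s ℤ.* (+ S ℤ.* y)) ∑θβ J-shift)

          fibre-insoluble : ¬ (+ l S.∣ D) → + suc N′ ℤ.* (+ S ℤ.* Nb) ≡ + N ℤ.- (s ℤ.- 1ℤ)
          fibre-insoluble l∤D = ℤₚ.*-cancelˡ-≡ (+ P₁) _ _ (fibre-J ∙ cong (λ v → + N ℤ.* + P₁ ℤ.+ ((s ℤ.- 1ℤ) ℤ.* (ℤ.- + P₁) ℤ.- s ℤ.* (+ S ℤ.* v)))
              (∑-zero N′ (λ i _ → cong (ℤ._* k.f i) (insoluble l∤D i) ∙ ℤₚ.*-zeroˡ (k.f i))) ∙
            lemma (+ N) (+ P₁) s (+ S))
            where
            lemma : ∀ N p s S → N ℤ.* p ℤ.+ ((s ℤ.- 1ℤ) ℤ.* (ℤ.- p) ℤ.- s ℤ.* (S ℤ.* 0ℤ)) ≡ p ℤ.* (N ℤ.- (s ℤ.- 1ℤ))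
            lemma = solve-∀

          -- `J` is supported on the exponents i ≡ j₀ modulo u, so S J is l times a period of 𝔽_q.
          -- Since u (l R) = P + 1, the evaluation applies to it with u in place of S, which is
          -- where s′ and κ′ come from.
          fibre-soluble : ∀ {D′ j₀} → D ≡ D′ ℤ.* + l → + u S.∣ (+ (τ * j₀) ℤ.- D′) →
            + suc N′ ℤ.* (+ S ℤ.* Nb) ≡
            + N ℤ.- (s ℤ.- 1ℤ) ℤ.- s ℤ.* (+ l ℤ.* (s′ ℤ.* (1ℤ ℤ.- + u ℤ.* [ u ∣ + j₀ ℤ.- + κ′ ]) ℤ.- 1ℤ))
          fibre-soluble {D′} {j₀} D≡D′l u∣ = ℤₚ.*-cancelˡ-≡ (+ P₁) _ _ (fibre-J ∙ cong (λ v → + N ℤ.* + P₁ ℤ.+ ((s ℤ.- 1ℤ) ℤ.* (ℤ.- + P₁) ℤ.- s ℤ.* v))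
              (S*soluble {D} {D′} {j₀} D≡D′l u∣ {k.f} k.f-periodic ∙ cong (+ l ℤ.*_) (k.semiprimitive {u} {l * R} ulR≡M j₀)) ∙
            lemma (+ N) (+ P₁) s (+ l) _)
            where
            lemma : ∀ N p s l y → N ℤ.* p ℤ.+ ((s ℤ.- 1ℤ) ℤ.* (ℤ.- p) ℤ.- s ℤ.* (l ℤ.* (p ℤ.* y))) ≡ p ℤ.* (N ℤ.- (s ℤ.- 1ℤ) ℤ.- s ℤ.* (l ℤ.* y))
            lemma = solve-∀

    suc-P∣N′ : suc (suc P₁) ∣ N′
    suc-P∣N′ = divides (k.W * P₁) (k.N≡ ∙ ≡.sym (ℕₚ.*-assoc k.W P₁ (suc P)))

    0<t₀ : 0 < t₀
    0<t₀ = ℕ.>-nonZero⁻¹ t₀ {{ℕₚ.m*n≢0⇒m≢0 t₀ {N′} {{subst ℕ.NonZero N≡t₀N′ L.N-nonZero}}}}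

    -- Trace and norm conditions as conditions on exponents

    module Norms {p k : ℕ} {γ : Carrier} (p-prime : Prime p) (ιp≈0 : ι p ≈ 0#) (0<k : 0 < k)
      (Q≡ : suc N ≡ suc N′ ^ t) (t₀≡ : t₀ ≡ repunit (suc N′) t)
      (0<c₀ : 0 < repunit (suc N) k) (γ^c₀≈δ : pow γ (repunit (suc N) k) ≈ δ) where

      private
        c₀ : ℕ
        c₀ = repunit (suc N) k

      -- If k vanished in the field along with p, a Bézout relation between the two would give 1 =
      -- 0.
      ιk≉0 : ¬ (p ∣ k) → ¬ (ι k ≈ 0#)
      ιk≉0 p∤k ιk≈0 = go (coprime-Bézout coprime)
        where
        coprime : Coprime k p
        coprime (i∣k , i∣p) with prime⇒irreducible p-prime i∣p
        ... | inj₁ i≡1 = i≡1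
        ... | inj₂ ≡.refl = ⊥-elim (p∤k i∣k)
        multiple : ∀ x {y} → ι y ≈ 0# → ι (x * y) ≈ 0#
        multiple x {y} ιy≈0 = ι-* x y ⨾ *-congˡ ιy≈0 ⨾ zeroʳ _
        clash : ∀ x y → ι x ≈ 0# → ι y ≈ 0# → ¬ 1 + x ≡ y
        clash x y ιx≈0 ιy≈0 eq = 0≉1 (sym (sym (+-congˡ ιx≈0 ⨾ +-identityʳ 1#) ⨾ reflexive (cong ι eq) ⨾ ιy≈0))
        go : Bézout.Identity 1 k p → ⊥
        go (Bézout.+- x y eq) = clash (y * p) (x * k) (multiple y ιp≈0) (multiple x ιk≈0) eq
        go (Bézout.-+ x y eq) = clash (x * k) (y * p) (multiple x ιk≈0) (multiple y ιp≈0) eq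

      ι-mem : ∀ x → k.Mem (ι x)
      ι-mem zero    = k.mem-0
      ι-mem (suc x) = k.mem-⊕ (pow-1# (suc N′)) (ι-mem x)

      -- On 𝔽_{q^t} the conjugates x^(q^i) repeat with period t, so the sum over k t of them runs k
      -- times through the trace to 𝔽_q.
      Tr≈ : ∀ {x} → L.Mem x → Tr (suc N′) (k * t) x ≈ ι k ⊗ trace x
      Tr≈ {x} mx = reflexive (sumTo≡∑ (k * t) _) ⨾
        ∑ᴷ.∑-periodic (frobenius-periodic (suc N′) t (pow-congʳ x (≡.sym Q≡) ⨾ mx)) k ⨾ ∑ᴷ-const k (trace x)

      prodTo-pow : ∀ m (f : ℕ → ℕ) (r : ℕ → ℕ) x → r 0 ≡ 0 → (∀ i → r (suc i) ≡ r i + f i) → prodTo m (λ i → pow x (f i)) ≈ pow x (r m)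
      prodTo-pow zero    f r x r₀ r+ = pow-congʳ x (≡.sym r₀)
      prodTo-pow (suc m) f r x r₀ r+ = *-congʳ (prodTo-pow m f r x r₀ r+) ⨾ sym (pow-+ x (r m) (f m)) ⨾ pow-congʳ x (≡.sym (r+ m))

      Nm≈ : ∀ x → Nm (suc N′) (k * t) x ≈ pow (pow x c₀) t₀
      Nm≈ x = prodTo-pow (k * t) (suc N′ ^_) (repunit (suc N′)) x ≡.refl (λ _ → ≡.refl) ⨾
        pow-congʳ x (repunit-product (suc N′) t k ∙ cong₂ (λ Q r → repunit Q k * r) (≡.sym Q≡) (≡.sym t₀≡)) ⨾ pow-* x c₀ t₀

      NmRel≈ : NmRel (suc N′) t k γ ≈ δ
      NmRel≈ = prodTo-pow k (λ i → suc N′ ^ (t * i)) (repunit (suc N)) γ ≡.refl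
        (λ i → cong (repunit (suc N) i ℕ.+_) (cong (_^ i) Q≡ ∙ ℕₚ.^-*-assoc (suc N′) t i)) ⨾ γ^c₀≈δ

      -- Every power of Q in the exponent acts trivially on 𝔽_{q^t}. Hence the norm from K to
      -- 𝔽_{q^t} is there the k-th power, the source of the factor m/t in the congruence for i₀.
      pow-repunit : ∀ i {x} → L.Mem x → pow x (repunit (suc N) i) ≈ pow x i
      pow-repunit zero    mx = refl
      pow-repunit (suc i) {x} mx = pow-+ x (repunit (suc N) i) (suc N ^ i) ⨾
        *-cong (pow-repunit i mx) (pow-fixed (suc N) mx i) ⨾ *-comm _ x

      Nm-δ : ∀ i → Nm (suc N′) (k * t) (pow δ i) ≈ pow (pow δ t₀) (k * i)
      Nm-δ i = Nm≈ (pow δ i) ⨾ pow-cong t₀ (pow-repunit k (L.mem-gen i) ⨾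
        sym (pow-* δ i k) ⨾ pow-congʳ δ (ℕₚ.*-comm i k)) ⨾ pow-comm δ (k * i) t₀

      module Count {s S d h k₁ h₁ R′ R : ℕ} (s≡dS : s ≡ d * S) (k≡dk₁ : k ≡ d * k₁) (h≡dh₁ : h ≡ d * h₁)
        (k₁⊥S : Coprime k₁ S) (sR′≡M : s * R′ ≡ suc P) (SR≡M : S * R ≡ suc P)
        {a b : Carrier} (p∤k : ¬ (p ∣ k)) (ιkb≈a : ι k ⊗ b ≈ a) (mb : k.Mem b)
        {i₀ : ℕ} (i₀-solves : + S S.∣ (+ (k₁ * i₀) ℤ.- + h₁))
        where

        private
          q : ℕ
          q = suc N′
          g₁ : Carrier
          g₁ = Nm q (k * t) γ
          instance
            d≢0 : ℕ.NonZero d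
            d≢0 = ℕₚ.m*n≢0⇒m≢0 d {{subst ℕ.NonZero k≡dk₁ (ℕ.>-nonZero 0<k)}}
            N′≢0 : ℕ.NonZero N′
            N′≢0 = ℕ.>-nonZero k.0<N

        g₁≈g₀ : g₁ ≈ pow δ t₀
        g₁≈g₀ = Nm≈ γ ⨾ pow-cong t₀ γ^c₀≈δ

        V : Carrier → Set ℓ
        V x = pow x (q ^ t) ≈ x × (Tr q (k * t) x ≈ a × InCoset q g₁ h s (Nm q (k * t) x))

        V-resp : ∀ {x y} → x ≈ y → V x → V y
        V-resp {x} {y} eq (mx , trx , i , cx) =
          pow-cong (q ^ t) (sym eq) ⨾ mx ⨾ eq ,
          reflexive (sumTo≡∑ (k * t) _) ⨾ ∑ᴷ.∑-cong′ (k * t) (λ i → pow-cong (q ^ i) (sym eq)) ⨾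
            reflexive (≡.sym (sumTo≡∑ (k * t) _)) ⨾ trx ,
          i , Nm≈ y ⨾ pow-cong t₀ (pow-cong c₀ (sym eq)) ⨾ sym (Nm≈ x) ⨾ cx

        V-mem : ∀ {x} → V x → L.Mem x
        V-mem {x} (mx , _) = pow-congʳ x Q≡ ⨾ mx

        ¬V0 : ¬ V 0#
        ¬V0 (_ , _ , i , c0) = pow-≉0 (h + s * toℕ i) (λ g≈0 → pow-≉0 t₀ L.δ≉0 (sym g₁≈g₀ ⨾ g≈0))
          (sym c0 ⨾ Nm≈ 0# ⨾ pow-cong t₀ (pow-0# c₀ 0<c₀) ⨾ pow-0# t₀ 0<t₀)

        s∣N′ : + s S.∣ + N′
        s∣N′ = S.∣ᵤ⇒∣ (divides (k.W * (P₁ * R′)) (k.N-multiple {s} {R′} sR′≡M))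

        -- Exponents of the generator of 𝔽_q* are determined modulo N′ only, but s divides P + 1 and
        -- thereby N′.
        coset⇒ : ∀ i → InCoset q g₁ h s (Nm q (k * t) (pow δ i)) → + s S.∣ (+ (k * i) ℤ.- + h)
        coset⇒ i (l , eq) = subst (+ s S.∣_) final
          (S.∣m∣n⇒∣m+n (S.∣-trans s∣N′ (k.≈⇒∣ (k * i) (h + s * toℕ l)
            (sym (Nm-δ i) ⨾ eq ⨾ pow-cong (h + s * toℕ l) g₁≈g₀))) (S.∣ᵤ⇒∣ {+ s} {+ (s * toℕ l)} (m∣m*n (toℕ l))))
          where
          lemma : ∀ x h y → x ℤ.- (h ℤ.+ y) ℤ.+ y ≡ x ℤ.- h
          lemma = solve-∀
          final : + (k * i) ℤ.- + (h + s * toℕ l) ℤ.+ + (s * toℕ l) ≡ + (k * i) ℤ.- + h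
          final = cong (λ v → + (k * i) ℤ.- v ℤ.+ + (s * toℕ l)) (ℤₚ.pos-+ h (s * toℕ l)) ∙ lemma (+ (k * i)) (+ h) (+ (s * toℕ l))

        ⇒coset : ∀ i → + s S.∣ (+ (k * i) ℤ.- + h) → InCoset q g₁ h s (Nm q (k * t) (pow δ i))
        ⇒coset i (S.divides z eq) = fromℕ< r<N′ , Nm-δ i ⨾ k.∣⇒≈ (k * i) (h + s * toℕ (fromℕ< r<N′)) N′∣ ⨾
          pow-cong (h + s * toℕ (fromℕ< r<N′)) (sym g₁≈g₀)
          where
          -- The quotient z may be any integer; reduced modulo q - 1 it becomes an index of `Fin`
          -- and still gives the same power of g.
          r = z %ℕ N′
          w = z /ℕ N′
          r<N′ : r < N′
          r<N′ = n%ℕd<d z N′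
          lemma : ∀ x h s r w N → x ℤ.- h ≡ (r ℤ.+ w ℤ.* N) ℤ.* s → x ℤ.- (h ℤ.+ s ℤ.* r) ≡ (w ℤ.* s) ℤ.* N
          lemma x h s r w N eq = l₁ x h (s ℤ.* r) ∙ cong (ℤ._- s ℤ.* r) eq ∙ l₂ s r w N
            where
            l₁ : ∀ x h y → x ℤ.- (h ℤ.+ y) ≡ x ℤ.- h ℤ.- y
            l₁ = solve-∀
            l₂ : ∀ s r w N → (r ℤ.+ w ℤ.* N) ℤ.* s ℤ.- s ℤ.* r ≡ (w ℤ.* s) ℤ.* N
            l₂ = solve-∀
          N′∣ : + N′ S.∣ (+ (k * i) ℤ.- + (h + s * toℕ (fromℕ< r<N′)))
          N′∣ = S.divides (w ℤ.* + s) (cong (λ v → + (k * i) ℤ.- v) (cong (λ r → + (h + s * r)) (Finₚ.toℕ-fromℕ< r<N′) ∙ ℤₚ.pos-+ h (s * r) ∙ cong (λ v → + h ℤ.+ v) (ℤₚ.pos-* s r)) ∙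
            lemma (+ (k * i)) (+ h) (+ s) (+ r) w (+ N′) (eq ∙ cong (ℤ._* + s) (a≡a%ℕn+[a/ℕn]*n z N′)))

        private
          factor : ∀ i → + (k * i) ℤ.- + h ≡ + d ℤ.* (+ (k₁ * i) ℤ.- + h₁)
          factor i = cong₂ ℤ._-_ (cong (λ x → + (x * i)) k≡dk₁ ∙ cong +_ (ℕₚ.*-assoc d k₁ i) ∙ ℤₚ.pos-* d (k₁ * i))
            (cong +_ h≡dh₁ ∙ ℤₚ.pos-* d h₁) ∙ lemma (+ d) (+ (k₁ * i)) (+ h₁)
            where
            lemma : ∀ d x y → d ℤ.* x ℤ.- d ℤ.* y ≡ d ℤ.* (x ℤ.- y)
            lemma = solve-∀

          s≡ : + s ≡ + d ℤ.* + S
          s≡ = cong +_ s≡dS ∙ ℤₚ.pos-* d S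

          shift : ∀ i → + k₁ ℤ.* (+ i ℤ.- + i₀) ≡ (+ (k₁ * i) ℤ.- + h₁) ℤ.- (+ (k₁ * i₀) ℤ.- + h₁)
          shift i = lemma (+ k₁) (+ i) (+ i₀) (+ h₁) ∙ cong₂ (λ x y → (x ℤ.- + h₁) ℤ.- (y ℤ.- + h₁)) (≡.sym (ℤₚ.pos-* k₁ i)) (≡.sym (ℤₚ.pos-* k₁ i₀))
            where
            lemma : ∀ k i j h → k ℤ.* (i ℤ.- j) ≡ (k ℤ.* i ℤ.- h) ℤ.- (k ℤ.* j ℤ.- h)
            lemma = solve-∀

          unshift : ∀ i → + k₁ ℤ.* (+ i ℤ.- + i₀) ℤ.+ (+ (k₁ * i₀) ℤ.- + h₁) ≡ + (k₁ * i) ℤ.- + h₁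
          unshift i = cong (ℤ._+ (+ (k₁ * i₀) ℤ.- + h₁)) (shift i) ∙ lemma _ _
            where
            lemma : ∀ x y → x ℤ.- y ℤ.+ y ≡ x
            lemma = solve-∀

        -- Division by d leaves k₁ i ≡ h₁ modulo S, which i₀ also solves; k₁ is invertible modulo S
        -- and can be cancelled from the difference.
        residue⇒ : ∀ i → + s S.∣ (+ (k * i) ℤ.- + h) → + S S.∣ (+ i ℤ.- + i₀)
        residue⇒ i s∣ = coprime-cancel k₁⊥S _ (subst (+ S S.∣_) (≡.sym (shift i))
          (S.∣m∣n⇒∣m-n (S.*-cancelˡ-∣ (+ d) (subst₂ S._∣_ s≡ (factor i) s∣)) i₀-solves))

        ⇒residue : ∀ i → + S S.∣ (+ i ℤ.- + i₀) → + s S.∣ (+ (k * i) ℤ.- + h)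
        ⇒residue i S∣ = subst₂ S._∣_ (≡.sym s≡) (≡.sym (factor i)) (S.*-monoʳ-∣ (+ d)
          (subst (+ S S.∣_) (unshift i) (S.∣m∣n⇒∣m+n (S.∣n⇒∣m*n (+ k₁) S∣) i₀-solves)))

        count≡Nb : + Ncount q (k * t) t h s a γ ≡ Fibre.Nb {S} {R} SR≡M i₀ mb
        count≡Nb = count-units L.ext (λ x → (pow x (q ^ t) ≟ x) ×-dec ((Tr q (k * t) x ≟ a) ×-dec inCoset? q g₁ h s (Nm q (k * t) x))) V-resp V-mem ¬V0 ∙
          ∑-cong′ N (λ i → ⟦⟧-cong _ ((+ S S.∣? (+ i ℤ.- + i₀)) ×-dec (trace (pow δ i) ≟ b))
              (λ { (mx , trx , cx) → residue⇒ i (coset⇒ i cx) , ⊗-cancelˡ (ι k) (ιk≉0 p∤k) (sym (Tr≈ (L.mem-gen i)) ⨾ trx ⨾ sym ιkb≈a) })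
              (λ { (S∣ , tr≈b) → pow-congʳ (pow δ i) (≡.sym Q≡) ⨾ L.mem-gen i , Tr≈ (L.mem-gen i) ⨾ *-congˡ tr≈b ⨾ ιkb≈a , ⇒coset i (⇒residue i S∣) }) ∙
            ⟦×⟧ (+ S S.∣? (+ i ℤ.- + i₀)) (trace (pow δ i) ≟ b))

      module Formulas {m S d h k₁ h₁ R′ R l u τ : ℕ} (m≡dS : m ≡ d * S) (k≡dk₁ : k ≡ d * k₁) (h≡dh₁ : h ≡ d * h₁)
        (k₁⊥S : Coprime k₁ S) (mR′≡M : m * R′ ≡ suc (suc P₁)) (SR≡M : S * R ≡ suc (suc P₁))
        (S≡lu : S ≡ l * u) (t₀≡lτ : t₀ ≡ l * τ) (τ⊥u : Coprime τ u)
        {a : Carrier} (p∤k : ¬ (p ∣ k)) (ma : pow a (suc N′) ≈ a) where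

        private
          Nt : ℕ
          Nt = Ncount (suc N′) (k * t) t h m a γ

          ιk⁻¹ : ∃ λ x → ι k ⊗ x ≈ 1#
          ιk⁻¹ = inverse (ι k) (ιk≉0 p∤k)

          b : Carrier
          b = a ⊗ proj₁ ιk⁻¹

          ιkb≈a : ι k ⊗ b ≈ a
          ιkb≈a = sym (*-assoc _ _ _) ⨾ *-congʳ (*-comm _ a) ⨾ *-assoc _ _ _ ⨾
            *-congˡ (proj₂ ιk⁻¹) ⨾ *-identityʳ a

          mb : k.Mem b
          mb = k.mem-⊗ ma (k.mem-inv (proj₂ ιk⁻¹) (ι-mem k))

          scaled : ∀ {i₀} → + S S.∣ (+ (k₁ * i₀) ℤ.- + h₁) → ∀ {E} →
            + suc N′ ℤ.* (+ S ℤ.* Fibre.Nb {S} {R} SR≡M i₀ mb) ≡ E → + suc N′ ℤ.* (+ S ℤ.* + Nt) ≡ E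
          scaled {i₀} i₀-solves = ≡.trans (cong (λ v → + suc N′ ℤ.* (+ S ℤ.* v))
            (Count.count≡Nb {m} {S} {d} {h} {k₁} {h₁} {R′} {R} m≡dS k≡dk₁ h≡dh₁ k₁⊥S mR′≡M SR≡M p∤k ιkb≈a mb i₀-solves))

        formula-zero : ∀ {i₀} → + S S.∣ (+ (k₁ * i₀) ℤ.- + h₁) → a ≈ 0# →
          + suc N′ ℤ.* (+ S ℤ.* + Nt) ≡ + N ℤ.+ ((s ℤ.- 1ℤ) ℤ.* + N′ ℤ.-
            s ℤ.* (+ N′ ℤ.* (+ l ℤ.* [ l ∣ + κ ℤ.- + i₀ ])))
        formula-zero {i₀} i₀-solves a≈0 = scaled i₀-solves
          (Fibre.Congruence.fibre-zero {S} {R} SR≡M i₀ mb {l} {τ} {u} S≡lu t₀≡lτ τ⊥u (*-congʳ a≈0 ⨾ zeroˡ _))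

        private
          module Unit {a⁻¹ : Carrier} (aa⁻¹≈1 : a ⊗ a⁻¹ ≈ 1#) where

            -- The element a₀ of the theorem. As b = a/k, it equals -1/b.
            y : Carrier
            y = ⊖ (ι k ⊗ a⁻¹)

            y-log : ∃ λ i → pow (pow δ t₀) i ≈ y
            y-log = k.log y (k.mem-⊖ (k.mem-⊗ (ι-mem k) (k.mem-inv aa⁻¹≈1 ma))) y≉0
              where
              y≉0 : ¬ (y ≈ 0#)
              y≉0 y≈0 = ⊗-≉0 (ιk≉0 p∤k) (unit-≉0 (*-comm _ _ ⨾ aa⁻¹≈1))
                (sym (⊖-involutive _) ⨾ -‿cong y≈0 ⨾ ⊖0≈0)

            i₁ : ℕ
            i₁ = proj₁ y-log

            y*b≈-1 : pow (pow δ t₀) i₁ ⊗ b ≈ ⊖ 1#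
            y*b≈-1 = *-congʳ (proj₂ y-log) ⨾ sym (-‿distribˡ-* _ b) ⨾ -‿cong
              (*-congʳ (*-comm _ _) ⨾ *-assoc _ _ _ ⨾ *-congˡ ιkb≈a ⨾ *-comm _ _ ⨾ aa⁻¹≈1)

            S∣N : + S S.∣ + N
            S∣N = S.∣ᵤ⇒∣ (subst (S ∣_) (≡.sym N≡t₀N′) (∣-trans (∣-trans (subst (S ∣_) SR≡M (m∣m*n R)) suc-P∣N′) (n∣m*n t₀)))

            -- Both `ind` and t₀ i₁ are logarithms of a₀ to the base δ, the first by assumption and
            -- the second through g₀ = δ^(t₀). They agree modulo N, hence modulo S.
            D-shift : ∀ {i₀ ind D} → pow (NmRel (suc N′) t k γ) ind ≈ y →
              + S S.∣ (D ℤ.- (+ κ ℤ.- + i₀ ℤ.- + ind)) → + S S.∣ (D ℤ.- (+ κ ℤ.- + i₀ ℤ.- + (t₀ * i₁)))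
            D-shift {i₀} {ind} {D} eq S∣D = subst (+ S S.∣_) (lemma D (+ κ) (+ i₀) (+ ind) (+ (t₀ * i₁)))
              (S.∣m∣n⇒∣m-n S∣D (S.∣-trans S∣N (L.≈⇒∣ ind (t₀ * i₁) (pow-cong ind (sym NmRel≈) ⨾
                eq ⨾ sym (proj₂ y-log) ⨾ sym (pow-* δ t₀ i₁)))))
              where
              lemma : ∀ D κ i x z → (D ℤ.- (κ ℤ.- i ℤ.- x)) ℤ.- (x ℤ.- z) ≡ D ℤ.- (κ ℤ.- i ℤ.- z)
              lemma = solve-∀

        formula-insoluble : ∀ {i₀} → + S S.∣ (+ (k₁ * i₀) ℤ.- + h₁) → ∀ {a⁻¹} → a ⊗ a⁻¹ ≈ 1# →
          ∀ {ind} → pow (NmRel (suc N′) t k γ) ind ≈ ⊖ (ι k ⊗ a⁻¹) →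
          ∀ {D} → + S S.∣ (D ℤ.- (+ κ ℤ.- + i₀ ℤ.- + ind)) →
          ¬ (+ l S.∣ D) → + suc N′ ℤ.* (+ S ℤ.* + Nt) ≡ + N ℤ.- (s ℤ.- 1ℤ)
        formula-insoluble {i₀} i₀-solves aa⁻¹≈1 {ind} ind≡ {D} S∣D l∤D = scaled i₀-solves
          (Fibre.Congruence.NonZero.fibre-insoluble {S} {R} SR≡M i₀ mb {l} {τ} {u} S≡lu t₀≡lτ τ⊥u
            {Unit.i₁ aa⁻¹≈1} (Unit.y*b≈-1 aa⁻¹≈1) {D} (Unit.D-shift aa⁻¹≈1 {i₀} {ind} {D} ind≡ S∣D) l∤D)

        formula-soluble : ∀ {i₀} → + S S.∣ (+ (k₁ * i₀) ℤ.- + h₁) → ∀ {a⁻¹} → a ⊗ a⁻¹ ≈ 1# →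
          ∀ {ind} → pow (NmRel (suc N′) t k γ) ind ≈ ⊖ (ι k ⊗ a⁻¹) →
          ∀ {D} → + S S.∣ (D ℤ.- (+ κ ℤ.- + i₀ ℤ.- + ind)) →
          ∀ {D′ j₀} → D ≡ D′ ℤ.* + l → + u S.∣ (+ (τ * j₀) ℤ.- D′) → + suc N′ ℤ.* (+ S ℤ.* + Nt) ≡
          + N ℤ.- (s ℤ.- 1ℤ) ℤ.- s ℤ.*
            (+ l ℤ.* (s′ ℤ.* (1ℤ ℤ.- + u ℤ.* [ u ∣ + j₀ ℤ.- + κ′ ]) ℤ.- 1ℤ))
        formula-soluble {i₀} i₀-solves aa⁻¹≈1 {ind} ind≡ {D} S∣D {D′} {j₀} D≡ u∣ = scaled i₀-solves
          (Fibre.Congruence.NonZero.fibre-soluble {S} {R} SR≡M i₀ mb {l} {τ} {u} S≡lu t₀≡lτ τ⊥u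
            {Unit.i₁ aa⁻¹≈1} (Unit.y*b≈-1 aa⁻¹≈1) {D} (Unit.D-shift aa⁻¹≈1 {i₀} {ind} {D} ind≡ S∣D) {D′} {j₀} D≡ u∣)

        ind-exists : ∀ {a⁻¹} → a ⊗ a⁻¹ ≈ 1# → ∃ λ ind → pow (NmRel (suc N′) t k γ) ind ≈ ⊖ (ι k ⊗ a⁻¹)
        ind-exists aa⁻¹≈1 = t₀ * Unit.i₁ aa⁻¹≈1 , pow-cong (t₀ * Unit.i₁ aa⁻¹≈1) NmRel≈ ⨾
          pow-* δ t₀ (Unit.i₁ aa⁻¹≈1) ⨾ proj₂ (Unit.y-log aa⁻¹≈1)

  -- The field with P^(2w) elements is semiprimitive: logarithms of -1

  module _ {p e : ℕ} (p-prime : Prime p) (ιp≈0 : ι p ≈ 0#) (P≡p^e : suc P₁ ≡ p ^ e) where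

    private
      M≡ : p ^ e + 1 ≡ suc P
      M≡ = ℕₚ.+-comm (p ^ e) 1 ∙ cong suc (≡.sym P≡p^e)

    module _ {N : ℕ} {δ : Carrier} (ext : Subfield N δ) (w : ℕ) (P^2w≡ : P ^ (2 * w) ≡ suc N) where
      private
        module E = Subfield ext
        W : ℕ
        W = repunit (P * P) w

        P²≡ : P * P ≡ suc (P₁ * suc P)
        P²≡ = eq P₁
          where
          eq : ∀ x → suc x * suc x ≡ suc (x * suc (suc x))
          eq = ℕS.solve-∀

        N≡W : N ≡ W * (P₁ * suc P)
        N≡W = ℕₚ.suc-injective (≡.sym P^2w≡ ∙ ≡.sym (ℕₚ.^-*-assoc P 2 w) ∙
          cong (_^ w) (cong (P *_) (ℕₚ.*-identityʳ P) ∙ P²≡) ∙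
            ≡.sym (repunit-* (P₁ * suc P) w) ∙ cong (λ x → suc (repunit x w * (P₁ * suc P))) (≡.sym P²≡))

        MinusOne : Set ℓ
        MinusOne = ∃ λ ν → pow δ ν ≈ ⊖ 1# × + (P₁ * suc P) S.∣ (+ ν ℤ.- + (P₁ * κ (isOdd p) (p ^ e + 1) w))

        -- In characteristic 2, -1 = 1, so ν = 0 serves, and κ is 0 as well.
        even-case : ∀ v → p ≡ v * 2 → isOdd p ≡ false → MinusOne
        even-case v p≡ p-even rewrite p-even = 0 , sym (⊖-unique (+-congˡ (sym (+-identityʳ 1#)) ⨾ ι2≈0)) ,
          S.divides 0ℤ (cong (λ x → + 0 ℤ.- + x) (ℕₚ.*-zeroʳ P₁) ∙ ≡.sym (ℤₚ.*-zeroˡ (+ (P₁ * suc P))))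
          where
          ⊖-unique : 1# ⊕ 1# ≈ 0# → ⊖ 1# ≈ 1#
          ⊖-unique eq = sym (⊖-uniqueʳ 1# 1# eq)
          ι2≈0 : ι 2 ≈ 0#
          ι2≈0 with prime⇒irreducible p-prime (divides v p≡)
          ... | inj₂ ≡.refl = ιp≈0

        -- δ^(N/2) is the square root of 1 other than 1.
        odd-case : ∀ v → p ≡ suc (v * 2) → isOdd p ≡ true → MinusOne
        odd-case v p≡ p-odd = ν , δ^ν≈-1 , ν≡κ (parity w)
          where
          h : ℕ
          h = proj₁ (odd-^ v e)
          P₁≡ : P₁ ≡ h * 2
          P₁≡ = ℕₚ.suc-injective (P≡p^e ∙ cong (_^ e) p≡ ∙ proj₂ (odd-^ v e))
          ν : ℕ
          ν = W * (h * suc P)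
          ν*2≡N : ν * 2 ≡ N
          ν*2≡N = eq W h (suc P) ∙ cong (λ x → W * (x * suc P)) (≡.sym P₁≡) ∙ ≡.sym N≡W
            where
            eq : ∀ W h M → W * (h * M) * 2 ≡ W * (h * 2 * M)
            eq = ℕS.solve-∀
          x : Carrier
          x = pow δ ν
          x≉1 : ¬ (x ≈ 1#)
          x≉1 x≈1 with ν in ν≡ | E.order ν x≈1
          ... | zero  | _  = ℕₚ.<-irrefl (cong (_* 2) (≡.sym ν≡) ∙ ν*2≡N) E.0<N
          ... | suc y | N∣ = ℕₚ.<⇒≱ (ℕₚ.m<m*n (suc y) 2 (s≤s (s≤s z≤n)))
            (subst (_≤ suc y) (≡.sym ν*2≡N ∙ cong (_* 2) ν≡) (∣⇒≤ N∣))
          x²≈1 : x ⊗ x ≈ 1#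
          x²≈1 = *-congˡ (sym (*-identityʳ x)) ⨾ sym (pow-* δ ν 2) ⨾ pow-congʳ δ ν*2≡N ⨾ E.pow-N
          δ^ν≈-1 : x ≈ ⊖ 1#
          δ^ν≈-1 with x ⊕ 1# ≟ 0#
          ... | yes x+1≈0 = ⊖-uniqueˡ x 1# x+1≈0
          ... | no  x+1≉0 = ⊥-elim (x≉1 (⊗-cancelˡ _ x+1≉0 (*-comm _ x ⨾ distribˡ x x 1# ⨾
              +-cong x²≈1 (*-identityʳ x) ⨾ +-comm 1# x ⨾ sym (*-identityʳ _))))
          -- W = 1 + P² + ... is w modulo P² - 1, so ν = W hM is w hM modulo 2 hM = P² - 1, and only
          -- the parity of w matters. For odd w the residue is hM = P₁ (P+1)/2.
          W-parity : ∃ λ z → W ≡ w + z * (P₁ * suc P)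
          W-parity = subst (λ q → ∃ λ z → repunit q w ≡ w + z * (P₁ * suc P)) (≡.sym P²≡) (repunit-mod (P₁ * suc P) w)
          hM : ℕ
          hM = h * suc P
          N₂ : P₁ * suc P ≡ hM * 2
          N₂ = cong (_* suc P) P₁≡ ∙ eq h (suc P)
            where
            eq : ∀ h M → h * 2 * M ≡ h * M * 2
            eq = ℕS.solve-∀
          ν≡κ : Parity w → + (P₁ * suc P) S.∣ (+ ν ℤ.- + (P₁ * κ (isOdd p) (p ^ e + 1) w))
          ν≡κ (even w-even y w≡) rewrite p-odd | w-even = S.divides (+ (y + z * hM))
            (cong₂ (λ a b → + a ℤ.- + b) ν≡ (ℕₚ.*-zeroʳ P₁) ∙
              ℤₚ.+-identityʳ _ ∙ ℤₚ.pos-* (y + z * hM) (P₁ * suc P))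
            where
            z = proj₁ W-parity
            eq : ∀ y z hM → (y * 2 + z * (hM * 2)) * hM ≡ (y + z * hM) * (hM * 2)
            eq = ℕS.solve-∀
            ν≡ : ν ≡ (y + z * hM) * (P₁ * suc P)
            ν≡ = cong (_* hM) (proj₂ W-parity ∙ cong₂ (λ a b → a + z * b) w≡ N₂) ∙
              eq y z hM ∙ cong ((y + z * hM) *_) (≡.sym N₂)
          ν≡κ (odd w-odd y w≡) rewrite p-odd | w-odd = S.divides (+ (y + z * hM))
            (cong₂ (λ a b → + a ℤ.- + b) ν≡ P₁κ≡ ∙
              cong (ℤ._- + hM) (ℤₚ.pos-+ ((y + z * hM) * (P₁ * suc P)) hM ∙ cong (ℤ._+ + hM) (ℤₚ.pos-* (y + z * hM) (P₁ * suc P))) ∙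
                lemma _ (+ hM))
            where
            z = proj₁ W-parity
            lemma : ∀ a b → a ℤ.+ b ℤ.- b ≡ a
            lemma = solve-∀
            eq : ∀ y z hM → (suc (y * 2) + z * (hM * 2)) * hM ≡ (y + z * hM) * (hM * 2) + hM
            eq = ℕS.solve-∀
            ν≡ : ν ≡ (y + z * hM) * (P₁ * suc P) + hM
            ν≡ = cong (_* hM) (proj₂ W-parity ∙ cong₂ (λ a b → a + z * b) w≡ N₂) ∙
              eq y z hM ∙ cong (λ b → (y + z * hM) * b + hM) (≡.sym N₂)
            M/2 : (p ^ e + 1) div 2 ≡ suc h
            M/2 = cong (_div 2) (M≡ ∙ cong (λ x → suc (suc x)) P₁≡) ∙ div-* (suc h) 2
            eq′ : ∀ h → h * 2 * suc h ≡ h * suc (suc (h * 2))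
            eq′ = ℕS.solve-∀
            P₁κ≡ : P₁ * (p ^ e + 1) div 2 ≡ hM
            P₁κ≡ = cong₂ _*_ P₁≡ M/2 ∙ eq′ h ∙ cong (λ x → h * suc (suc x)) (≡.sym P₁≡)

        minusOne : MinusOne
        minusOne with parity p
        ... | even p-even v p≡ = even-case v p≡ p-even
        ... | odd  p-odd  v p≡ = odd-case v p≡ p-odd

      semiprimitiveField : 0 < w → SemiprimitiveField (2 * w) N δ (κ (isOdd p) (p ^ e + 1) w) (σ P w)
      semiprimitiveField 0<w = record
        { 0<j    = ℕₚ.≤-trans 0<w (ℕₚ.m≤m+n w _)
        ; P^j≡   = P^2w≡
        ; ext    = ext
        ; W      = W
        ; N≡     = N≡W
        ; ν      = proj₁ minusOne
        ; δ^ν≈-1 = proj₁ (proj₂ minusOne)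
        ; ν≡κ    = proj₂ (proj₂ minusOne)
        ; s²≡Q   = σ² P w ∙ cong +_ P^2w≡
        ; s≡1    = σ≡1 P w
        }

-- The tower 𝔽_P ⊂ 𝔽_q ⊂ 𝔽_{q^t} ⊂ K

module Tower {c ℓ : Level} (K : FiniteField c ℓ)
  {p e n k t P₁ N′ N : ℕ} (p-prime : Prime p) (0<e : 0 < e) (0<n : 0 < n) (0<k : 0 < k) (0<t : 0 < t)
  (P≡ : suc P₁ ≡ p ^ e) (q≡ : suc N′ ≡ p ^ (2 * e * n)) (Q≡ : suc N ≡ suc N′ ^ t)
  (size≡ : FF.card K ≡ suc N′ ^ (k * t)) {γ : FF.F K} (prim : FF.Primitive K γ)
  where

  open Subfields K

  1<p : 1 < p
  1<p = ℕ.nonTrivial⇒n>1 p {{prime⇒nonTrivial p-prime}}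

  instance
    p≢0 : ℕ.NonZero p
    p≢0 = ℕ.>-nonZero (ℕₚ.<-trans (s≤s z≤n) 1<p)

  P^2n≡q : suc P₁ ^ (2 * n) ≡ suc N′
  P^2n≡q = cong (_^ (2 * n)) P≡ ∙ ℕₚ.^-*-assoc p e (2 * n) ∙
    cong (p ^_) (eq e n) ∙ ≡.sym q≡
    where
    eq : ∀ e n → e * (2 * n) ≡ 2 * e * n
    eq = ℕS.solve-∀

  P^2nt≡Q : suc P₁ ^ (2 * (n * t)) ≡ suc N
  P^2nt≡Q = cong (suc P₁ ^_) (≡.sym (ℕₚ.*-assoc 2 n t)) ∙ ≡.sym (ℕₚ.^-*-assoc (suc P₁) (2 * n) t) ∙
    cong (_^ t) P^2n≡q ∙ ≡.sym Q≡

  1<P : 1 < suc P₁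
  1<P = subst (1 <_) (≡.sym P≡) (ℕₚ.^-monoʳ-< p 1<p {0} {e} 0<e)

  0<P₁ : 0 < P₁
  0<P₁ = ℕₚ.≤-pred 1<P

  2<q : 2 < suc N′
  2<q = ℕₚ.<-≤-trans (ℕₚ.<-≤-trans (s≤s (s≤s (s≤s (z≤n {1})))) (ℕₚ.*-mono-≤ 1<P 1<P)) (subst (_≤ suc N′) (cong (suc P₁ *_) (ℕₚ.*-identityʳ (suc P₁)))
    (subst (suc P₁ ^ 2 ≤_) P^2n≡q (ℕₚ.^-monoʳ-≤ (suc P₁) (ℕₚ.*-mono-≤ {2} ℕₚ.≤-refl 0<n))))

  0<N′ : 0 < N′
  0<N′ = ℕₚ.≤-pred (ℕₚ.<-trans (s≤s (s≤s z≤n)) 2<q)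

  -- The exponents of the norms from K to 𝔽_{q^t} and from 𝔽_{q^t} to 𝔽_q; thus δ = γ^(c₀) is the
  -- γ_t of the theorem.
  c₀ t₀ : ℕ
  c₀ = repunit (suc N) k
  t₀ = repunit (suc N′) t

  N≡t₀N′ : N ≡ t₀ * N′
  N≡t₀N′ = ℕₚ.suc-injective (Q≡ ∙ ≡.sym (repunit-* N′ t))

  size≡1+ : size ≡ suc (c₀ * N)
  size≡1+ = size≡ ∙ cong (suc N′ ^_) (ℕₚ.*-comm k t) ∙ ≡.sym (ℕₚ.^-*-assoc (suc N′) t k) ∙
    cong (_^ k) (≡.sym Q≡) ∙ ≡.sym (repunit-* N k)

  2<size : 2 < size
  2<size = ℕₚ.<-≤-trans 2<q (subst₂ _≤_ (ℕₚ.*-identityʳ (suc N′)) (≡.sym size≡)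
    (ℕₚ.^-monoʳ-≤ (suc N′) (ℕₚ.*-mono-≤ 0<k 0<t)))

  γ-order : HasOrder γ (c₀ * N)
  γ-order = primitive-order prim 2<size size≡1+

  private
    instance
      c₀N≢0 : ℕ.NonZero (c₀ * N)
      c₀N≢0 = HasOrder.N-nonZero γ-order
      c₀≢0 : ℕ.NonZero c₀
      c₀≢0 = ℕₚ.m*n≢0⇒m≢0 c₀
      N≢0 : ℕ.NonZero N
      N≢0 = ℕₚ.m*n≢0⇒n≢0 c₀
      t₀N′≢0 : ℕ.NonZero (t₀ * N′)
      t₀N′≢0 = subst ℕ.NonZero N≡t₀N′ N≢0
      t₀≢0 : ℕ.NonZero t₀
      t₀≢0 = ℕₚ.m*n≢0⇒m≢0 t₀

  ιp≈0 : ι p ≈ 0#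
  ιp≈0 = characteristic p (2 * e * n * (k * t)) (size≡ ∙ cong (_^ (k * t)) q≡ ∙ ℕₚ.^-*-assoc p (2 * e * n) (k * t))

  open Frobenius p-prime ιp≈0 using (frobenius-^-⊕)

  frobenius-P : FrobeniusAdditive (suc P₁)
  frobenius-P i x y = pow-congʳ _ eq ⨾ frobenius-^-⊕ (e * i) x y ⨾
    sym (+-cong (pow-congʳ x eq) (pow-congʳ y eq))
    where
    eq : suc P₁ ^ i ≡ p ^ (e * i)
    eq = cong (_^ i) P≡ ∙ ℕₚ.^-*-assoc p e i

  ιP≈0 : ι (suc P₁) ≈ 0#
  ιP≈0 = reflexive (cong ι P≡) ⨾ ι-^ p e ⨾ pow-cong e ιp≈0 ⨾ pow-0# e 0<e

  additive-P^ : ∀ {M} i → suc P₁ ^ i ≡ suc M → ∀ x y → pow (x ⊕ y) (suc M) ≈ pow x (suc M) ⊕ pow y (suc M)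
  additive-P^ i eq x y = pow-congʳ _ (≡.sym eq) ⨾ frobenius-P i x y ⨾ +-cong (pow-congʳ x eq) (pow-congʳ y eq)

  private
    c₁ : ℕ
    c₁ = repunit (suc P₁) (2 * (n * t) * k)

    c₀N≡c₁P₁ : c₀ * N ≡ c₁ * P₁
    c₀N≡c₁P₁ = ℕₚ.suc-injective (repunit-* N k ∙ cong (_^ k) (≡.sym P^2nt≡Q) ∙
      ℕₚ.^-*-assoc (suc P₁) (2 * (n * t)) k ∙ ≡.sym (repunit-* P₁ (2 * (n * t) * k)))

    instance
      c₁≢0 : ℕ.NonZero c₁
      c₁≢0 = ℕₚ.m*n≢0⇒m≢0 c₁ {{subst ℕ.NonZero c₀N≡c₁P₁ c₀N≢0}}

  base : Subfield P₁ (pow γ c₁)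
  base = subfield {γ} {P₁} {c₁} (subst (HasOrder γ) c₀N≡c₁P₁ γ-order) 0<P₁ (λ x _ → prim x) (additive-P^ 1 (ℕₚ.*-identityʳ (suc P₁)))

  δ : Carrier
  δ = pow γ c₀

  bigExt : Subfield N δ
  bigExt = subfield {γ} {N} {c₀} γ-order (ℕ.>-nonZero⁻¹ N) (λ x _ → prim x) (additive-P^ (2 * (n * t)) P^2nt≡Q)

  smallExt : Subfield N′ (pow δ t₀)
  smallExt = subfield {δ} {N′} {t₀} (subst (HasOrder δ) N≡t₀N′ (Subfield.hasOrder bigExt)) 0<N′
    (λ x mx → Subfield.log bigExt x (pow-congʳ x Q≡ ⨾ pow-fixed (suc N′) mx t)) (additive-P^ (2 * n) P^2n≡q)

  private
    degrees : ∀ n t → 2 * (n * t) ≡ t * (2 * n)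
    degrees = ℕS.solve-∀

    big : Traces.SemiprimitiveField K P₁ frobenius-P ιP≈0 base (2 * (n * t)) N δ (κ (isOdd p) (p ^ e + 1) (n * t)) (σ (suc P₁) (n * t))
    big = Traces.semiprimitiveField K P₁ frobenius-P ιP≈0 base {p} {e} p-prime ιp≈0 P≡ bigExt (n * t) P^2nt≡Q (ℕₚ.*-mono-≤ 0<n 0<t)

    small : Traces.SemiprimitiveField K P₁ frobenius-P ιP≈0 base (2 * n) N′ (pow δ t₀) (κ (isOdd p) (p ^ e + 1) n) (σ (suc P₁) n)
    small = Traces.semiprimitiveField K P₁ frobenius-P ιP≈0 base {p} {e} p-prime ιp≈0 P≡ smallExt n P^2n≡q 0<n

  suc-P∣N′ : suc (suc P₁) ∣ N′
  suc-P∣N′ = Traces.Relative.suc-P∣N′ K P₁ frobenius-P ιP≈0 base {t₀ = t₀} {t = t} big small N≡t₀N′ (degrees n t)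

  module Norms = Traces.Relative.Norms K P₁ frobenius-P ιP≈0 base {t₀ = t₀} {t = t}
    big small N≡t₀N′ (degrees n t) {p} {k} {γ} p-prime ιp≈0 0<k Q≡ ≡.refl (ℕ.>-nonZero⁻¹ c₀) refl

-- The rational closed forms

ℚ-ring : AlmostCommutativeRing 0ℓ 0ℓ
ℚ-ring = fromCommutativeRing ℚₚ.+-*-commutativeRing (λ x → dec⇒maybe (0ℚ ℚₚ.≟ x))

opaque
  fromℤ : ℤ → ℚ
  fromℤ z = z ℚ./ 1

  toℚᵘ-fromℤ : ∀ z → toℚᵘ (fromℤ z) ℚᵘ.≃ mkℚᵘ z 0
  toℚᵘ-fromℤ z = ℚₚ.toℚᵘ-fromℚᵘ (mkℚᵘ z 0)

  fromℤ-+ : ∀ x y → fromℤ (x ℤ.+ y) ≡ fromℤ x ℚ.+ fromℤ y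
  fromℤ-+ x y = ℚₚ.toℚᵘ-injective (ℚᵘₚ.≃-trans (toℚᵘ-fromℤ (x ℤ.+ y)) (ℚᵘₚ.≃-trans (*≡* (lemma x y))
    (ℚᵘₚ.≃-sym (ℚᵘₚ.≃-trans (ℚₚ.toℚᵘ-homo-+ (fromℤ x) (fromℤ y)) (ℚᵘₚ.+-cong (toℚᵘ-fromℤ x) (toℚᵘ-fromℤ y))))))
    where
    lemma : ∀ x y → (x ℤ.+ y) ℤ.* 1ℤ ≡ (x ℤ.* 1ℤ ℤ.+ y ℤ.* 1ℤ) ℤ.* 1ℤ
    lemma = solve-∀

  fromℤ-* : ∀ x y → fromℤ (x ℤ.* y) ≡ fromℤ x ℚ.* fromℤ y
  fromℤ-* x y = ℚₚ.toℚᵘ-injective (ℚᵘₚ.≃-trans (toℚᵘ-fromℤ (x ℤ.* y))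
    (ℚᵘₚ.≃-sym (ℚᵘₚ.≃-trans (ℚₚ.toℚᵘ-homo-* (fromℤ x) (fromℤ y)) (ℚᵘₚ.*-cong (toℚᵘ-fromℤ x) (toℚᵘ-fromℤ y)))))

  fromℤ-neg : ∀ x → fromℤ (ℤ.- x) ≡ ℚ.- fromℤ x
  fromℤ-neg x = ℚₚ.toℚᵘ-injective (ℚᵘₚ.≃-trans (toℚᵘ-fromℤ (ℤ.- x))
    (ℚᵘₚ.≃-sym (ℚᵘₚ.≃-trans (ℚₚ.toℚᵘ-homo‿- (fromℤ x)) (ℚᵘₚ.-‿cong (toℚᵘ-fromℤ x)))))

  fromℤ-0 : fromℤ 0ℤ ≡ 0ℚ
  fromℤ-0 = ≡.refl

  fromℤ-1 : fromℤ 1ℤ ≡ 1ℚ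
  fromℤ-1 = ≡.refl

  ℕtoℚ≡fromℤ : ∀ x → ℕtoℚ x ≡ fromℤ (+ x)
  ℕtoℚ≡fromℤ x = ≡.refl

fromℤ-- : ∀ x y → fromℤ (x ℤ.- y) ≡ fromℤ x ℚ.- fromℤ y
fromℤ-- x y = fromℤ-+ x (ℤ.- y) ∙ cong (fromℤ x ℚ.+_) (fromℤ-neg y)

ℕtoℚ-* : ∀ x y → ℕtoℚ (x * y) ≡ ℕtoℚ x ℚ.* ℕtoℚ y
ℕtoℚ-* x y = ℕtoℚ≡fromℤ (x * y) ∙ cong fromℤ (ℤₚ.pos-* x y) ∙
  fromℤ-* (+ x) (+ y) ∙ cong₂ ℚ._*_ (≡.sym (ℕtoℚ≡fromℤ x)) (≡.sym (ℕtoℚ≡fromℤ y))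

ℕtoℚ-suc : ∀ x → ℕtoℚ (suc x) ≡ 1ℚ ℚ.+ ℕtoℚ x
ℕtoℚ-suc x = ℕtoℚ≡fromℤ (suc x) ∙ fromℤ-+ 1ℤ (+ x) ∙
  cong₂ ℚ._+_ fromℤ-1 (≡.sym (ℕtoℚ≡fromℤ x))

/ℚ-inverse : ∀ x n .{{_ : ℕ.NonZero n}} → (x /ℚ n) ℚ.* ℕtoℚ n ≡ x
/ℚ-inverse x (suc n) = ℚₚ.*-assoc x _ _ ∙ cong (x ℚ.*_) unit ∙ ℚₚ.*-identityʳ x
  where
  lemma : ∀ n → (1ℤ ℤ.* n) ℤ.* 1ℤ ≡ 1ℤ ℤ.* (n ℤ.* 1ℤ)
  lemma = solve-∀
  unit : (+ 1 ℚ./ suc n) ℚ.* ℕtoℚ (suc n) ≡ 1ℚ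
  unit = ℚₚ.toℚᵘ-injective (ℚᵘₚ.≃-trans (ℚₚ.toℚᵘ-homo-* (+ 1 ℚ./ suc n) (ℕtoℚ (suc n)))
    (ℚᵘₚ.≃-trans (ℚᵘₚ.*-cong (ℚₚ.toℚᵘ-fromℚᵘ (mkℚᵘ (+ 1) n)) (ℚₚ.toℚᵘ-fromℚᵘ (mkℚᵘ (+ suc n) 0)))
      (*≡* (lemma (+ suc n) ∙ cong (1ℤ ℤ.*_) (≡.sym (ℤₚ.pos-* (suc n) 1))))))

ℕtoℚ-cancel : ∀ n .{{_ : ℕ.NonZero n}} {x y} → x ℚ.* ℕtoℚ n ≡ y ℚ.* ℕtoℚ n → x ≡ y
ℕtoℚ-cancel n {x} {y} eq = ≡.sym (undo x) ∙ cong (ℚ._* (1ℚ /ℚ n)) eq ∙ undo y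
  where
  undo : ∀ z → z ℚ.* ℕtoℚ n ℚ.* (1ℚ /ℚ n) ≡ z
  undo z = ℚₚ.*-assoc z _ _ ∙ cong (z ℚ.*_) (ℚₚ.*-comm (ℕtoℚ n) _ ∙ /ℚ-inverse 1ℚ n) ∙ ℚₚ.*-identityʳ z

sgn-suc : ∀ w → sgn (suc w) ≡ ℚ.- sgn w
sgn-suc w rewrite isOdd-suc w with isOdd w
... | true  = ≡.refl
... | false = ≡.refl

fromℤ-σ : ∀ P w → fromℤ (σ P w) ≡ sgn w ℚ.* ℕtoℚ (P ^ w)
fromℤ-σ P zero    = fromℤ-1
fromℤ-σ P (suc w) = fromℤ-* (ℤ.- + P) (σ P w) ∙ cong₂ ℚ._*_ (fromℤ-neg (+ P) ∙ cong ℚ.-_ (≡.sym (ℕtoℚ≡fromℤ P))) (fromℤ-σ P w) ∙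
  lemma (ℕtoℚ P) (sgn w) (ℕtoℚ (P ^ w)) ∙
    cong₂ ℚ._*_ (≡.sym (sgn-suc w)) (≡.sym (ℕtoℚ-* P (P ^ w)))
  where
  lemma : ∀ p s x → (ℚ.- p) ℚ.* (s ℚ.* x) ≡ (ℚ.- s) ℚ.* (p ℚ.* x)
  lemma = solve-∀-in ℚ-ring

fromℤ-zero : ∀ N s N′ l v {N° s° N′° l° v°} →
  fromℤ N ≡ N° → fromℤ s ≡ s° → fromℤ N′ ≡ N′° → fromℤ l ≡ l° → fromℤ v ≡ v° →
  fromℤ (N ℤ.+ ((s ℤ.- 1ℤ) ℤ.* N′ ℤ.- s ℤ.* (N′ ℤ.* (l ℤ.* v)))) ≡
  N° ℚ.+ ((s° ℚ.- 1ℚ) ℚ.* N′° ℚ.- s° ℚ.* (N′° ℚ.* (l° ℚ.* v°)))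
fromℤ-zero N s N′ l v ≡.refl ≡.refl ≡.refl ≡.refl ≡.refl
  rewrite fromℤ-+ N ((s ℤ.- 1ℤ) ℤ.* N′ ℤ.- s ℤ.* (N′ ℤ.* (l ℤ.* v)))
        | fromℤ-- ((s ℤ.- 1ℤ) ℤ.* N′) (s ℤ.* (N′ ℤ.* (l ℤ.* v)))
        | fromℤ-* (s ℤ.- 1ℤ) N′ | fromℤ-- s 1ℤ | fromℤ-1
        | fromℤ-* s (N′ ℤ.* (l ℤ.* v)) | fromℤ-* N′ (l ℤ.* v) | fromℤ-* l v = ≡.refl

fromℤ-insoluble : ∀ N s {N° s°} → fromℤ N ≡ N° → fromℤ s ≡ s° →
  fromℤ (N ℤ.- (s ℤ.- 1ℤ)) ≡ N° ℚ.- (s° ℚ.- 1ℚ)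
fromℤ-insoluble N s ≡.refl ≡.refl rewrite fromℤ-- N (s ℤ.- 1ℤ) | fromℤ-- s 1ℤ | fromℤ-1 = ≡.refl

fromℤ-soluble : ∀ N s l s′ u v {N° s° l° s′° u° v°} →
  fromℤ N ≡ N° → fromℤ s ≡ s° → fromℤ l ≡ l° → fromℤ s′ ≡ s′° → fromℤ u ≡ u° → fromℤ v ≡ v° →
  fromℤ (N ℤ.- (s ℤ.- 1ℤ) ℤ.- s ℤ.* (l ℤ.* (s′ ℤ.* (1ℤ ℤ.- u ℤ.* v) ℤ.- 1ℤ))) ≡
  N° ℚ.- (s° ℚ.- 1ℚ) ℚ.- s° ℚ.* (l° ℚ.* (s′° ℚ.* (1ℚ ℚ.- u° ℚ.* v°) ℚ.- 1ℚ))
fromℤ-soluble N s l s′ u v ≡.refl ≡.refl ≡.refl ≡.refl ≡.refl ≡.refl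
  rewrite fromℤ-- (N ℤ.- (s ℤ.- 1ℤ)) (s ℤ.* (l ℤ.* (s′ ℤ.* (1ℤ ℤ.- u ℤ.* v) ℤ.- 1ℤ)))
        | fromℤ-insoluble N s ≡.refl ≡.refl
        | fromℤ-* s (l ℤ.* (s′ ℤ.* (1ℤ ℤ.- u ℤ.* v) ℤ.- 1ℤ))
        | fromℤ-* l (s′ ℤ.* (1ℤ ℤ.- u ℤ.* v) ℤ.- 1ℤ)
        | fromℤ-- (s′ ℤ.* (1ℤ ℤ.- u ℤ.* v)) 1ℤ
        | fromℤ-* s′ (1ℤ ℤ.- u ℤ.* v) | fromℤ-- 1ℤ (u ℤ.* v) | fromℤ-1 | fromℤ-* u v = ≡.refl

signed : ∀ {x y} → x ∣ℤ y → x S.∣ y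
signed (w , eq) = S.divides w eq

unsigned : ∀ {x y} → x S.∣ y → x ∣ℤ y
unsigned (S.divides w eq) = w , eq

collapse-zero : ∀ Q₁ ε N′ R {l} → l ≡ 1 → Q₁ ℚ.- 1ℚ ℚ.- ε ℚ.* N′ ℚ.* ℕtoℚ (l ∸ 1) ℚ.* R ≡ Q₁ ℚ.- 1ℚ
collapse-zero Q₁ ε N′ R ≡.refl = lemma Q₁ ε N′ R (ℕtoℚ 0) (ℕtoℚ≡fromℤ 0 ∙ fromℤ-0)
  where
  lemma₀ : ∀ Q₁ ε N′ R → Q₁ ℚ.- 1ℚ ℚ.- ε ℚ.* N′ ℚ.* 0ℚ ℚ.* R ≡ Q₁ ℚ.- 1ℚ
  lemma₀ = solve-∀-in ℚ-ring
  lemma : ∀ Q₁ ε N′ R z → z ≡ 0ℚ → Q₁ ℚ.- 1ℚ ℚ.- ε ℚ.* N′ ℚ.* z ℚ.* R ≡ Q₁ ℚ.- 1ℚ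
  lemma Q₁ ε N′ R z ≡.refl = lemma₀ Q₁ ε N′ R

collapse-unit : ∀ Q₁ ε σ √q R {l u} → l ≡ 1 → u ≡ 1 →
  Q₁ ℚ.- ε ℚ.* ((σ ℚ.* ℕtoℚ (u ∸ 1) ℚ.* √q ℚ.- 1ℚ) ℚ.* ℕtoℚ l ℚ.+ 1ℚ) ℚ.* R ≡ Q₁
collapse-unit Q₁ ε σ √q R ≡.refl ≡.refl = lemma Q₁ ε σ √q R (ℕtoℚ 0) (ℕtoℚ 1)
  (ℕtoℚ≡fromℤ 0 ∙ fromℤ-0) (ℕtoℚ≡fromℤ 1 ∙ fromℤ-1)
  where
  lemma₀ : ∀ Q₁ ε σ √q R → Q₁ ℚ.- ε ℚ.* ((σ ℚ.* 0ℚ ℚ.* √q ℚ.- 1ℚ) ℚ.* 1ℚ ℚ.+ 1ℚ) ℚ.* R ≡ Q₁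
  lemma₀ = solve-∀-in ℚ-ring
  lemma : ∀ Q₁ ε σ √q R y z → y ≡ 0ℚ → z ≡ 1ℚ → Q₁ ℚ.- ε ℚ.* ((σ ℚ.* y ℚ.* √q ℚ.- 1ℚ) ℚ.* z ℚ.+ 1ℚ) ℚ.* R ≡ Q₁
  lemma Q₁ ε σ √q R y z ≡.refl ≡.refl = lemma₀ Q₁ ε σ √q R

-- The parameters of the theorem and its formulas over ℚ

module Assembly {c ℓ : Level} (K : FiniteField c ℓ)
  (p e n k t s h : ℕ) (a γ : FF.F K)
  (p-prime : Prime p) (0<e : 1 ≤ e) (0<n : 1 ≤ n) (1<s : 1 < s) (s∣M : s ∣ (p ^ e + 1))
  (2≤m : 2 ≤ k * t) (p∤k : ¬ (p ∣ k)) (d∣h : gcd k s ∣ h)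
  (card≡ : FF.card K ≡ (p ^ (2 * e * n)) ^ (k * t)) (ma : FF._≈F_ K (FF.pow K a (p ^ (2 * e * n))) a) (prim : FF.Primitive K γ)
  where

  open Subfields K

  q N′ N P₁ d S k₁ h₁ l u τ : ℕ
  q  = p ^ (2 * e * n)
  N′ = q ∸ 1
  N  = q ^ t ∸ 1
  P₁ = p ^ e ∸ 1
  d  = gcd k s
  S  = s div d
  k₁ = k div d
  h₁ = h div d
  l  = gcd t S
  u  = s div (d * l)
  τ  = (N div N′) div l

  private
    0<m : 0 < k * t
    0<m = ℕₚ.<-trans (s≤s z≤n) 2≤m

    0<k : 0 < k
    0<k = ℕ.>-nonZero⁻¹ k {{ℕₚ.m*n≢0⇒m≢0 k {t} {{ℕ.>-nonZero 0<m}}}}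

    0<t : 0 < t
    0<t = ℕ.>-nonZero⁻¹ t {{ℕₚ.m*n≢0⇒n≢0 k {t} {{ℕ.>-nonZero 0<m}}}}

    instance
      p≢0 : ℕ.NonZero p
      p≢0 = ℕ.>-nonZero (ℕₚ.<-trans (s≤s z≤n) (ℕ.nonTrivial⇒n>1 p {{prime⇒nonTrivial p-prime}}))
      q≢0 : ℕ.NonZero q
      q≢0 = ℕₚ.m^n≢0 p (2 * e * n)
      Q≢0 : ℕ.NonZero (q ^ t)
      Q≢0 = ℕₚ.m^n≢0 q t
      p^e≢0 : ℕ.NonZero (p ^ e)
      p^e≢0 = ℕₚ.m^n≢0 p e
      s≢0 : ℕ.NonZero s
      s≢0 = ℕ.>-nonZero (ℕₚ.<-trans (s≤s z≤n) 1<s)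

    q≡ : suc N′ ≡ q
    q≡ = ℕₚ.m+[n∸m]≡n (ℕ.>-nonZero⁻¹ q)

    Q≡q^t : suc N ≡ q ^ t
    Q≡q^t = ℕₚ.m+[n∸m]≡n (ℕ.>-nonZero⁻¹ (q ^ t))

    Q≡ : suc N ≡ suc N′ ^ t
    Q≡ = Q≡q^t ∙ cong (_^ t) (≡.sym q≡)

    size≡ : size ≡ suc N′ ^ (k * t)
    size≡ = card≡ ∙ cong (_^ (k * t)) (≡.sym q≡)

    P≡ : suc P₁ ≡ p ^ e
    P≡ = ℕₚ.m+[n∸m]≡n (ℕ.>-nonZero⁻¹ (p ^ e))

    t₀ κᴸ κᵏ : ℕ
    t₀ = repunit (suc N′) t
    κᴸ = κ (isOdd p) (p ^ e + 1) (n * t)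
    κᵏ = κ (isOdd p) (p ^ e + 1) n

    instance
      d≢0 : ℕ.NonZero d
      d≢0 = ℕ.≢-nonZero (gcd[m,n]≢0 k s (inj₂ (ℕ.≢-nonZero⁻¹ s)))
      N′≢0 : ℕ.NonZero N′
      N′≢0 = ℕ.>-nonZero (Tower.0<N′ K {p} {e} {n} {k} {t} {P₁} {N′} {N} p-prime 0<e 0<n 0<k 0<t P≡ q≡ Q≡ size≡ {γ} prim)

    s≡dS : s ≡ d * S
    s≡dS = div-exact (gcd[m,n]∣n k s)

    k≡dk₁ : k ≡ d * k₁
    k≡dk₁ = div-exact (gcd[m,n]∣m k s)

    h≡dh₁ : h ≡ d * h₁
    h≡dh₁ = div-exact d∣h

    k₁⊥S : Coprime k₁ S
    k₁⊥S = coprime-quotients k≡dk₁ s≡dS gcd-greatest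

    instance
      S≢0 : ℕ.NonZero S
      S≢0 = ℕₚ.m*n≢0⇒n≢0 d {{subst ℕ.NonZero s≡dS s≢0}}

    R′ R : ℕ
    R′ = _∣_.quotient s∣M
    R  = d * R′

    sR′≡M₀ : s * R′ ≡ p ^ e + 1
    sR′≡M₀ = ℕₚ.*-comm s R′ ∙ ≡.sym (_∣_.equality s∣M)

    SR≡M₀ : S * R ≡ p ^ e + 1
    SR≡M₀ = eq S d R′ ∙ cong (_* R′) (≡.sym s≡dS) ∙ sR′≡M₀
      where
      eq : ∀ S d R → S * (d * R) ≡ d * S * R
      eq = ℕS.solve-∀

    M₀≡M : p ^ e + 1 ≡ suc (suc P₁)
    M₀≡M = ℕₚ.+-comm (p ^ e) 1 ∙ cong suc (≡.sym P≡)

    SR≡M : S * R ≡ suc (suc P₁)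
    SR≡M = SR≡M₀ ∙ M₀≡M

    S∣N′ : S ∣ N′
    S∣N′ = ∣-trans (subst (S ∣_) SR≡M (m∣m*n R)) (Tower.suc-P∣N′ K {p} {e} {n} {k} {t} {P₁} {N′} {N} p-prime 0<e 0<n 0<k 0<t P≡ q≡ Q≡ size≡ {γ} prim)

    N≡t₀N′ : N ≡ t₀ * N′
    N≡t₀N′ = ℕₚ.suc-injective (Q≡ ∙ ≡.sym (repunit-* N′ t))

    -- S divides P + 1, which divides q - 1, so t₀ ≡ t modulo S. Hence l = gcd(t, S) is also the gcd
    -- of t₀ and S, as the solution of t₀ i ≡ D modulo S requires.
    t₀-mod : t₀ ≡ t + proj₁ (repunit-mod N′ t) * N′
    t₀-mod = proj₂ (repunit-mod N′ t)

    multiple : ∀ {i} → i ∣ S → i ∣ proj₁ (repunit-mod N′ t) * N′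
    multiple i∣S = ∣-trans i∣S (∣-trans S∣N′ (n∣m*n (proj₁ (repunit-mod N′ t))))

    l∣t₀ : l ∣ t₀
    l∣t₀ = subst (l ∣_) (≡.sym t₀-mod) (∣m∣n⇒∣m+n (gcd[m,n]∣m t S) (multiple (gcd[m,n]∣n t S)))

    S≡l* : S ≡ l * S div l
    instance
      l≢0 : ℕ.NonZero l
      l≢0 = ℕ.≢-nonZero (gcd[m,n]≢0 t S (inj₂ (ℕ.≢-nonZero⁻¹ S)))
    S≡l* = div-exact (gcd[m,n]∣n t S)

    u≡ : u ≡ S div l
    u≡ = cong (_div (d * l)) (s≡dS ∙ cong (d *_) S≡l* ∙ eq d l (S div l)) ∙
      div-* (S div l) (d * l) {{ℕₚ.m*n≢0 d l}}
      where
      eq : ∀ d l u → d * (l * u) ≡ u * (d * l)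
      eq = ℕS.solve-∀

    S≡lu : S ≡ l * u
    S≡lu = S≡l* ∙ cong (l *_) (≡.sym u≡)

    instance
      u≢0 : ℕ.NonZero u
      u≢0 = ℕₚ.m*n≢0⇒n≢0 l {{subst ℕ.NonZero S≡lu S≢0}}

    t₀≡lτ : t₀ ≡ l * τ
    t₀≡lτ = div-exact l∣t₀ ∙ cong (λ x → l * x div l)
      (≡.sym (cong (_div N′) N≡t₀N′ ∙ div-* t₀ N′))

    τ⊥u : Coprime τ u
    τ⊥u = coprime-quotients t₀≡lτ S≡lu (λ i∣t₀ i∣S → gcd-greatest
      (∣m+n∣m⇒∣n (subst (_ ∣_) (t₀-mod ∙ ℕₚ.+-comm t _) i∣t₀) (multiple i∣S)) i∣S)

    κᴸ-mod : ∀ {x y} → x * y ≡ p ^ e + 1 → + x S.∣ (+ κᴸ ℤ.- + kN p e n x t)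
    κᴸ-mod eq = kN≡κ p e n _ t eq (odd⇒even+1 e)

    κᵏ-mod : + u S.∣ (+ κᵏ ℤ.- + kN p e n u 1)
    κᵏ-mod = subst (λ w → + u S.∣ (+ κ (isOdd p) (p ^ e + 1) w ℤ.- + kN p e n u 1)) (ℕₚ.*-identityʳ n)
      (kN≡κ p e n u 1 {l * R} (eq u l R ∙ cong (_* R) (≡.sym S≡lu) ∙ SR≡M₀) (odd⇒even+1 e))
      where
      eq : ∀ u l R → u * (l * R) ≡ l * u * R
      eq = ℕS.solve-∀

    module F = Tower.Norms.Formulas K {p} {e} {n} {k} {t} {P₁} {N′} {N} p-prime 0<e 0<n 0<k 0<t P≡ q≡ Q≡ size≡ {γ} prim
      {s} {S} {d} {h} {k₁} {h₁} {R′} {R} {l} {u} {τ} s≡dS k≡dk₁ h≡dh₁ k₁⊥S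
      (sR′≡M₀ ∙ M₀≡M) SR≡M S≡lu t₀≡lτ τ⊥u {a} p∤k (pow-congʳ a q≡ ⨾ ma)

  Nt : ℕ
  Nt = Ncount q (k * t) t h s a γ

  R₀ √q ds Q₁ ε : ℚ
  R₀ = sqrtQPow p e n t
  √q = ℕtoℚ (p ^ (e * n))
  ds = ℕtoℚ d /ℚ s
  Q₁ = ℕtoℚ (q ^ (t ∸ 1))
  ε  = sgn (n * t)

  ds*S : ds ℚ.* ℕtoℚ S ≡ 1ℚ
  ds*S = ℕtoℚ-cancel d (ℚₚ.*-assoc ds _ _ ∙ cong (ds ℚ.*_) (≡.sym (ℕtoℚ-* S d) ∙ cong ℕtoℚ (ℕₚ.*-comm S d ∙ ≡.sym s≡dS)) ∙
    /ℚ-inverse (ℕtoℚ d) s ∙ ≡.sym (ℚₚ.*-identityˡ (ℕtoℚ d)))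

  q₁ : ℚ
  q₁ = 1ℚ ℚ.+ ℕtoℚ N′

  q-ℚ : ℕtoℚ q ≡ q₁
  q-ℚ = cong ℕtoℚ (≡.sym q≡) ∙ ℕtoℚ-suc N′

  N-ℚ : fromℤ (+ N) ≡ q₁ ℚ.* Q₁ ℚ.- 1ℚ
  N-ℚ = ≡.sym (ℕtoℚ≡fromℤ N) ∙ lemma (ℕtoℚ N) ∙ cong (ℚ._- 1ℚ) (≡.sym (ℕtoℚ-suc N) ∙ cong ℕtoℚ (Q≡q^t ∙ cong (q ^_) (≡.sym (ℕₚ.m+[n∸m]≡n 0<t))) ∙
    ℕtoℚ-* q (q ^ (t ∸ 1)) ∙ cong (ℚ._* Q₁) q-ℚ)
    where
    lemma : ∀ x → x ≡ (1ℚ ℚ.+ x) ℚ.- 1ℚ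
    lemma = solve-∀-in ℚ-ring

  -- (-P)^(nt) is ε p^(ent), and p^(ent) = R₀ q holds even for t = 1, where R₀ is a proper fraction.
  -- The factor q exposed here cancels the one that Fourier inversion leaves on the other side.
  σᴸ-ℚ : fromℤ (σ (suc P₁) (n * t)) ≡ ε ℚ.* (R₀ ℚ.* q₁)
  σᴸ-ℚ = fromℤ-σ (suc P₁) (n * t) ∙ cong (ε ℚ.*_) (cong ℕtoℚ (cong (_^ (n * t)) P≡ ∙ ℕₚ.^-*-assoc p e (n * t) ∙ cong (p ^_) (≡.sym (ℕₚ.*-assoc e n t))) ∙
    ≡.sym (/ℚ-inverse (ℕtoℚ (p ^ (e * n * t))) q) ∙ cong (R₀ ℚ.*_) q-ℚ)

  σᵏ-ℚ : fromℤ (σ (suc P₁) n) ≡ sgn n ℚ.* √q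
  σᵏ-ℚ = fromℤ-σ (suc P₁) n ∙ cong (λ x → sgn n ℚ.* ℕtoℚ x) (cong (_^ n) P≡ ∙ ℕₚ.^-*-assoc p e n)

  ℕ-ℚ : ∀ x → fromℤ (+ x) ≡ ℕtoℚ x
  ℕ-ℚ x = ≡.sym (ℕtoℚ≡fromℤ x)

  pred-ℚ : ∀ x .{{_ : ℕ.NonZero x}} → ℕtoℚ x ≡ 1ℚ ℚ.+ ℕtoℚ (x ∸ 1)
  pred-ℚ x = cong ℕtoℚ (≡.sym (ℕₚ.m+[n∸m]≡n (ℕ.>-nonZero⁻¹ x))) ∙ ℕtoℚ-suc (x ∸ 1)

  unscale : ∀ {E} → + suc N′ ℤ.* (+ S ℤ.* + Ncount (suc N′) (k * t) t h s a γ) ≡ E → + suc N′ ℤ.* (+ S ℤ.* + Nt) ≡ E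
  unscale {E} = subst (λ q → + suc N′ ℤ.* (+ S ℤ.* + Ncount q (k * t) t h s a γ) ≡ E) q≡

  -- `ds` = d/s is 1/S, so multiplication by it removes S; the factor q left on both sides is then
  -- cancelled.
  divide : ∀ {E X} → + suc N′ ℤ.* (+ S ℤ.* + Nt) ≡ E → q₁ ℚ.* X ≡ fromℤ E → ℕtoℚ Nt ≡ ds ℚ.* X
  divide {E} {X} E≡ X≡ = ℕtoℚ-cancel (suc N′) (begin
    ℕtoℚ Nt ℚ.* ℕtoℚ (suc N′)
      ≡⟨ cong (ℚ._* (ℕtoℚ Nt ℚ.* ℕtoℚ (suc N′))) ds*S ∙ ℚₚ.*-identityˡ _ ⟨
    ds ℚ.* ℕtoℚ S ℚ.* (ℕtoℚ Nt ℚ.* ℕtoℚ (suc N′))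
      ≡⟨ lemma ds (ℕtoℚ S) (ℕtoℚ Nt) (ℕtoℚ (suc N′)) ⟩
    ds ℚ.* (ℕtoℚ (suc N′) ℚ.* (ℕtoℚ S ℚ.* ℕtoℚ Nt))
      ≡⟨ cong (ds ℚ.*_) (cong₂ ℚ._*_ (ℕtoℚ≡fromℤ (suc N′)) (cong₂ ℚ._*_ (ℕtoℚ≡fromℤ S) (ℕtoℚ≡fromℤ Nt) ∙ ≡.sym (fromℤ-* (+ S) (+ Nt))) ∙ ≡.sym (fromℤ-* (+ suc N′) (+ S ℤ.* + Nt))) ⟩
    ds ℚ.* fromℤ (+ suc N′ ℤ.* (+ S ℤ.* + Nt))
      ≡⟨ cong (ds ℚ.*_) (cong fromℤ E≡ ∙ ≡.sym X≡) ⟩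
    ds ℚ.* (q₁ ℚ.* X)
      ≡⟨ lemma′ ds q₁ X ∙ cong (ds ℚ.* X ℚ.*_) (≡.sym (ℕtoℚ-suc N′)) ⟩
    ds ℚ.* X ℚ.* ℕtoℚ (suc N′) ∎)
    where
    open ≡.≡-Reasoning
    lemma : ∀ d S x q → d ℚ.* S ℚ.* (x ℚ.* q) ≡ d ℚ.* (q ℚ.* (S ℚ.* x))
    lemma = solve-∀-in ℚ-ring
    lemma′ : ∀ d q x → d ℚ.* (q ℚ.* x) ≡ d ℚ.* x ℚ.* q
    lemma′ = solve-∀-in ℚ-ring

  module At (i₀ : ℕ) (i₀-solves : + S S.∣ (+ (k₁ * i₀) ℤ.- + h₁)) where

    private
      D₀ : ℤ
      D₀ = + κᴸ ℤ.- + i₀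

      κl : + l S.∣ (+ κᴸ ℤ.- + kN p e n l t)
      κl = κᴸ-mod {l} {u * R} (≡.sym (ℕₚ.*-assoc l u R) ∙ cong (_* R) (≡.sym S≡lu) ∙ SR≡M₀)

    -- The last hypothesis is what each case has to supply: a polynomial identity without divisions,
    -- in which q appears as 1 + (q - 1) and l, where l - 1 is wanted, as 1 + (l - 1).
    zero-ℚ : a ≈ 0# → ∀ {v v° l° X} → [ l ∣ D₀ ] ≡ v → fromℤ v ≡ v° → ℕtoℚ l ≡ l° →
      q₁ ℚ.* X ≡ (q₁ ℚ.* Q₁ ℚ.- 1ℚ) ℚ.+ ((ε ℚ.* (R₀ ℚ.* q₁) ℚ.- 1ℚ) ℚ.* ℕtoℚ N′ ℚ.-
        ε ℚ.* (R₀ ℚ.* q₁) ℚ.* (ℕtoℚ N′ ℚ.* (l° ℚ.* v°))) →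
      ℕtoℚ Nt ≡ ds ℚ.* X
    zero-ℚ a≈0 v≡ v°≡ l°≡ X≡ = divide (unscale (F.formula-zero {i₀} i₀-solves a≈0)) (X≡ ∙ ≡.sym
      (fromℤ-zero (+ N) (σ (suc P₁) (n * t)) (+ N′) (+ l) [ l ∣ D₀ ] N-ℚ σᴸ-ℚ (ℕ-ℚ N′) (ℕ-ℚ l ∙ l°≡) (cong fromℤ v≡ ∙ v°≡)))

    zero-no : a ≈ 0# → ¬ ((+ i₀) ≡ (+ kN p e n l t) [modℤ l ]) →
      ℕtoℚ Nt ≡ ds ℚ.* (Q₁ ℚ.- 1ℚ ℚ.+ ε ℚ.* ℕtoℚ N′ ℚ.* R₀)
    zero-no a≈0 i₀≢ = zero-ℚ a≈0 (⟦⟧-no (+ l S.∣? D₀) l∤D₀) fromℤ-0 ≡.refl (lemma (ℕtoℚ N′) Q₁ ε R₀ (ℕtoℚ l))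
      where
      l∤D₀ : ¬ (+ l S.∣ D₀)
      l∤D₀ l∣D₀ = i₀≢ (unsigned (subst (+ l S.∣_) (difference (+ κᴸ) (+ kN p e n l t) (+ i₀)) (S.∣m∣n⇒∣m-n κl l∣D₀)))
        where
        difference : ∀ κ k i → (κ ℤ.- k) ℤ.- (κ ℤ.- i) ≡ i ℤ.- k
        difference = solve-∀
      lemma : ∀ N′ Q₁ ε R l → (1ℚ ℚ.+ N′) ℚ.* (Q₁ ℚ.- 1ℚ ℚ.+ ε ℚ.* N′ ℚ.* R) ≡ ((1ℚ ℚ.+ N′) ℚ.* Q₁ ℚ.- 1ℚ) ℚ.+ ((ε ℚ.* (R ℚ.* (1ℚ ℚ.+ N′)) ℚ.- 1ℚ) ℚ.* N′ ℚ.-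
        ε ℚ.* (R ℚ.* (1ℚ ℚ.+ N′)) ℚ.* (N′ ℚ.* (l ℚ.* 0ℚ)))
      lemma = solve-∀-in ℚ-ring

    zero-yes : a ≈ 0# → l ≡ 1 ⊎ (1 < l × (+ i₀) ≡ (+ kN p e n l t) [modℤ l ]) →
      ℕtoℚ Nt ≡ ds ℚ.* (Q₁ ℚ.- 1ℚ ℚ.- ε ℚ.* ℕtoℚ N′ ℚ.* ℕtoℚ (l ∸ 1) ℚ.* R₀)
    zero-yes a≈0 i₀≡ = zero-ℚ a≈0 (⟦⟧-yes (+ l S.∣? D₀) (l∣D₀ i₀≡)) fromℤ-1 (pred-ℚ l)
      (lemma (ℕtoℚ N′) Q₁ ε R₀ (ℕtoℚ (l ∸ 1)))
      where
      l∣D₀ : l ≡ 1 ⊎ (1 < l × (+ i₀) ≡ (+ kN p e n l t) [modℤ l ]) → + l S.∣ D₀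
      l∣D₀ (inj₁ l≡1) = subst (λ l → + l S.∣ D₀) (≡.sym l≡1) (S.divides D₀ (≡.sym (ℤₚ.*-identityʳ D₀)))
      l∣D₀ (inj₂ (_ , w , eq)) = subst (+ l S.∣_) (difference (+ κᴸ) (+ kN p e n l t) (+ i₀))
        (S.∣m∣n⇒∣m-n κl (S.divides w eq))
        where
        difference : ∀ κ k i → (κ ℤ.- k) ℤ.- (i ℤ.- k) ≡ κ ℤ.- i
        difference = solve-∀
      lemma : ∀ N′ Q₁ ε R l₁ → (1ℚ ℚ.+ N′) ℚ.* (Q₁ ℚ.- 1ℚ ℚ.- ε ℚ.* N′ ℚ.* l₁ ℚ.* R) ≡ ((1ℚ ℚ.+ N′) ℚ.* Q₁ ℚ.- 1ℚ) ℚ.+ ((ε ℚ.* (R ℚ.* (1ℚ ℚ.+ N′)) ℚ.- 1ℚ) ℚ.* N′ ℚ.-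
        ε ℚ.* (R ℚ.* (1ℚ ℚ.+ N′)) ℚ.* (N′ ℚ.* ((1ℚ ℚ.+ l₁) ℚ.* 1ℚ)))
      lemma = solve-∀-in ℚ-ring

    module Unit {a⁻¹ : Carrier} (aa⁻¹≈1 : a ⊗ a⁻¹ ≈ 1#)
      {ind : ℕ} (ind≡ : pow (NmRel q t k γ) ind ≈ ⊖ (ι k ⊗ a⁻¹)) where

      private
        ind≡′ : pow (NmRel (suc N′) t k γ) ind ≈ ⊖ (ι k ⊗ a⁻¹)
        ind≡′ = subst (λ q → pow (NmRel q t k γ) ind ≈ ⊖ (ι k ⊗ a⁻¹)) (≡.sym q≡) ind≡

      module _ {D : ℤ} (D≡ : + S S.∣ (D ℤ.- (+ κᴸ ℤ.- + i₀ ℤ.- + ind))) where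

        insoluble-ℚ : ¬ (+ l S.∣ D) → ℕtoℚ Nt ≡ ds ℚ.* (Q₁ ℚ.- ε ℚ.* R₀)
        insoluble-ℚ l∤D = divide (unscale (F.formula-insoluble {i₀} i₀-solves aa⁻¹≈1 {ind} ind≡′ {D} D≡ l∤D)) (lemma (ℕtoℚ N′) Q₁ ε R₀ ∙
          ≡.sym (fromℤ-insoluble (+ N) (σ (suc P₁) (n * t)) N-ℚ σᴸ-ℚ))
          where
          lemma : ∀ N′ Q₁ ε R → (1ℚ ℚ.+ N′) ℚ.* (Q₁ ℚ.- ε ℚ.* R) ≡ ((1ℚ ℚ.+ N′) ℚ.* Q₁ ℚ.- 1ℚ) ℚ.- (ε ℚ.* (R ℚ.* (1ℚ ℚ.+ N′)) ℚ.- 1ℚ)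
          lemma = solve-∀-in ℚ-ring

        soluble-ℚ : ∀ {D′ j₀} → D ≡ D′ ℤ.* + l → + u S.∣ (+ (τ * j₀) ℤ.- D′) →
          ∀ {v v° u° σ° X} → [ u ∣ + j₀ ℤ.- + κᵏ ] ≡ v → fromℤ v ≡ v° → ℕtoℚ u ≡ u° → sgn n ≡ σ° →
          q₁ ℚ.* X ≡ (q₁ ℚ.* Q₁ ℚ.- 1ℚ) ℚ.- (ε ℚ.* (R₀ ℚ.* q₁) ℚ.- 1ℚ) ℚ.-
            ε ℚ.* (R₀ ℚ.* q₁) ℚ.* (ℕtoℚ l ℚ.* (σ° ℚ.* √q ℚ.* (1ℚ ℚ.- u° ℚ.* v°) ℚ.- 1ℚ)) →
          ℕtoℚ Nt ≡ ds ℚ.* X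
        soluble-ℚ {D′} {j₀} D≡D′l u∣ v≡ v°≡ u°≡ σ°≡ X≡ = divide (unscale (F.formula-soluble {i₀} i₀-solves aa⁻¹≈1 {ind} ind≡′ {D} D≡ {D′} {j₀} D≡D′l u∣)) (X≡ ∙ ≡.sym
          (fromℤ-soluble (+ N) (σ (suc P₁) (n * t)) (+ l) (σ (suc P₁) n) (+ u) [ u ∣ + j₀ ℤ.- + κᵏ ] N-ℚ σᴸ-ℚ (ℕ-ℚ l)
            (σᵏ-ℚ ∙ cong (ℚ._* √q) σ°≡) (ℕ-ℚ u ∙ u°≡) (cong fromℤ v≡ ∙ v°≡)))

        soluble-no : ∀ {D′ j₀} → D ≡ D′ ℤ.* + l → + u S.∣ (+ (τ * j₀) ℤ.- D′) → ¬ ((+ j₀) ≡ (+ kN p e n u 1) [modℤ u ]) →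
          ℕtoℚ Nt ≡ ds ℚ.* (Q₁ ℚ.- ε ℚ.* ((sgn n ℚ.* √q ℚ.- 1ℚ) ℚ.* ℕtoℚ l ℚ.+ 1ℚ) ℚ.* R₀)
        soluble-no {D′} {j₀} D≡D′l u∣ j₀≢ = soluble-ℚ {D′} {j₀} D≡D′l u∣ (⟦⟧-no (+ u S.∣? (+ j₀ ℤ.- + κᵏ)) u∤) fromℤ-0 ≡.refl ≡.refl
          (lemma (ℕtoℚ N′) Q₁ ε R₀ (ℕtoℚ l) (sgn n ℚ.* √q) (ℕtoℚ u))
          where
          u∤ : ¬ (+ u S.∣ (+ j₀ ℤ.- + κᵏ))
          u∤ u∣j = j₀≢ (unsigned (subst (+ u S.∣_) (add (+ j₀) (+ κᵏ) (+ kN p e n u 1)) (S.∣m∣n⇒∣m+n u∣j κᵏ-mod)))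
            where
            add : ∀ j κ k → (j ℤ.- κ) ℤ.+ (κ ℤ.- k) ≡ j ℤ.- k
            add = solve-∀
          lemma : ∀ N′ Q₁ ε R l σ u → (1ℚ ℚ.+ N′) ℚ.* (Q₁ ℚ.- ε ℚ.* ((σ ℚ.- 1ℚ) ℚ.* l ℚ.+ 1ℚ) ℚ.* R) ≡
            ((1ℚ ℚ.+ N′) ℚ.* Q₁ ℚ.- 1ℚ) ℚ.- (ε ℚ.* (R ℚ.* (1ℚ ℚ.+ N′)) ℚ.- 1ℚ) ℚ.-
            ε ℚ.* (R ℚ.* (1ℚ ℚ.+ N′)) ℚ.* (l ℚ.* (σ ℚ.* (1ℚ ℚ.- u ℚ.* 0ℚ) ℚ.- 1ℚ))
          lemma = solve-∀-in ℚ-ring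

        soluble-yes : ∀ {D′ j₀} → D ≡ D′ ℤ.* + l → + u S.∣ (+ (τ * j₀) ℤ.- D′) →
          u ≡ 1 ⊎ (1 < u × (+ j₀) ≡ (+ kN p e n u 1) [modℤ u ]) →
          ℕtoℚ Nt ≡ ds ℚ.* (Q₁ ℚ.- ε ℚ.* ((sgn (n ∸ 1) ℚ.* ℕtoℚ (u ∸ 1) ℚ.* √q ℚ.- 1ℚ) ℚ.* ℕtoℚ l ℚ.+ 1ℚ) ℚ.* R₀)
        soluble-yes {D′} {j₀} D≡D′l u∣ j₀≡ = soluble-ℚ {D′} {j₀} D≡D′l u∣ (⟦⟧-yes (+ u S.∣? (+ j₀ ℤ.- + κᵏ)) (u∣j j₀≡)) fromℤ-1 (pred-ℚ u)
          -- n ≥ 1 makes the truncated n - 1 exact. The sign (-1)^n = -(-1)^(n-1) combines with 1 -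
          -- u = -(u - 1) to give the form with (-1)^(n-1) (u - 1).
          (cong sgn (≡.sym (ℕₚ.m+[n∸m]≡n 0<n)) ∙ sgn-suc (n ∸ 1))
          (lemma (ℕtoℚ N′) Q₁ ε R₀ (ℕtoℚ l) (sgn (n ∸ 1)) √q (ℕtoℚ (u ∸ 1)))
          where
          u∣j : u ≡ 1 ⊎ (1 < u × (+ j₀) ≡ (+ kN p e n u 1) [modℤ u ]) → + u S.∣ (+ j₀ ℤ.- + κᵏ)
          u∣j (inj₁ u≡1) = subst (λ u → + u S.∣ (+ j₀ ℤ.- + κᵏ)) (≡.sym u≡1) (S.divides (+ j₀ ℤ.- + κᵏ) (≡.sym (ℤₚ.*-identityʳ (+ j₀ ℤ.- + κᵏ))))
          u∣j (inj₂ (_ , w , eq)) = subst (+ u S.∣_) (difference (+ j₀) (+ κᵏ) (+ kN p e n u 1))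
            (S.∣m∣n⇒∣m-n (S.divides w eq) κᵏ-mod)
            where
            difference : ∀ j κ k → (j ℤ.- k) ℤ.- (κ ℤ.- k) ≡ j ℤ.- κ
            difference = solve-∀
          lemma : ∀ N′ Q₁ ε R l σ √q u₁ → (1ℚ ℚ.+ N′) ℚ.* (Q₁ ℚ.- ε ℚ.* ((σ ℚ.* u₁ ℚ.* √q ℚ.- 1ℚ) ℚ.* l ℚ.+ 1ℚ) ℚ.* R) ≡
            ((1ℚ ℚ.+ N′) ℚ.* Q₁ ℚ.- 1ℚ) ℚ.- (ε ℚ.* (R ℚ.* (1ℚ ℚ.+ N′)) ℚ.- 1ℚ) ℚ.-
            ε ℚ.* (R ℚ.* (1ℚ ℚ.+ N′)) ℚ.* (l ℚ.* ((ℚ.- σ) ℚ.* √q ℚ.* (1ℚ ℚ.- (1ℚ ℚ.+ u₁) ℚ.* 1ℚ) ℚ.- 1ℚ))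
          lemma = solve-∀-in ℚ-ring

      -- The theorem forms D with k_S(t), while the periods produce the class κ modulo P + 1. The
      -- two agree modulo S, and D matters only modulo S.
      discriminant : + S S.∣ ((+ kN p e n S t ℤ.- + i₀ ℤ.- + ind) ℤ.- (+ κᴸ ℤ.- + i₀ ℤ.- + ind))
      discriminant = subst (+ S S.∣_) (lemma (+ kN p e n S t) (+ κᴸ) (+ ind) (+ i₀))
        (S.∣m⇒∣-m (κᴸ-mod {S} {R} SR≡M₀))
        where
        lemma : ∀ k κ x i → ℤ.- (κ ℤ.- k) ≡ (k ℤ.- i ℤ.- x) ℤ.- (κ ℤ.- i ℤ.- x)
        lemma = solve-∀

  -- The two special cases of the theorem do not mention i₀, so a solution has to be produced for
  -- them.
  i₀-exists : ∃ λ i₀ → i₀ < S × + S S.∣ (+ (k₁ * i₀) ℤ.- + h₁)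
  i₀-exists = solve-congruence k₁⊥S (+ h₁)

  zero-l≡1 : a ≈ 0# → l ≡ 1 → ℕtoℚ Nt ≡ ds ℚ.* (Q₁ ℚ.- 1ℚ)
  zero-l≡1 a≈0 l≡1 = At.zero-yes i₀ solves a≈0 (inj₁ l≡1) ∙
    cong (ds ℚ.*_) (collapse-zero Q₁ ε (ℕtoℚ N′) R₀ l≡1)
    where
    i₀ = proj₁ i₀-exists
    solves = proj₂ (proj₂ i₀-exists)

  unit-d≡s : ¬ (a ≈ 0#) → d ≡ s → ℕtoℚ Nt ≡ Q₁
  unit-d≡s a≉0 d≡s = At.Unit.soluble-yes i₀ solves aa⁻¹≈1 {ind} ind≡ {D} D∣ {D} {0} D≡D*l u∣ (inj₁ u≡1) ∙
    cong (ds ℚ.*_) (collapse-unit Q₁ ε (sgn (n ∸ 1)) √q R₀ l≡1 u≡1) ∙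
      cong (ℚ._* Q₁) ds≡1 ∙ ℚₚ.*-identityˡ Q₁
    where
    i₀ : ℕ
    i₀ = proj₁ i₀-exists
    solves : + S S.∣ (+ (k₁ * i₀) ℤ.- + h₁)
    solves = proj₂ (proj₂ i₀-exists)
    a⁻¹ : Carrier
    a⁻¹ = proj₁ (inverse a a≉0)
    aa⁻¹≈1 : a ⊗ a⁻¹ ≈ 1#
    aa⁻¹≈1 = proj₂ (inverse a a≉0)
    ind : ℕ
    ind = proj₁ (F.ind-exists aa⁻¹≈1)
    ind≡ : pow (NmRel q t k γ) ind ≈ ⊖ (ι k ⊗ a⁻¹)
    ind≡ = subst (λ q → pow (NmRel q t k γ) ind ≈ ⊖ (ι k ⊗ a⁻¹)) q≡ (proj₂ (F.ind-exists aa⁻¹≈1))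
    S≡1 : S ≡ 1
    S≡1 = ℕₚ.*-cancelˡ-≡ S 1 d (≡.sym s≡dS ∙ ≡.sym d≡s ∙ ≡.sym (ℕₚ.*-identityʳ d))
    lu≡1 : l * u ≡ 1
    lu≡1 = ≡.sym S≡lu ∙ S≡1
    l≡1 : l ≡ 1
    l≡1 = ℕₚ.m*n≡1⇒m≡1 l u lu≡1
    u≡1 : u ≡ 1
    u≡1 = ℕₚ.m*n≡1⇒n≡1 l u lu≡1
    ds≡1 : ds ≡ 1ℚ
    ds≡1 = ≡.sym (ℚₚ.*-identityʳ ds) ∙ cong (ds ℚ.*_) (≡.sym (ℕtoℚ≡fromℤ 1 ∙ fromℤ-1) ∙ cong ℕtoℚ (≡.sym S≡1)) ∙ ds*S
    -- d = s forces S = l = u = 1, so all congruences hold: D can be taken as it arises from the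
    -- periods, with itself as quotient by l and with j₀ = 0.
    D : ℤ
    D = + κᴸ ℤ.- + i₀ ℤ.- + ind
    D∣ : + S S.∣ (D ℤ.- D)
    D∣ = S.divides 0ℤ (ℤₚ.+-inverseʳ D)
    D≡D*l : D ≡ D ℤ.* + l
    D≡D*l = ≡.sym (ℤₚ.*-identityʳ D) ∙ cong (λ x → D ℤ.* + x) (≡.sym l≡1)
    u∣ : + u S.∣ (+ (τ * 0) ℤ.- D)
    u∣ = subst (λ u → + u S.∣ (+ (τ * 0) ℤ.- D)) (≡.sym u≡1) (S.divides (+ (τ * 0) ℤ.- D) (≡.sym (ℤₚ.*-identityʳ (+ (τ * 0) ℤ.- D))))

theorem4 : ∀ {c ℓ : Level} (K : FiniteField c ℓ) →
  let open FF K in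
  (p e n m t k s h : ℕ) (a γm : F) →
  Prime p → 1 ≤ e → 1 ≤ n →
  1 < s → s ∣ (p ^ e + 1) → h < s →
  2 ≤ m → m ≡ k * t →
  ¬ (p ∣ k) → gcd k s ∣ h →
  card ≡ (p ^ (2 * e * n)) ^ m →
  pow a (p ^ (2 * e * n)) ≈F a →
  Primitive γm →
  let r  = 2 * e * n
      q  = p ^ r
      d  = gcd k s
      l  = gcd t (s div d)
      u  = s div (d * l)
      t₀ = (q ^ t ∸ 1) div (q ∸ 1)
      γt = NmRel q t k γm
      Nt = ℕtoℚ (Ncount q m t h s a γm)
      R  = sqrtQPow p e n t
      √q = ℕtoℚ (p ^ (e * n))
      ds = ℕtoℚ d /ℚ s
      Q₁ = ℕtoℚ (q ^ (t ∸ 1))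
      ε  = sgn (n * t)
  in
  ((a ≈F 0F → l ≡ 1 → Nt ≡ ds ℚ.* (Q₁ ℚ.- ℚ.1ℚ))
   × (¬ (a ≈F 0F) → d ≡ s → Nt ≡ Q₁))
  ×
  (∀ i₀ → i₀ < s div d →
    (+ (k div d * i₀)) ≡ (+ (h div d)) [modℤ s div d ] →
    -- (A)
    ((a ≈F 0F →
      ((1 < l → ¬ ((+ i₀) ≡ (+ kN p e n l t) [modℤ l ]) →
         Nt ≡ ds ℚ.* (Q₁ ℚ.- ℚ.1ℚ ℚ.+ ε ℚ.* ℕtoℚ (q ∸ 1) ℚ.* R))
       ×
       ((l ≡ 1 ⊎ (1 < l × (+ i₀) ≡ (+ kN p e n l t) [modℤ l ])) →
         Nt ≡ ds ℚ.* (Q₁ ℚ.- ℚ.1ℚ ℚ.- ε ℚ.* ℕtoℚ (q ∸ 1) ℚ.* ℕtoℚ (l ∸ 1) ℚ.* R))))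
    ×
    -- (B)
    (¬ (a ≈F 0F) → ∀ a⁻¹ → a · a⁻¹ ≈F 1F →
      ∀ ind → ind < q ^ t ∸ 1 → pow γt ind ≈F negF (ι k · a⁻¹) →
      let D = (+ kN p e n (s div d) t) ℤ.- (+ i₀) ℤ.- (+ ind) in
      ((¬ ((+ l) ∣ℤ D) →
         Nt ≡ ds ℚ.* (Q₁ ℚ.- ε ℚ.* R))
       ×
       (∀ D/l → D ≡ D/l ℤ.* (+ l) →
         ∀ j₀ → j₀ < u →
         (+ (t₀ div l * j₀)) ≡ D/l [modℤ u ] →
         ((1 < u → ¬ ((+ j₀) ≡ (+ kN p e n u 1) [modℤ u ]) →
            Nt ≡ ds ℚ.* (Q₁ ℚ.- ε ℚ.* ((sgn n ℚ.* √q ℚ.- ℚ.1ℚ) ℚ.* ℕtoℚ l ℚ.+ ℚ.1ℚ) ℚ.* R))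
          ×
          ((u ≡ 1 ⊎ (1 < u × (+ j₀) ≡ (+ kN p e n u 1) [modℤ u ])) →
            Nt ≡ ds ℚ.* (Q₁ ℚ.- ε ℚ.* ((sgn (n ∸ 1) ℚ.* ℕtoℚ (u ∸ 1) ℚ.* √q ℚ.- ℚ.1ℚ) ℚ.* ℕtoℚ l ℚ.+ ℚ.1ℚ) ℚ.* R))))))))
theorem4 K p e n m t k s h a γm p-prime 1≤e 1≤n 1<s s∣M h<s 2≤m ≡.refl p∤k d∣h card≡ ma prim =
  (zero-l≡1 , unit-d≡s) ,
  λ i₀ _ i₀≡ →
    let open At i₀ (signed i₀≡) in
    (λ a≈0 → (λ _ → zero-no a≈0) , zero-yes a≈0) ,
    λ a≉0 a⁻¹ aa⁻¹≈1 ind _ ind≡ →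
      let open Unit aa⁻¹≈1 {ind} ind≡ in
      (λ l∤D → insoluble-ℚ discriminant (λ l∣D → l∤D (unsigned l∣D))) ,
      λ D/l D≡ j₀ _ j₀≡ →
        (λ _ → soluble-no discriminant {D/l} {j₀} D≡ (signed j₀≡)) ,
        soluble-yes discriminant {D/l} {j₀} D≡ (signed j₀≡)
  where
  open Assembly K p e n k t s h a γm p-prime 1≤e 1≤n 1<s s∣M 2≤m p∤k d∣h card≡ ma prim
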